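{- Let $K$ be a number field (viewed inside $\mathbb{C}$), let $n\ge 1$, and let $A=[a_{ij}]\in \mathrm{GL}_n(K)$ with combined matrix $\mathcal{C}(A)=A\circ (A^{ -1})^T$. Let $\lambda_1,\ldots,\lambda_n\in\mathbb{C}$ be the eigenvalues of $\mathcal{C}(A)$ counted with multiplicity and let $L=K[\lambda_1,\ldots,\lambda_n]$. Let $A_{ij}$ denote the $(i,j)$ minor of $A$. Then: 1. $\mathcal{C}(A)=[m_{ij}]_{n\times n}$ with $m_{ij}=\dfrac{(-1)^{i+j}}{\det A}\,a_{ij}A_{ij}$. 2. $\mathrm{Tr}(\mathcal{C}(A))=\dfrac{1}{\det A}\displaystyle\sum_{i=1}^n a_{ii}A_{ii}$. 3. $1$ is an eigenvalue of $\mathcal{C}(A)$, with eigenvector $v_1=\displaystyle\sum_{k=1}^n e_k$, where $e_1,\ldots,e_n$ is the canonical basis. 4. $\mathrm{Gal}(L/K)$ is isomorphic to a subgroup of the symmetric group $S_{n-1}$. 5. $\mathcal{C}(\mathcal{R}(A))=\mathcal{R}(\mathcal{C}(A))$, where $\mathcal{R}$ is the reversing operation on $n\times n$ matrices.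
   Context: A number field is a finite extension of $\mathbb{Q}$. $\circ$ denotes the Hadamard (entrywise) product of matrices; the combined matrix of a non-singular matrix $A$ is $\mathcal{C}(A)=A\circ (A^{ -1})^T$. The minor $A_{ij}$ is the determinant of the submatrix of $A$ obtained by deleting row $i$ and column $j$. $\mathrm{Gal}(L/K)$ is the group of field automorphisms of $L$ fixing $K$ pointwise. $S_m$ is the symmetric group of order $m!$ ($S_0$ is trivial). Reversing: for an $n\times n$ matrix $M$, $\mathcal{R}(M)=JMJ$, where $J=[\delta_{i,n-j+1}]_{n\times n}$ is the matrix with ones on the antidiagonal and zeros elsewhere (so $J^2=I_n$); i.e. the $(i,j)$ entry of $\mathcal{R}(M)$ is the $(n+1-i,n+1-j)$ entry of $M$. -}

module Defs where

open import Algebra.Bundles using (Group)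
open import Algebra.Bundles.Raw using (RawRing; RawGroup)
import Algebra.Definitions.RawSemiring as RawSemiringDefs
open import Algebra.Morphism.Structures using (IsRingHomomorphism; IsGroupIsomorphism)
import Algebra.Morphism.Construct.Composition as Compose
import Algebra.Morphism.Construct.Identity as Identity
open import Data.Bool.Base using (if_then_else_)
open import Data.Fin.Base using (Fin; zero; suc; toℕ; punchIn; opposite)
open import Data.Fin.Permutation as Perm using (Permutation′; _⟨$⟩ʳ_; _⟨$⟩ˡ_)
open import Data.Fin.Properties using (_≟_)
open import Data.List.Base as List using (List; []; _∷_)
open import Data.Nat.Base using (ℕ; zero; suc; _⊔_; _≥_)
import Data.Nat.Properties as ℕ
open import Data.Product.Base using (Σ; Σ-syntax; _×_; _,_; proj₁; proj₂)
open import Data.Rational.Base as ℚ using (ℚ; 0ℚ; 1ℚ; ½)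
import Data.Rational.Properties as ℚ
open import Data.Rational.Solver using (module +-*-Solver)
open import Data.Vec.Functional using (Vector)
open import Function.Base using (_∘_; id)
open import Level using (Level; 0ℓ) renaming (suc to lsuc; _⊔_ to _⊔ˡ_)
open import Relation.Binary.Core using (Rel)
open import Relation.Binary.PropositionalEquality
  using (_≡_; refl; sym; trans; cong; subst)
open import Relation.Binary.Structures using (IsEquivalence)
open import Relation.Nullary using (¬_; does)
open import Relation.Unary using (Pred; _∈_)

private
  variable
    a ℓ ℓ₁ ℓ₂ : Level
    n : ℕ

------------------------------------------------------------------------
-- Real numbers: Cauchy sequences of rationals, with equality _≈ʳ_ modulo null
-- sequences, so that all operations are pointwise

record ℝ : Set where
  constructor mkℝ
  field
    seq    : ℕ → ℚ
    cauchy : ∀ ε → 0ℚ ℚ.< ε →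
             Σ[ N ∈ ℕ ] (∀ m n → m ≥ N → n ≥ N → ℚ.∣ seq m ℚ.- seq n ∣ ℚ.< ε)

open ℝ public

infix 4 _≈ʳ_

record _≈ʳ_ (x y : ℝ) : Set where
  constructor mk≈ʳ
  field
    close : ∀ ε → 0ℚ ℚ.< ε →
            Σ[ N ∈ ℕ ] (∀ n → n ≥ N → ℚ.∣ seq x n ℚ.- seq y n ∣ ℚ.< ε)

open _≈ʳ_ public

private
  ∣p-p∣<ε : ∀ p {ε} → 0ℚ ℚ.< ε → ℚ.∣ p ℚ.- p ∣ ℚ.< ε
  ∣p-p∣<ε p 0<ε = subst (ℚ._< _) (sym (cong ℚ.∣_∣ (ℚ.+-inverseʳ p))) 0<ε

  ∣p-q∣≡∣q-p∣ : ∀ p q → ℚ.∣ p ℚ.- q ∣ ≡ ℚ.∣ q ℚ.- p ∣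
  ∣p-q∣≡∣q-p∣ p q = trans (sym (ℚ.∣-p∣≡∣p∣ (p ℚ.- q))) (cong ℚ.∣_∣ lemma)
    where
    open +-*-Solver
    lemma : ℚ.- (p ℚ.- q) ≡ q ℚ.- p
    lemma = solve 2 (λ p q → :- (p :- q) := q :- p) refl p q

  ½*ε>0 : ∀ {ε} → 0ℚ ℚ.< ε → 0ℚ ℚ.< ½ ℚ.* ε
  ½*ε>0 {ε} 0<ε = subst (ℚ._< ½ ℚ.* ε) (ℚ.*-zeroʳ ½) (ℚ.*-monoʳ-<-pos ½ 0<ε)

  ½*ε+½*ε≡ε : ∀ ε → ½ ℚ.* ε ℚ.+ ½ ℚ.* ε ≡ ε
  ½*ε+½*ε≡ε ε = trans (sym (ℚ.*-distribʳ-+ ε ½ ½)) (ℚ.*-identityˡ ε)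

  split-∣-∣ : ∀ {p q r ε} → p ≡ q ℚ.+ r → ℚ.∣ q ∣ ℚ.< ½ ℚ.* ε →
              ℚ.∣ r ∣ ℚ.< ½ ℚ.* ε → ℚ.∣ p ∣ ℚ.< ε
  split-∣-∣ {q = q} {r} {ε} refl q<½ε r<½ε =
    ℚ.≤-<-trans (ℚ.∣p+q∣≤∣p∣+∣q∣ q r)
      (subst (ℚ.∣ q ∣ ℚ.+ ℚ.∣ r ∣ ℚ.<_) (½*ε+½*ε≡ε ε) (ℚ.+-mono-< q<½ε r<½ε))

≈ʳ-refl : ∀ {x} → x ≈ʳ x
≈ʳ-refl {x} .close ε 0<ε = 0 , λ n _ → ∣p-p∣<ε (seq x n) 0<ε

≈ʳ-sym : ∀ {x y} → x ≈ʳ y → y ≈ʳ x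
≈ʳ-sym {x} {y} x≈y .close ε 0<ε with N , x~y ← x≈y .close ε 0<ε =
  N , λ n n≥N → subst (ℚ._< ε) (∣p-q∣≡∣q-p∣ (seq x n) (seq y n)) (x~y n n≥N)

≈ʳ-trans : ∀ {x y z} → x ≈ʳ y → y ≈ʳ z → x ≈ʳ z
≈ʳ-trans {x} {y} {z} x≈y y≈z .close ε 0<ε
  with M , x~y ← x≈y .close (½ ℚ.* ε) (½*ε>0 0<ε)
     | N , y~z ← y≈z .close (½ ℚ.* ε) (½*ε>0 0<ε) =
  M ⊔ N , λ n n≥ → split-∣-∣ (lemma (seq x n) (seq y n) (seq z n))
                     (x~y n (ℕ.m⊔n≤o⇒m≤o M N n≥)) (y~z n (ℕ.m⊔n≤o⇒n≤o M N n≥))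
  where
  open +-*-Solver
  lemma : ∀ p q r → p ℚ.- r ≡ (p ℚ.- q) ℚ.+ (q ℚ.- r)
  lemma = solve 3 (λ p q r → p :- r := (p :- q) :+ (q :- r)) refl

constʳ : ℚ → ℝ
constʳ q = mkℝ (λ _ → q) (λ ε 0<ε → 0 , λ _ _ _ _ → ∣p-p∣<ε q 0<ε)

infixl 6 _+ʳ_
infixl 7 _*ʳ_
infix  8 -ʳ_

_+ʳ_ : ℝ → ℝ → ℝ
seq (x +ʳ y) n = seq x n ℚ.+ seq y n
cauchy (x +ʳ y) ε 0<ε
  with M , x~ ← cauchy x (½ ℚ.* ε) (½*ε>0 0<ε)
     | N , y~ ← cauchy y (½ ℚ.* ε) (½*ε>0 0<ε) =
  M ⊔ N , λ m n m≥ n≥ →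
    split-∣-∣ (lemma (seq x m) (seq y m) (seq x n) (seq y n))
      (x~ m n (ℕ.m⊔n≤o⇒m≤o M N m≥) (ℕ.m⊔n≤o⇒m≤o M N n≥))
      (y~ m n (ℕ.m⊔n≤o⇒n≤o M N m≥) (ℕ.m⊔n≤o⇒n≤o M N n≥))
  where
  open +-*-Solver
  lemma : ∀ p q r s → (p ℚ.+ q) ℚ.- (r ℚ.+ s) ≡ (p ℚ.- r) ℚ.+ (q ℚ.- s)
  lemma = solve 4 (λ p q r s → (p :+ q) :- (r :+ s) := (p :- r) :+ (q :- s)) refl

-ʳ_ : ℝ → ℝ
seq (-ʳ x) n = ℚ.- seq x n
cauchy (-ʳ x) ε 0<ε with N , x~ ← cauchy x ε 0<ε =
  N , λ m n m≥ n≥ →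
    subst (λ p → ℚ.∣ p ∣ ℚ.< ε) (lemma (seq x n) (seq x m)) (x~ n m n≥ m≥)
  where
  open +-*-Solver
  lemma : ∀ p q → p ℚ.- q ≡ (ℚ.- q) ℚ.- (ℚ.- p)
  lemma = solve 2 (λ p q → p :- q := (:- q) :- (:- p)) refl

private
  ∣p∣≤1+∣q∣ : ∀ p q → ℚ.∣ p ℚ.- q ∣ ℚ.< 1ℚ → ℚ.∣ p ∣ ℚ.≤ 1ℚ ℚ.+ ℚ.∣ q ∣
  ∣p∣≤1+∣q∣ p q p~q =
    ℚ.≤-trans (subst (λ r → ℚ.∣ r ∣ ℚ.≤ ℚ.∣ p ℚ.- q ∣ ℚ.+ ℚ.∣ q ∣) (lemma p q)
                (ℚ.∣p+q∣≤∣p∣+∣q∣ (p ℚ.- q) q))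
      (ℚ.+-monoˡ-≤ ℚ.∣ q ∣ (ℚ.<⇒≤ p~q))
    where
    open +-*-Solver
    lemma : ∀ p q → (p ℚ.- q) ℚ.+ q ≡ p
    lemma = solve 2 (λ p q → (p :- q) :+ q := p) refl

eventuallyBounded : ∀ x → Σ[ B ∈ ℚ ] (0ℚ ℚ.< B) ×
                    Σ[ N ∈ ℕ ] (∀ n → n ≥ N → ℚ.∣ seq x n ∣ ℚ.≤ B)
eventuallyBounded x with N , x~ ← cauchy x 1ℚ (ℚ.positive⁻¹ 1ℚ) =
  1ℚ ℚ.+ ℚ.∣ seq x N ∣ ,
  ℚ.+-mono-<-≤ (ℚ.positive⁻¹ 1ℚ) (ℚ.0≤∣p∣ (seq x N)) ,
  N , λ n n≥N → ∣p∣≤1+∣q∣ (seq x n) (seq x N) (x~ n N n≥N ℕ.≤-refl)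

private
  -- Some δ > 0 with B * δ = η.
  rescale : ∀ {B η} → 0ℚ ℚ.< B → 0ℚ ℚ.< η → Σ[ δ ∈ ℚ ] (0ℚ ℚ.< δ) × (B ℚ.* δ ≡ η)
  rescale {B} {η} 0<B 0<η =
    B⁻¹ ℚ.* η ,
    subst (ℚ._< B⁻¹ ℚ.* η) (ℚ.*-zeroʳ B⁻¹) (ℚ.*-monoʳ-<-pos B⁻¹ {{ℚ.1/pos⇒pos B}} 0<η) ,
    trans (sym (ℚ.*-assoc B B⁻¹ η))
      (trans (cong (ℚ._* η) (ℚ.*-inverseʳ B)) (ℚ.*-identityˡ η))
    where
    instance
      B-pos : ℚ.Positive B
      B-pos = ℚ.positive 0<B
      B≢0 : ℚ.NonZero B
      B≢0 = ℚ.pos⇒nonZero B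
    B⁻¹ = ℚ.1/ B

  ∣p*q∣<η : ∀ {p q B δ η} → 0ℚ ℚ.< B → ℚ.∣ p ∣ ℚ.≤ B → ℚ.∣ q ∣ ℚ.< δ → B ℚ.* δ ≡ η →
            ℚ.∣ p ℚ.* q ∣ ℚ.< η
  ∣p*q∣<η {p} {q} {B} {δ} 0<B p≤B q<δ refl =
    subst (ℚ._< B ℚ.* δ) (sym (ℚ.∣p*q∣≡∣p∣*∣q∣ p q))
      (ℚ.≤-<-trans (ℚ.*-monoʳ-≤-nonNeg ℚ.∣ q ∣ {{ℚ.nonNegative (ℚ.0≤∣p∣ q)}} p≤B)
                   (ℚ.*-monoʳ-<-pos B {{ℚ.positive 0<B}} q<δ))

private
  ∣p*q-r*s∣<ε : ∀ {p q r s B C δ η ε} → 0ℚ ℚ.< B → 0ℚ ℚ.< C →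
    ℚ.∣ p ∣ ℚ.≤ B → ℚ.∣ s ∣ ℚ.≤ C → ℚ.∣ q ℚ.- s ∣ ℚ.< δ → ℚ.∣ p ℚ.- r ∣ ℚ.< η →
    B ℚ.* δ ≡ ½ ℚ.* ε → C ℚ.* η ≡ ½ ℚ.* ε → ℚ.∣ p ℚ.* q ℚ.- r ℚ.* s ∣ ℚ.< ε
  ∣p*q-r*s∣<ε {p} {q} {r} {s} 0<B 0<C p≤B s≤C q~s p~r Bδ≡ Cη≡ =
    split-∣-∣ (lemma p q r s) (∣p*q∣<η {p} 0<B p≤B q~s Bδ≡) (∣p*q∣<η {s} 0<C s≤C p~r Cη≡)
    where
    open +-*-Solver
    lemma : ∀ p q r s → (p ℚ.* q) ℚ.- (r ℚ.* s) ≡ p ℚ.* (q ℚ.- s) ℚ.+ s ℚ.* (p ℚ.- r)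
    lemma = solve 4 (λ p q r s → (p :* q) :- (r :* s) := p :* (q :- s) :+ s :* (p :- r)) refl

  *-cauchy : ∀ x y ε → 0ℚ ℚ.< ε →
    Σ[ N ∈ ℕ ] (∀ m n → m ≥ N → n ≥ N →
      ℚ.∣ seq x m ℚ.* seq y m ℚ.- seq x n ℚ.* seq y n ∣ ℚ.< ε)
  *-cauchy x y ε 0<ε =
    let B , 0<B , M , x≤B = eventuallyBounded x
        C , 0<C , N , y≤C = eventuallyBounded y
        δ , 0<δ , Bδ≡ = rescale {B} {½ ℚ.* ε} 0<B (½*ε>0 0<ε)
        η , 0<η , Cη≡ = rescale {C} {½ ℚ.* ε} 0<C (½*ε>0 0<ε)
        P , y~ = cauchy y δ 0<δ
        Q , x~ = cauchy x η 0<η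
        ≥MP : ∀ {m} → m ≥ (M ⊔ P) ⊔ (N ⊔ Q) → m ≥ M ⊔ P
        ≥MP = ℕ.m⊔n≤o⇒m≤o (M ⊔ P) (N ⊔ Q)
        ≥NQ : ∀ {m} → m ≥ (M ⊔ P) ⊔ (N ⊔ Q) → m ≥ N ⊔ Q
        ≥NQ = ℕ.m⊔n≤o⇒n≤o (M ⊔ P) (N ⊔ Q)
    in (M ⊔ P) ⊔ (N ⊔ Q) , λ m n m≥ n≥ →
      ∣p*q-r*s∣<ε {seq x m} {seq y m} {seq x n} {seq y n} {B} {C} {δ} {η} 0<B 0<C
        (x≤B m (ℕ.m⊔n≤o⇒m≤o M P (≥MP m≥))) (y≤C n (ℕ.m⊔n≤o⇒m≤o N Q (≥NQ n≥)))
        (y~ m n (ℕ.m⊔n≤o⇒n≤o M P (≥MP m≥)) (ℕ.m⊔n≤o⇒n≤o M P (≥MP n≥)))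
        (x~ m n (ℕ.m⊔n≤o⇒n≤o N Q (≥NQ m≥)) (ℕ.m⊔n≤o⇒n≤o N Q (≥NQ n≥)))
        Bδ≡ Cη≡

_*ʳ_ : ℝ → ℝ → ℝ
seq (x *ʳ y) n = seq x n ℚ.* seq y n
cauchy (x *ʳ y) = *-cauchy x y

------------------------------------------------------------------------
-- Complex numbers

infix 5 _+i_

record ℂ : Set where
  constructor _+i_
  field
    re im : ℝ

open ℂ public

infix 4 _≈_

record _≈_ (z w : ℂ) : Set where
  constructor mk≈
  field
    re≈ : re z ≈ʳ re w
    im≈ : im z ≈ʳ im w

open _≈_ public

ℂ-rawRing : RawRing 0ℓ 0ℓ
ℂ-rawRing = record
  { Carrier = ℂ
  ; _≈_     = _≈_
  ; _+_     = λ z w → (re z +ʳ re w) +i (im z +ʳ im w)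
  ; _*_     = λ z w → (re z *ʳ re w +ʳ -ʳ (im z *ʳ im w))
                   +i (re z *ʳ im w +ʳ im z *ʳ re w)
  ; -_      = λ z → (-ʳ re z) +i (-ʳ im z)
  ; 0#      = constʳ 0ℚ +i constʳ 0ℚ
  ; 1#      = constʳ 1ℚ +i constʳ 0ℚ
  }

open RawRing ℂ-rawRing public
  using (_≉_; _+_; _*_; -_; 0#; 1#)

ℂ-isEquivalence : IsEquivalence _≈_
ℂ-isEquivalence = record
  { refl  = mk≈ ≈ʳ-refl ≈ʳ-refl
  ; sym   = λ (mk≈ p q) → mk≈ (≈ʳ-sym p) (≈ʳ-sym q)
  ; trans = λ (mk≈ p q) (mk≈ p′ q′) → mk≈ (≈ʳ-trans p p′) (≈ʳ-trans q q′)
  }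

fromℚ : ℚ → ℂ
fromℚ q = constʳ q +i constʳ 0ℚ

------------------------------------------------------------------------
-- Matrices over a (raw) ring

module Matrices {c ℓ} (R : RawRing c ℓ) where
  open RawRing R renaming
    ( Carrier to C; _≈_ to _≈₁_; _+_ to _+₁_; _*_ to _*₁_; -_ to -₁_
    ; 0# to 0₁; 1# to 1₁; rawSemiring to rawSemiring₁ )
  open RawSemiringDefs rawSemiring₁ public using (sum; product; _^_)

  Matrix : ℕ → Set c
  Matrix n = Fin n → Fin n → C

  infix  4 _≈ᴹ_
  infixl 7 _*ᴹ_ _*ⱽ_ _∘ᴹ_

  _≈ᴹ_ : Rel (Matrix n) ℓ
  M ≈ᴹ N = ∀ i j → M i j ≈₁ N i j

  𝟙 : Matrix n
  𝟙 i j = if does (i ≟ j) then 1₁ else 0₁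

  _*ᴹ_ : Matrix n → Matrix n → Matrix n
  (M *ᴹ N) i j = sum (λ k → M i k *₁ N k j)

  _*ⱽ_ : Matrix n → Vector C n → Vector C n
  (M *ⱽ v) i = sum (λ j → M i j *₁ v j)

  _∘ᴹ_ : Matrix n → Matrix n → Matrix n
  (M ∘ᴹ N) i j = M i j *₁ N i j

  _ᵀ : Matrix n → Matrix n
  (M ᵀ) i j = M j i

  tr : Matrix n → C
  tr M = sum (λ i → M i i)

  sign : ℕ → C
  sign k = (-₁ 1₁) ^ k

  submatrix : Matrix (suc n) → Fin (suc n) → Fin (suc n) → Matrix n
  submatrix M i j k l = M (punchIn i k) (punchIn j l)

  -- Laplace expansion along the first row.
  det : Matrix n → C
  det {zero}  M = 1₁
  det {suc n} M = sum (λ j → sign (toℕ j) *₁ (M zero j *₁ det (submatrix M zero j)))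

  -- With 0-based indices the sign (-1)^{i+j} of a cofactor is unchanged.
  minor : Matrix n → Fin n → Fin n → C
  minor {suc n} M i j = det (submatrix M i j)

  -- The exchange matrix δ_{i,n+1-j}; `opposite` is j ↦ n - 1 - j on 0-based indices.
  J : Matrix n
  J i j = 𝟙 i (opposite j)

  ℛ : Matrix n → Matrix n
  ℛ M = J *ᴹ M *ᴹ J

  basisVector : Fin n → Vector C n
  basisVector k i = 𝟙 k i

  vectorSum : ∀ {m} → Vector (Vector C n) m → Vector C n
  vectorSum vs i = sum (λ k → vs k i)

  record IsEigenvector (M : Matrix n) (μ : C) (v : Vector C n) : Set ℓ where
    field
      nonzero : ¬ (∀ i → v i ≈₁ 0₁)
      eigen   : ∀ i → (M *ⱽ v) i ≈₁ μ *₁ v i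

------------------------------------------------------------------------
-- Polynomials over a (raw) ring: coefficient lists, constant term first,
-- up to trailing zeros

module Polynomials {c ℓ} (R : RawRing c ℓ) where
  open RawRing R renaming
    ( Carrier to C; _≈_ to _≈₁_; _+_ to _+₁_; _*_ to _*₁_; -_ to -₁_
    ; 0# to 0₁; 1# to 1₁ )

  Poly : Set c
  Poly = List C

  coeff : Poly → ℕ → C
  coeff []      k       = 0₁
  coeff (a ∷ p) zero    = a
  coeff (a ∷ p) (suc k) = coeff p k

  const : C → Poly
  const a = a ∷ []

  X : Poly
  X = 0₁ ∷ 1₁ ∷ []

  addₚ : Poly → Poly → Poly
  addₚ []      q       = q
  addₚ (a ∷ p) []      = a ∷ p
  addₚ (a ∷ p) (b ∷ q) = (a +₁ b) ∷ addₚ p q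

  mulₚ : Poly → Poly → Poly
  mulₚ []      q = []
  mulₚ (a ∷ p) q = addₚ (List.map (a *₁_) q) (0₁ ∷ mulₚ p q)

  poly-rawRing : RawRing c ℓ
  poly-rawRing = record
    { Carrier = Poly
    ; _≈_     = λ p q → ∀ k → coeff p k ≈₁ coeff q k
    ; _+_     = addₚ
    ; _*_     = mulₚ
    ; -_      = List.map -₁_
    ; 0#      = []
    ; 1#      = const 1₁
    }

  open RawRing poly-rawRing public
    using () renaming (_≈_ to _≈ₚ_; _+_ to _+ₚ_; _*_ to _*ₚ_; -_ to -ₚ_)

  private
    module M  = Matrices R
    module Mₚ = Matrices poly-rawRing

  charPoly : M.Matrix n → Poly
  charPoly M = Mₚ.det (λ i j → (X *ₚ Mₚ.𝟙 i j) +ₚ (-ₚ const (M i j)))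

  -- μs lists the eigenvalues of M, repeated according to algebraic multiplicity.
  IsSpectrum : M.Matrix n → Vector C n → Set ℓ
  IsSpectrum M μs = charPoly M ≈ₚ Mₚ.product (λ i → X +ₚ (-ₚ const (μs i)))

open Matrices ℂ-rawRing public
open Polynomials ℂ-rawRing public using (charPoly; IsSpectrum)

------------------------------------------------------------------------
-- Number fields inside ℂ

record IsSubfield (K : Pred ℂ ℓ) : Set ℓ where
  field
    resp-≈     : ∀ {x y} → x ≈ y → x ∈ K → y ∈ K
    0-closed   : 0# ∈ K
    1-closed   : 1# ∈ K
    +-closed   : ∀ {x y} → x ∈ K → y ∈ K → x + y ∈ K
    *-closed   : ∀ {x y} → x ∈ K → y ∈ K → x * y ∈ K
    neg-closed : ∀ {x} → x ∈ K → - x ∈ K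
    inverse    : ∀ {x} → x ∈ K → x ≉ 0# → Σ[ y ∈ ℂ ] (y ∈ K) × (x * y ≈ 1#)

-- A finite extension of ℚ: the field has a finite basis over ℚ.
record IsNumberField (K : Pred ℂ ℓ) : Set ℓ where
  field
    isSubfield  : IsSubfield K
    degree      : ℕ
    basis       : Vector ℂ degree
    basis∈K     : ∀ i → basis i ∈ K
    independent : ∀ (q : Vector ℚ degree) →
                  sum (λ i → fromℚ (q i) * basis i) ≈ 0# → ∀ i → q i ≡ 0ℚ
    spanning    : ∀ {x} → x ∈ K →
                  Σ[ q ∈ Vector ℚ degree ] (x ≈ sum (λ i → fromℚ (q i) * basis i))

-- The subring of ℂ generated by K and μs; for a field K and μs algebraic
-- over K it is a field, so its ring automorphisms are field automorphisms.
data _[_] (K : Pred ℂ ℓ) (μs : Vector ℂ n) : Pred ℂ ℓ where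
  base : ∀ {x} → x ∈ K → x ∈ K [ μs ]
  gen  : ∀ i → μs i ∈ K [ μs ]
  resp : ∀ {x y} → x ≈ y → x ∈ K [ μs ] → y ∈ K [ μs ]
  zero : 0# ∈ K [ μs ]
  one  : 1# ∈ K [ μs ]
  add  : ∀ {x y} → x ∈ K [ μs ] → y ∈ K [ μs ] → x + y ∈ K [ μs ]
  mul  : ∀ {x y} → x ∈ K [ μs ] → y ∈ K [ μs ] → x * y ∈ K [ μs ]
  neg  : ∀ {x} → x ∈ K [ μs ] → - x ∈ K [ μs ]

------------------------------------------------------------------------
-- Combined matrices

record GL (K : Pred ℂ ℓ) (A : Matrix n) : Set ℓ where
  field
    entries∈K : ∀ i j → A i j ∈ K
    inv       : Matrix n
    inv∈K     : ∀ i j → inv i j ∈ K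
    inverseˡ  : inv *ᴹ A ≈ᴹ 𝟙
    inverseʳ  : A *ᴹ inv ≈ᴹ 𝟙

𝒞 : {K : Pred ℂ ℓ} (A : Matrix n) → GL K A → Matrix n
𝒞 A A∈GL = A ∘ᴹ (GL.inv A∈GL ᵀ)

------------------------------------------------------------------------
-- Galois groups

module _ (K : Pred ℂ ℓ) (μs : Vector ℂ n) where

  adjoin-rawRing : RawRing ℓ 0ℓ
  adjoin-rawRing = record
    { Carrier = Σ ℂ (K [ μs ])
    ; _≈_     = λ x y → proj₁ x ≈ proj₁ y
    ; _+_     = λ (x , x∈L) (y , y∈L) → x + y , add x∈L y∈L
    ; _*_     = λ (x , x∈L) (y , y∈L) → x * y , mul x∈L y∈L
    ; -_      = λ (x , x∈L) → - x , neg x∈L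
    ; 0#      = 0# , zero
    ; 1#      = 1# , one
    }

  private
    module L = RawRing adjoin-rawRing
    module ≈ = IsEquivalence ℂ-isEquivalence

  record GaloisAutomorphism : Set ℓ where
    field
      to      : L.Carrier → L.Carrier
      from    : L.Carrier → L.Carrier
      to-homomorphism   : IsRingHomomorphism adjoin-rawRing adjoin-rawRing to
      from-homomorphism : IsRingHomomorphism adjoin-rawRing adjoin-rawRing from
      to∘from : ∀ x → to (from x) L.≈ x
      from∘to : ∀ x → from (to x) L.≈ x
      fixes-K : ∀ {x} (x∈K : x ∈ K) → to (x , base x∈K) L.≈ (x , base x∈K)

    open IsRingHomomorphism to-homomorphism public using () renaming (⟦⟧-cong to to-cong)
    open IsRingHomomorphism from-homomorphism public using () renaming (⟦⟧-cong to from-cong)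

  open GaloisAutomorphism

  -- Gal(K[μs]/K)
  Gal : Group ℓ ℓ
  Gal = record
    { Carrier = GaloisAutomorphism
    ; _≈_     = λ σ τ → ∀ x → to σ x L.≈ to τ x
    ; _∙_     = λ σ τ → record
      { to                = to σ ∘ to τ
      ; from              = from τ ∘ from σ
      ; to-homomorphism   =
          Compose.isRingHomomorphism ≈.trans (to-homomorphism τ) (to-homomorphism σ)
      ; from-homomorphism =
          Compose.isRingHomomorphism ≈.trans (from-homomorphism σ) (from-homomorphism τ)
      ; to∘from = λ x → ≈.trans (to-cong σ (to∘from τ (from σ x))) (to∘from σ x)
      ; from∘to = λ x → ≈.trans (from-cong τ (from∘to σ (to τ x))) (from∘to τ x)
      ; fixes-K = λ x∈K → ≈.trans (to-cong σ (fixes-K τ x∈K)) (fixes-K σ x∈K)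
      }
    ; ε       = record
      { to                = id
      ; from              = id
      ; to-homomorphism   = Identity.isRingHomomorphism adjoin-rawRing ≈.refl
      ; from-homomorphism = Identity.isRingHomomorphism adjoin-rawRing ≈.refl
      ; to∘from = λ _ → ≈.refl
      ; from∘to = λ _ → ≈.refl
      ; fixes-K = λ _ → ≈.refl
      }
    ; _⁻¹     = λ σ → record
      { to                = from σ
      ; from              = to σ
      ; to-homomorphism   = from-homomorphism σ
      ; from-homomorphism = to-homomorphism σ
      ; to∘from = from∘to σ
      ; from∘to = to∘from σ
      ; fixes-K = λ x∈K → ≈.trans (from-cong σ (≈.sym (fixes-K σ x∈K))) (from∘to σ _)
      }
    ; isGroup = record
      { isMonoid = record
        { isSemigroup = record
          { isMagma = record
            { isEquivalence = record
              { refl  = λ _ → ≈.refl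
              ; sym   = λ σ≈τ x → ≈.sym (σ≈τ x)
              ; trans = λ σ≈τ τ≈υ x → ≈.trans (σ≈τ x) (τ≈υ x)
              }
            ; ∙-cong = λ {σ} {σ′} {τ} {τ′} σ≈σ′ τ≈τ′ x →
                ≈.trans (to-cong σ (τ≈τ′ x)) (σ≈σ′ (to τ′ x))
            }
          ; assoc = λ _ _ _ _ → ≈.refl
          }
        ; identity = (λ _ _ → ≈.refl) , (λ _ _ → ≈.refl)
        }
      ; inverse = from∘to , to∘from
      ; ⁻¹-cong = λ {σ} {τ} σ≈τ x →
          ≈.trans (from-cong σ {x} {to τ (from τ x)} (≈.sym (to∘from τ x)))
            (≈.trans (from-cong σ (≈.sym (σ≈τ (from τ x)))) (from∘to σ (from τ x)))
      }
    }

------------------------------------------------------------------------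
-- Symmetric groups and subgroups

-- The product is composition of functions, i.e. _∘ₚ_ with its arguments swapped.
S : ℕ → Group 0ℓ 0ℓ
S m = record
  { Carrier = Permutation′ m
  ; _≈_     = Perm._≈_
  ; _∙_     = λ π ρ → ρ Perm.∘ₚ π
  ; ε       = Perm.id
  ; _⁻¹     = Perm.flip
  ; isGroup = record
    { isMonoid = record
      { isSemigroup = record
        { isMagma = record
          { isEquivalence = record
            { refl  = λ _ → refl
            ; sym   = λ π≈ρ i → sym (π≈ρ i)
            ; trans = λ π≈ρ ρ≈υ i → trans (π≈ρ i) (ρ≈υ i)
            }
          ; ∙-cong = λ {π} {π′} {ρ} {ρ′} π≈π′ ρ≈ρ′ i →
              trans (cong (π ⟨$⟩ʳ_) (ρ≈ρ′ i)) (π≈π′ (ρ′ ⟨$⟩ʳ i))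
          }
        ; assoc = λ _ _ _ _ → refl
        }
      ; identity = (λ _ _ → refl) , (λ _ _ → refl)
      }
    ; inverse = (λ π _ → Perm.inverseˡ π) , (λ π _ → Perm.inverseʳ π)
    ; ⁻¹-cong = λ {π} {ρ} π≈ρ i →
        trans (cong (π ⟨$⟩ˡ_) (sym (Perm.inverseʳ ρ)))
          (trans (cong (π ⟨$⟩ˡ_) (sym (π≈ρ (ρ ⟨$⟩ˡ i)))) (Perm.inverseˡ π))
    }
  }

record IsSubgroup (G : Group a ℓ₁) (H : Pred (Group.Carrier G) ℓ₂) : Set (a ⊔ˡ ℓ₁ ⊔ˡ ℓ₂) where
  private module G = Group G
  field
    respects  : ∀ {x y} → x G.≈ y → x ∈ H → y ∈ H
    ∙-closed  : ∀ {x y} → x ∈ H → y ∈ H → x G.∙ y ∈ H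
    ε-closed  : G.ε ∈ H
    ⁻¹-closed : ∀ {x} → x ∈ H → x G.⁻¹ ∈ H

  subgroup : RawGroup (a ⊔ˡ ℓ₂) ℓ₁
  subgroup = record
    { Carrier = Σ G.Carrier H
    ; _≈_     = λ x y → proj₁ x G.≈ proj₁ y
    ; _∙_     = λ (x , x∈H) (y , y∈H) → x G.∙ y , ∙-closed x∈H y∈H
    ; ε       = G.ε , ε-closed
    ; _⁻¹     = λ (x , x∈H) → x G.⁻¹ , ⁻¹-closed x∈H
    }

IsomorphicToSubgroupOf : Group ℓ ℓ → Group 0ℓ 0ℓ → Set (lsuc ℓ)
IsomorphicToSubgroupOf {ℓ} G H =
  Σ[ P ∈ Pred (Group.Carrier H) ℓ ] Σ[ P≤H ∈ IsSubgroup H P ]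
  Σ[ φ ∈ (Group.Carrier G → Σ (Group.Carrier H) P) ]
    IsGroupIsomorphism (Group.rawGroup G) (IsSubgroup.subgroup P≤H) φ

{-# OPTIONS --safe #-}

-- An alternating multilinear functional of n rows is det times its value at the identity; this
-- gives det (M N) = det M det N and the cofactor expansion, hence parts 1, 2 and 5. The row and
-- column sums of 𝒞(A) are the diagonal entries of A A⁻¹ and A⁻¹ A, so 1 is an eigenvalue.
-- An automorphism in Gal(L/K) is determined by its action on the distinct roots of the
-- characteristic polynomial of 𝒞(A), which it permutes, and it fixes the root 1; this embeds
-- Gal(L/K) into S_{n-1}.
--
-- Equality in ℂ is undecidable, so the last step needs that two roots x and y are equal or have
-- an invertible difference. The powers of x - y lie in a finitely generated K-module, and K has
-- decidable equality through its basis over ℚ, so linear algebra over K yields a nontrivial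
-- polynomial relation for x - y. Removing its zero coefficients of lowest degree, it reads
-- (x - y)^k (a + (x - y) t) = 0 with a invertible; since ℂ is a local ring, either x - y is
-- invertible or it is nilpotent, hence zero.

module Submission where

open import Algebra.Bundles using (CommutativeMonoid; CommutativeRing; Group)
open import Algebra.Bundles.Raw using (RawRing)
open import Algebra.Morphism.Structures using (IsRingHomomorphism)
import Algebra.Properties.CommutativeSemigroup as CommutativeSemigroupProps
import Algebra.Properties.Ring as RingProps
import Algebra.Properties.Semiring.Mult as Mult
import Algebra.Properties.Semiring.Sum as SumProps
import Algebra.Solver.Ring as RingSolver
import Algebra.Solver.Ring.AlmostCommutativeRing as ACR
open import Algebra.Structures using (IsCommutativeRing)
open import Data.Bool.Base using (true; false)
open import Data.Empty using (⊥-elim)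
open import Data.Fin.Base as Fin
  using (Fin; zero; suc; toℕ; punchIn; punchOut; fromℕ<; combine; remQuot; opposite)
open import Data.Fin.Permutation as Perm using (Permutation′; _⟨$⟩ʳ_; _⟨$⟩ˡ_)
import Data.Fin.Properties as Fin
import Data.List.Base as List
open import Data.List.Relation.Unary.All as Unary using (All)
open import Data.Maybe.Base using (Maybe; just; nothing)
open import Data.Nat.Base as ℕ using (ℕ; zero; suc; _<_; _≥_; z≤n; s≤s; z<s; s<s; NonZero)
import Data.Nat.Properties as ℕ
open import Data.Product.Base using (Σ-syntax; _×_; _,_; proj₁; proj₂)
open import Data.Rational.Base as ℚ using (ℚ; 0ℚ; 1ℚ; ½)
import Data.Rational.Properties as ℚ
open import Data.Rational.Solver using (module +-*-Solver)
open import Data.Sum.Base using (_⊎_; inj₁; inj₂; [_,_]′)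
open import Data.Unit.Polymorphic.Base using (⊤; tt)
open import Data.Vec.Functional as Vector using (Vector; head; tail; insertAt)
import Data.Vec.Functional.Properties as VectorProps
open import Function.Base using (_∘_)
open import Level using (0ℓ; _⊔_) renaming (suc to lsuc)
open import Relation.Binary.PropositionalEquality as ≡
  using (_≡_; _≢_; subst; subst₂; cong; cong₂; module ≡-Reasoning)
import Relation.Binary.Reasoning.Setoid as ≈-Reasoning
open import Relation.Binary.Structures using (IsEquivalence)
open import Relation.Nullary using (¬_; Dec; yes; no; does)
open import Relation.Unary using (Pred; _∈_)

open import Defs using (module Matrices; module Polynomials)

-- The dichotomy for differences of roots is needed twice. A vanishing product of factors z - μ
-- yields a vanishing factor only if each factor is known to be zero or invertible. The permutation
-- attached to an automorphism needs the index of each image as computed data.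
--
-- No division by det A takes place: for the given inverse N, det A det N = 1, so det N serves as
-- 1/det A.
--
-- Row sums and column sums have different uses: the row sums give the eigenvector of part 3, the
-- column sums give a left null vector of 1 - 𝒞(A) and with it the root 1 of the characteristic
-- polynomial.

commutativeRing : ∀ {c ℓ} (R : RawRing c ℓ) (let open RawRing R) →
                  IsCommutativeRing _≈_ _+_ _*_ (-_) 0# 1# → CommutativeRing c ℓ
commutativeRing R isCommutativeRing = record { isCommutativeRing = isCommutativeRing }

-- The pair (a , b) stands for the integer a - b; equality of such pairs is decidable, which
-- the library's solver over an abstract ring needs to cancel terms.
module IntegerSolver {c ℓ} (R : CommutativeRing c ℓ) where
  open CommutativeRing R
  open Mult semiring using () renaming (_×_ to _×′_; ×1-homo-* to ×1-homo; ×-homo-+ to ×-homo)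
  open RingProps ring
  open CommutativeSemigroupProps (CommutativeMonoid.commutativeSemigroup +-commutativeMonoid)
    using (interchange)
  open ≈-Reasoning setoid

  private
    differences : RawRing 0ℓ 0ℓ
    differences = record
      { Carrier = ℕ × ℕ
      ; _≈_ = _≡_
      ; _+_ = λ (a , b) (c , d) → a ℕ.+ c , b ℕ.+ d
      ; _*_ = λ (a , b) (c , d) → a ℕ.* c ℕ.+ b ℕ.* d , a ℕ.* d ℕ.+ b ℕ.* c
      ; -_  = λ (a , b) → b , a
      ; 0#  = 0 , 0
      ; 1#  = 1 , 0
      }

    module ℤ = RawRing differences

    ⟦_⟧ : ℕ × ℕ → Carrier
    ⟦ a , b ⟧ = (a ×′ 1#) - (b ×′ 1#)

    -- The literals 0 and 1 are interpreted on the nose, so that solver goals may mention 0# and 1#.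
    ⟦_⟧′ : ℕ × ℕ → Carrier
    ⟦ 0 , 0 ⟧′ = 0#
    ⟦ 1 , 0 ⟧′ = 1#
    ⟦ a , b ⟧′ = ⟦ a , b ⟧

    ⟦⟧′≈⟦⟧ : ∀ x → ⟦ x ⟧′ ≈ ⟦ x ⟧
    ⟦⟧′≈⟦⟧ (0 , 0)             = sym (-‿inverseʳ 0#)
    ⟦⟧′≈⟦⟧ (1 , 0)             = sym (trans (+-cong (+-identityʳ 1#) -0#≈0#) (+-identityʳ 1#))
    ⟦⟧′≈⟦⟧ (0 , suc b)         = refl
    ⟦⟧′≈⟦⟧ (1 , suc b)         = refl
    ⟦⟧′≈⟦⟧ (suc (suc a) , b)   = refl

    [-]+[-] : ∀ p q r s → (p - q) + (r - s) ≈ (p + r) - (q + s)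
    [-]+[-] p q r s = trans (interchange p (- q) r (- s)) (+-congˡ (-‿+-comm q s))

    [-]-[-] : ∀ p q r s → (p - q) - (r - s) ≈ (p + s) - (q + r)
    [-]-[-] p q r s = trans (+-congˡ (⁻¹-anti-homo‿- r s)) ([-]+[-] p q s r)

    +-homo : ∀ x y → ⟦ x ℤ.+ y ⟧ ≈ ⟦ x ⟧ + ⟦ y ⟧
    +-homo (a , b) (c , d) = trans (+-cong (×-homo 1# a c) (-‿cong (×-homo 1# b d)))
      (sym ([-]+[-] _ _ _ _))

    ×-homo₂ : ∀ a c b d → (a ℕ.* c ℕ.+ b ℕ.* d) ×′ 1# ≈ (a ×′ 1#) * (c ×′ 1#) + (b ×′ 1#) * (d ×′ 1#)
    ×-homo₂ a c b d = trans (×-homo 1# (a ℕ.* c) (b ℕ.* d)) (+-cong (×1-homo a c) (×1-homo b d))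

    *-homo : ∀ x y → ⟦ x ℤ.* y ⟧ ≈ ⟦ x ⟧ * ⟦ y ⟧
    *-homo (a , b) (c , d) = begin
      ⟦ a ℕ.* c ℕ.+ b ℕ.* d , a ℕ.* d ℕ.+ b ℕ.* c ⟧ ≈⟨ +-cong (×-homo₂ a c b d) (-‿cong (×-homo₂ a d b c)) ⟩
      (A * C + B * D) - (A * D + B * C)             ≈⟨ [-]-[-] _ _ _ _ ⟨
      (A * C - A * D) - (B * C - B * D)             ≈⟨ +-cong (x[y-z]≈xy-xz A C D) (-‿cong (x[y-z]≈xy-xz B C D)) ⟨
      A * (C - D) - B * (C - D)                     ≈⟨ [y-z]x≈yx-zx (C - D) A B ⟨
      (A - B) * (C - D)                             ∎
      where
      A = a ×′ 1#
      B = b ×′ 1#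
      C = c ×′ 1#
      D = d ×′ 1#

    morphism : differences ACR.-Raw-AlmostCommutative⟶ ACR.fromCommutativeRing R
    morphism = record
      { ⟦_⟧    = ⟦_⟧′
      ; +-homo = λ x y → trans (⟦⟧′≈⟦⟧ (x ℤ.+ y)) (trans (+-homo x y) (sym (+-cong (⟦⟧′≈⟦⟧ x) (⟦⟧′≈⟦⟧ y))))
      ; *-homo = λ x y → trans (⟦⟧′≈⟦⟧ (x ℤ.* y)) (trans (*-homo x y) (sym (*-cong (⟦⟧′≈⟦⟧ x) (⟦⟧′≈⟦⟧ y))))
      ; -‿homo = λ x → trans (⟦⟧′≈⟦⟧ (ℤ.- x)) (trans (sym (⁻¹-anti-homo‿- _ _)) (sym (-‿cong (⟦⟧′≈⟦⟧ x))))
      ; 0-homo = refl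
      ; 1-homo = refl
      }

    ⟦⟧-cong : ∀ x y → Maybe (⟦ x ⟧′ ≈ ⟦ y ⟧′)
    ⟦⟧-cong (a , b) (c , d) with a ℕ.+ d ℕ.≟ b ℕ.+ c
    ... | no  _ = nothing
    ... | yes e = just (trans (⟦⟧′≈⟦⟧ (a , b)) (trans (x∙y⁻¹≈ε⇒x≈y _ _ (begin
      ⟦ a , b ⟧ - ⟦ c , d ⟧                             ≈⟨ [-]-[-] _ _ _ _ ⟩
      ((a ×′ 1#) + (d ×′ 1#)) - ((b ×′ 1#) + (c ×′ 1#)) ≈⟨ +-cong (×-homo 1# a d) (-‿cong (×-homo 1# b c)) ⟨
      ((a ℕ.+ d) ×′ 1#) - ((b ℕ.+ c) ×′ 1#)             ≡⟨ ≡.cong (λ k → (k ×′ 1#) - ((b ℕ.+ c) ×′ 1#)) e ⟩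
      ((b ℕ.+ c) ×′ 1#) - ((b ℕ.+ c) ×′ 1#)             ≈⟨ -‿inverseʳ _ ⟩
      0#                                               ∎)) (sym (⟦⟧′≈⟦⟧ (c , d)))))

  open RingSolver differences (ACR.fromCommutativeRing R) morphism ⟦⟧-cong public
    using (solve; _:=_; _:+_; _:*_; :-_; _:-_; con; Polynomial)

  :0 :1 : ∀ {n} → Polynomial n
  :0 = con (0 , 0)
  :1 = con (1 , 0)

-- Finite sums and the Kronecker delta

module Sums {c ℓ} (R : CommutativeRing c ℓ) where
  open CommutativeRing R hiding (zero)
  open Matrices rawRing using (sum; 𝟙)
  open SumProps semiring public
    using (∑-distrib-+; ∑-comm; *-distribˡ-sum; *-distribʳ-sum)
  open SumProps semiring using (sum-cong-≋; sum-replicate-zero)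
  open IntegerSolver R

  sum-cong : ∀ {n} {f g : Vector Carrier n} → (∀ i → f i ≈ g i) → sum f ≈ sum g
  sum-cong f≈g = sum-cong-≋ f≈g

  sum-zero : ∀ {n} {f : Vector Carrier n} → (∀ i → f i ≈ 0#) → sum f ≈ 0#
  sum-zero {n} f≈0 = trans (sum-cong f≈0) (sum-replicate-zero n)

  sum-linear : ∀ {n} a (f g : Vector Carrier n) → sum (λ i → a * f i + g i) ≈ a * sum f + sum g
  sum-linear a f g = trans (∑-distrib-+ (λ i → a * f i) g) (+-congʳ (sym (*-distribˡ-sum a f)))

  sum-𝟙ʳ : ∀ {n} (x : Vector Carrier n) j → sum (λ k → x k * 𝟙 k j) ≈ x j
  sum-𝟙ʳ x zero = trans (+-cong (*-identityʳ _) (sum-zero (λ k → zeroʳ (x (suc k))))) (+-identityʳ _)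
  sum-𝟙ʳ x (suc j) = trans (+-cong (zeroʳ _) (sum-𝟙ʳ (tail x) j)) (+-identityˡ _)

  sum-𝟙ˡ : ∀ {n} (x : Vector Carrier n) i → sum (λ k → 𝟙 i k * x k) ≈ x i
  sum-𝟙ˡ x zero = trans (+-cong (*-identityˡ _) (sum-zero (λ k → zeroˡ (x (suc k))))) (+-identityʳ _)
  sum-𝟙ˡ x (suc j) = trans (+-cong (zeroˡ _) (sum-𝟙ˡ (tail x) j)) (+-identityˡ _)

  𝟙-diag : ∀ {n} (i : Fin n) → 𝟙 i i ≡ 1#
  𝟙-diag zero    = ≡.refl
  𝟙-diag (suc i) = 𝟙-diag i

  𝟙-off : ∀ {n} {i j : Fin n} → i ≢ j → 𝟙 i j ≡ 0#
  𝟙-off {i = zero}  {zero}  i≢j with () ← i≢j ≡.refl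
  𝟙-off {i = zero}  {suc j} i≢j = ≡.refl
  𝟙-off {i = suc i} {zero}  i≢j = ≡.refl
  𝟙-off {i = suc i} {suc j} i≢j = 𝟙-off (i≢j ∘ ≡.cong suc)

-- Determinants as alternating multilinear functionals of the rows

module Determinants {c ℓ} (R : CommutativeRing c ℓ) where
  open Vector using (_∷_)
  open CommutativeRing R hiding (zero)
  open Matrices rawRing
  open Sums R
  open IntegerSolver R
  open RingProps ring using (+-inverseˡ-unique; -1*x≈-x)
  open ≈-Reasoning setoid

  Rows : ℕ → ℕ → Set c
  Rows m n = Fin m → Vector Carrier n

  Functional : ℕ → ℕ → Set c
  Functional m n = Rows m n → Carrier

  private
    variable
      m n p : ℕ

  Congruent : Functional m n → Set (c ⊔ ℓ)
  Congruent D = ∀ {M N} → (∀ i j → M i j ≈ N i j) → D M ≈ D N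

  infix 8 _·_⊕_
  _·_⊕_ : Carrier → Vector Carrier n → Vector Carrier n → Vector Carrier n
  (a · x ⊕ y) j = a * x j + y j

  LinearAtHead : Functional (suc m) n → Set (c ⊔ ℓ)
  LinearAtHead D = ∀ a x y xs → D (a · x ⊕ y ∷ xs) ≈ a * D (x ∷ xs) + D (y ∷ xs)

  VanishesOnRepeat : Functional (suc m) n → Set (c ⊔ ℓ)
  VanishesOnRepeat {zero}  D = ⊤
  VanishesOnRepeat {suc m} D = ∀ x xs → D (x ∷ x ∷ xs) ≈ 0#

  -- Conditions are imposed at the first row and the first two rows only, and then recursively with
  -- the first row fixed. This fits structural recursion on the number of rows; repetitions at a
  -- distance are recovered by `repeat-head`.
  Alternating : Functional m n → Set (c ⊔ ℓ)
  Alternating {zero}  D = ⊤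
  Alternating {suc m} D =
    LinearAtHead D × VanishesOnRepeat D × (∀ x → Alternating (λ xs → D (x ∷ xs)))

  ∷-cong : ∀ (x : Vector Carrier n) {xs ys : Rows m n} → (∀ i j → xs i j ≈ ys i j) →
           ∀ i j → (x ∷ xs) i j ≈ (x ∷ ys) i j
  ∷-cong x xs≈ys zero    j = refl
  ∷-cong x xs≈ys (suc i) j = xs≈ys i j

  ∷-η : ∀ (M : Rows (suc m) n) i j → M i j ≈ (head M ∷ tail M) i j
  ∷-η M zero    j = refl
  ∷-η M (suc i) j = refl

  restrict-cong : {D : Functional (suc m) n} → Congruent D → ∀ x → Congruent (λ xs → D (x ∷ xs))
  restrict-cong D-cong x xs≈ys = D-cong (∷-cong x xs≈ys)

  alternating-resp : {D E : Functional m n} → (∀ M → D M ≈ E M) → Alternating D → Alternating E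
  alternating-resp {zero} D≈E _ = tt
  alternating-resp {suc m} {D = D} {E} D≈E (linear , vanish , alt) =
    (λ a x y xs → trans (sym (D≈E _)) (trans (linear a x y xs) (+-cong (*-congˡ (D≈E _)) (D≈E _)))) ,
    vanish′ D≈E vanish ,
    λ x → alternating-resp (λ xs → D≈E (x ∷ xs)) (alt x)
    where
    -- `VanishesOnRepeat` computes only once it is known whether a second row exists, hence a
    -- separate case distinction.
    vanish′ : ∀ {m} {D E : Functional (suc m) _} → (∀ M → D M ≈ E M) →
              VanishesOnRepeat D → VanishesOnRepeat E
    vanish′ {zero}  _   _      = tt
    vanish′ {suc m} D≈E vanish = λ x xs → trans (sym (D≈E _)) (vanish x xs)

  -- A linear map applied to every row preserves all three conditions. The maps used are deletion of
  -- a column, insertion of a zero entry and right multiplication by a matrix.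
  alternating-∘ : {D : Functional m n} → Congruent D → Alternating D →
                  (f : Vector Carrier p → Vector Carrier n) →
                  (∀ a x y j → f (a · x ⊕ y) j ≈ (a · f x ⊕ f y) j) →
                  Alternating (λ M → D (f ∘ M))
  alternating-∘ {zero} D-cong _ f f-linear = tt
  alternating-∘ {suc m} {n} {p} {D} D-cong (linear , vanish , alt) f f-linear =
    (λ a x y xs → trans (D-cong (λ where
        zero    j → f-linear a x y j
        (suc i) j → refl))
      (trans (linear a (f x) (f y) (f ∘ xs)) (+-cong (*-congˡ (D-cong (f∷ x xs))) (D-cong (f∷ y xs))))) ,
    vanish′ D-cong vanish ,
    λ x → alternating-resp (λ xs → D-cong (f∷ x xs))
            (alternating-∘ (restrict-cong D-cong (f x)) (alt (f x)) f f-linear)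
    where
    f∷ : ∀ {m} x (xs : Rows m p) i j → (f x ∷ f ∘ xs) i j ≈ f ((x ∷ xs) i) j
    f∷ x xs zero    j = refl
    f∷ x xs (suc i) j = refl

    vanish′ : ∀ {m} {D : Functional (suc m) n} → Congruent D → VanishesOnRepeat D →
              VanishesOnRepeat (λ M → D (f ∘ M))
    vanish′ {zero}  _      _      = tt
    vanish′ {suc m} D-cong vanish = λ x xs → trans (D-cong (λ where
      zero          j → refl
      (suc zero)    j → refl
      (suc (suc i)) j → refl)) (vanish (f x) (f ∘ xs))

  alternating-sum : (a : Vector Carrier p) {D : Fin p → Functional m n} →
                    (∀ k → Alternating (D k)) → Alternating (λ M → sum (λ k → a k * D k M))
  alternating-sum {m = zero} a alt = tt
  alternating-sum {p} {m = suc m} {n} a {D} alt =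
    (λ b x y xs → trans
      (sum-cong (λ k → trans (*-congˡ (proj₁ (alt k) b x y xs)) (lemma (a k) b _ _)))
      (sum-linear b (λ k → a k * D k (x ∷ xs)) (λ k → a k * D k (y ∷ xs)))) ,
    vanish′ (λ k → proj₁ (proj₂ (alt k))) ,
    λ x → alternating-sum a (λ k → proj₂ (proj₂ (alt k)) x)
    where
    lemma : ∀ a b x y → a * (b * x + y) ≈ b * (a * x) + a * y
    lemma = solve 4 (λ a b x y → a :* (b :* x :+ y) := b :* (a :* x) :+ a :* y) refl

    vanish′ : ∀ {m} {D : Fin p → Functional (suc m) n} → (∀ k → VanishesOnRepeat (D k)) →
              VanishesOnRepeat (λ M → sum (λ k → a k * D k M))
    vanish′ {zero}  _      = tt
    vanish′ {suc m} vanish = λ x xs → sum-zero (λ k → trans (*-congˡ (vanish k x xs)) (zeroʳ (a k)))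

  module _ {D : Functional (suc m) n} (D-cong : Congruent D) (alt : Alternating D) where

    private linear = proj₁ alt

    -- Linearity has no clause of its own for the zero row; with coefficient `- 1#` and both rows
    -- zero it makes the value equal to its negative plus itself.
    D-zero : ∀ xs → D ((λ _ → 0#) ∷ xs) ≈ 0#
    D-zero xs = begin
      D (o ∷ xs)                            ≈⟨ D-cong (λ where
                                                 zero    j → sym (trans (+-congʳ (zeroʳ _)) (+-identityʳ _))
                                                 (suc i) j → refl) ⟩
      D ((- 1#) · o ⊕ o ∷ xs)               ≈⟨ linear (- 1#) o o xs ⟩
      - 1# * D (o ∷ xs) + D (o ∷ xs)        ≈⟨ solve 1 (λ d → (:- :1) :* d :+ d := :0) refl _ ⟩
      0#                                    ∎
      where
      o : Vector Carrier n
      o _ = 0#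

    D-sum : ∀ {k} (a : Vector Carrier k) (v : Fin k → Vector Carrier n) xs →
            D ((λ j → sum (λ i → a i * v i j)) ∷ xs) ≈ sum (λ i → a i * D (v i ∷ xs))
    D-sum {zero}  a v xs = D-zero xs
    D-sum {suc k} a v xs =
      trans (linear (a zero) (v zero) _ xs) (+-congˡ (D-sum (tail a) (tail v) xs))

    D-expand : ∀ x xs → D (x ∷ xs) ≈ sum (λ k → x k * D (𝟙 k ∷ xs))
    D-expand x xs = trans
      (D-cong (λ where
        zero    j → sym (sum-𝟙ʳ x j)
        (suc i) j → refl))
      (D-sum x 𝟙 xs)

  -- Polarisation: expand the value at two rows both equal to x + y, which vanishes, and drop the
  -- two terms with a repeated row.
  swap-head : (D : Functional (suc (suc m)) n) → Alternating D →
              ∀ x y xs → D (x ∷ y ∷ xs) ≈ - D (y ∷ x ∷ xs)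
  swap-head D (linear , vanish , alt) x y xs = +-inverseˡ-unique _ _ (begin
    D (x ∷ y ∷ xs) + D (y ∷ x ∷ xs)
      ≈⟨ solve 2 (λ p q → p :+ q := :1 :* (:1 :* :0 :+ p) :+ (:1 :* q :+ :0)) refl _ _ ⟩
    1# * (1# * 0# + D (x ∷ y ∷ xs)) + (1# * D (y ∷ x ∷ xs) + 0#)
      ≈⟨ +-cong (*-congˡ (+-congʳ (*-congˡ (vanish x xs)))) (+-congˡ (vanish y xs)) ⟨
    1# * (1# * D (x ∷ x ∷ xs) + D (x ∷ y ∷ xs)) + (1# * D (y ∷ x ∷ xs) + D (y ∷ y ∷ xs))
      ≈⟨ +-cong (*-congˡ (proj₁ (alt x) 1# x y xs)) (proj₁ (alt y) 1# x y xs) ⟨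
    1# * D (x ∷ 1# · x ⊕ y ∷ xs) + D (y ∷ 1# · x ⊕ y ∷ xs)
      ≈⟨ linear 1# x y _ ⟨
    D (1# · x ⊕ y ∷ 1# · x ⊕ y ∷ xs)
      ≈⟨ vanish _ xs ⟩
    0# ∎)

  -- After the second row is cleared, x trades places with it, so that x is again the head of a
  -- functional with one row fewer; a second swap undoes the sign.
  add-multiples : {D : Functional (suc m) n} → Congruent D → Alternating D →
                  ∀ x (a : Vector Carrier m) T → D (x ∷ (λ i → a i · x ⊕ T i)) ≈ D (x ∷ T)
  add-multiples {zero}  D-cong alt x a T = D-cong (λ where zero j → refl)
  add-multiples {suc m} {D = D} D-cong alt@(_ , vanish , alt′) x a T = begin
    D (x ∷ T′)                                            ≈⟨ D-cong (λ where
                                                               zero          j → refl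
                                                               (suc zero)    j → refl
                                                               (suc (suc i)) j → refl) ⟩
    D (x ∷ a zero · x ⊕ head T ∷ tail T′)                 ≈⟨ proj₁ (alt′ x) (a zero) x (head T) _ ⟩
    a zero * D (x ∷ x ∷ tail T′) + D (x ∷ head T ∷ tail T′) ≈⟨ +-congʳ (trans (*-congˡ (vanish x _)) (zeroʳ _)) ⟩
    0# + D (x ∷ head T ∷ tail T′)                         ≈⟨ +-identityˡ _ ⟩
    D (x ∷ head T ∷ tail T′)                              ≈⟨ swap-head D alt x (head T) _ ⟩
    - D (head T ∷ x ∷ tail T′)                            ≈⟨ -‿cong (add-multiples
                                                               (restrict-cong D-cong (head T)) (alt′ (head T)) x (tail a) (tail T)) ⟩
    - D (head T ∷ x ∷ tail T)                             ≈⟨ swap-head D alt x (head T) _ ⟨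
    D (x ∷ head T ∷ tail T)                               ≈⟨ D-cong (∷-cong x (∷-η T)) ⟨
    D (x ∷ T)                                             ∎
    where
    T′ : Rows (suc m) _
    T′ i = a i · x ⊕ T i

  -- Row k climbs by k adjacent swaps, each costing one sign, and the order of the other rows is
  -- kept.
  move-to-head : {D : Functional (suc m) n} → Congruent D → Alternating D →
                 ∀ M k → D M ≈ sign (toℕ k) * D (M k ∷ (M ∘ punchIn k))
  move-to-head D-cong alt M zero = trans (D-cong (∷-η M)) (sym (*-identityˡ _))
  move-to-head {suc m} {D = D} D-cong alt@(_ , _ , alt′) M (suc k) = begin
    D M                                                   ≈⟨ D-cong (∷-η M) ⟩
    D (head M ∷ tail M)                                   ≈⟨ move-to-head
                                                               (restrict-cong D-cong (head M)) (alt′ (head M)) (tail M) k ⟩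
    s * D (head M ∷ tail M k ∷ (tail M ∘ punchIn k))      ≈⟨ *-congˡ (swap-head D alt _ _ _) ⟩
    s * - D (tail M k ∷ head M ∷ (tail M ∘ punchIn k))    ≈⟨ solve 2 (λ s d → s :* (:- d) := ((:- :1) :* s) :* d) refl s _ ⟩
    (- 1# * s) * D (tail M k ∷ head M ∷ (tail M ∘ punchIn k)) ≈⟨ *-congˡ (D-cong (∷-cong _ (λ where
                                                               zero    j → refl
                                                               (suc i) j → refl))) ⟩
    (- 1# * s) * D (M (suc k) ∷ (M ∘ punchIn (suc k)))    ∎
    where s = sign (toℕ k)

  repeat-head : {D : Functional (suc m) n} → Congruent D → Alternating D →
                ∀ x T k → (∀ j → T k j ≈ x j) → D (x ∷ T) ≈ 0#
  repeat-head {suc m} {D = D} D-cong (_ , vanish , alt′) x T k Tk≈x = begin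
    D (x ∷ T)                                  ≈⟨ move-to-head (restrict-cong D-cong x) (alt′ x) T k ⟩
    sign (toℕ k) * D (x ∷ T k ∷ (T ∘ punchIn k)) ≈⟨ *-congˡ (D-cong (λ where
                                                    zero          j → refl
                                                    (suc zero)    j → Tk≈x j
                                                    (suc (suc i)) j → refl)) ⟩
    sign (toℕ k) * D (x ∷ x ∷ (T ∘ punchIn k)) ≈⟨ *-congˡ (vanish x _) ⟩
    sign (toℕ k) * 0#                          ≈⟨ zeroʳ _ ⟩
    0#                                         ∎

  sign² : ∀ k → sign k * sign k ≈ 1#
  sign² zero    = *-identityˡ 1#
  sign² (suc k) = trans
    (solve 1 (λ s → ((:- :1) :* s) :* ((:- :1) :* s) := s :* s) refl (sign k)) (sign² k)

  sign-+ : ∀ j k → sign (j ℕ.+ k) ≈ sign j * sign k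
  sign-+ zero    k = sym (*-identityˡ _)
  sign-+ (suc j) k = trans (*-congˡ (sign-+ j k)) (sym (*-assoc _ _ _))

  det-cong : ∀ {n} → Congruent (det {n})
  det-cong {zero}  M≈N = refl
  det-cong {suc n} {M} {N} M≈N = sum-cong (λ j → *-congˡ {sign (toℕ j)} (*-cong (M≈N zero j)
    (det-cong (λ k l → M≈N (suc k) (punchIn j l)))))

  private
    -- Deleting columns j and then l is the same as deleting punchIn j l and then swapped j l.
    swapped : Fin (suc n) → Fin n → Fin n
    swapped zero    l       = zero′ l
      where
      zero′ : Fin n → Fin n
      zero′ zero    = zero
      zero′ (suc _) = zero
    swapped (suc j) zero    = j
    swapped (suc j) (suc l) = suc (swapped j l)

    punchIn-swapped : ∀ (j : Fin (suc n)) l → punchIn (punchIn j l) (swapped j l) ≡ j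
    punchIn-swapped zero    zero    = ≡.refl
    punchIn-swapped zero    (suc l) = ≡.refl
    punchIn-swapped (suc j) zero    = ≡.refl
    punchIn-swapped (suc j) (suc l) = ≡.cong suc (punchIn-swapped j l)

    punchIn-punchIn-swapped : ∀ (j : Fin (suc (suc n))) l k →
      punchIn (punchIn j l) (punchIn (swapped j l) k) ≡ punchIn j (punchIn l k)
    punchIn-punchIn-swapped zero    zero    k       = ≡.refl
    punchIn-punchIn-swapped zero    (suc l) k       = ≡.refl
    punchIn-punchIn-swapped (suc j) zero    k       = ≡.refl
    punchIn-punchIn-swapped (suc j) (suc l) zero    = ≡.refl
    punchIn-punchIn-swapped (suc j) (suc l) (suc k) = ≡.cong suc (punchIn-punchIn-swapped j l k)

    -- Deleting one of two columns lowers the index of the other exactly when the other lies further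
    -- right. Of the two orders of deletion just one lowers an index, so the exponents differ in
    -- parity.
    sign-swapped : ∀ (j : Fin (suc n)) l →
      sign (toℕ (punchIn j l)) * sign (toℕ (swapped j l)) ≈ - (sign (toℕ j) * sign (toℕ l))
    sign-swapped zero zero =
      solve 0 (((:- :1) :* :1) :* :1 := :- (:1 :* :1)) refl
    sign-swapped zero (suc l) =
      solve 1 (λ s → ((:- :1) :* ((:- :1) :* s)) :* :1 := :- (:1 :* ((:- :1) :* s))) refl _
    sign-swapped (suc j) zero =
      solve 1 (λ s → :1 :* s := :- (((:- :1) :* s) :* :1)) refl _
    sign-swapped (suc j) (suc l) = trans
      (solve 2 (λ s t → ((:- :1) :* s) :* ((:- :1) :* t) := s :* t) refl _ _)
      (trans (sign-swapped j l)
        (solve 2 (λ s t → :- (s :* t) := :- (((:- :1) :* s) :* ((:- :1) :* t))) refl _ _))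

    -- The terms cancel in pairs (j , l) ↔ (punchIn j l , swapped j l).
    antisymmetric-sum : ∀ {n} (F : Fin (suc n) → Fin n → Carrier) →
      (∀ j l → F (punchIn j l) (swapped j l) ≈ - F j l) → sum (λ j → sum (F j)) ≈ 0#
    antisymmetric-sum {zero}  F anti = +-identityˡ 0#
    antisymmetric-sum {suc n} F anti = begin
      sum (F zero) + sum (λ j → sum (F (suc j)))
        ≈⟨ +-congˡ (∑-distrib-+ (λ j → F (suc j) zero) (λ j → sum (F (suc j) ∘ suc))) ⟩
      sum (F zero) + (sum (λ j → F (suc j) zero) + sum (λ j → sum (F (suc j) ∘ suc)))
        -- The terms with j = 0 are the negatives of those with l = 0, and what remains is the same
        -- kind of sum one size smaller.
        ≈⟨ +-cong (sum-cong first) (+-congˡ (antisymmetric-sum (λ j l → F (suc j) (suc l))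
             (λ j l → anti (suc j) (suc l)))) ⟩
      sum (λ j → - 1# * F (suc j) zero) + (sum (λ j → F (suc j) zero) + 0#)
        ≈⟨ +-congʳ (*-distribˡ-sum (- 1#) (λ j → F (suc j) zero)) ⟨
      - 1# * sum (λ j → F (suc j) zero) + (sum (λ j → F (suc j) zero) + 0#)
        ≈⟨ solve 1 (λ s → (:- :1) :* s :+ (s :+ :0) := :0) refl _ ⟩
      0# ∎
      where
      first : ∀ j → F zero j ≈ - 1# * F (suc j) zero
      first j = trans (anti (suc j) zero) (sym (-1*x≈-x _))

  -- Expansion along the two equal rows runs over ordered pairs of columns. Exchanging the columns
  -- keeps the product of the two entries and the remaining minor, and reverses the sign.
  det-vanish : ∀ (x : Vector Carrier (suc (suc n))) (xs : Rows n (suc (suc n))) →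
               det (x ∷ x ∷ xs) ≈ 0#
  det-vanish {n} x xs = begin
    det (x ∷ x ∷ xs)
      ≈⟨ sum-cong (λ j → trans (*-congˡ {s j} (*-distribˡ-sum (x j) (inner j)))
           (*-distribˡ-sum (s j) (λ l → x j * inner j l))) ⟩
    sum (λ j → sum (F j))
      ≈⟨ antisymmetric-sum F anti ⟩
    0# ∎
    where
    s : ∀ {n} → Fin n → Carrier
    s j = sign (toℕ j)

    E : Fin (suc (suc n)) → Fin (suc n) → Carrier
    E j l = det (λ a b → xs a (punchIn j (punchIn l b)))

    inner : Fin (suc (suc n)) → Fin (suc n) → Carrier
    inner j l = s l * (x (punchIn j l) * E j l)

    F : Fin (suc (suc n)) → Fin (suc n) → Carrier
    F j l = s j * (x j * inner j l)

    anti : ∀ j l → F (punchIn j l) (swapped j l) ≈ - F j l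
    anti j l = begin
      s j′ * (x j′ * (s l′ * (x (punchIn j′ l′) * E j′ l′)))
        ≈⟨ *-congˡ (*-congˡ (*-congˡ (*-cong (reflexive (≡.cong x (punchIn-swapped j l)))
             (det-cong (λ a b → reflexive (≡.cong (xs a) (punchIn-punchIn-swapped j l b))))))) ⟩
      s j′ * (x j′ * (s l′ * (x j * E j l)))
        ≈⟨ solve 5 (λ s x s′ x′ e → s :* (x :* (s′ :* (x′ :* e))) := (s :* s′) :* (x :* (x′ :* e)))
             refl _ _ _ _ _ ⟩
      (s j′ * s l′) * (x j′ * (x j * E j l))
        ≈⟨ *-congʳ (sign-swapped j l) ⟩
      - (s j * s l) * (x j′ * (x j * E j l))
        ≈⟨ solve 5 (λ s x s′ x′ e → (:- (s :* s′)) :* (x :* (x′ :* e)) := :- (s :* (x′ :* (s′ :* (x :* e)))))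
             refl _ _ _ _ _ ⟩
      - F j l ∎
      where
      j′ = punchIn j l
      l′ = swapped j l

  -- With the first row fixed, `det` is a linear combination of minors, and each minor is a smaller
  -- determinant composed with the deletion of a column.
  det-alternating : ∀ {n} → Alternating (det {n})
  det-alternating {zero}  = tt
  det-alternating {suc n} = linear , vanish n , λ x → alternating-resp
    (λ M → sum-cong (λ j → *-assoc (sign (toℕ j)) (x j) (det (submatrix (x ∷ M) zero j))))
    (alternating-sum (λ j → sign (toℕ j) * x j) (λ j →
      alternating-∘ det-cong det-alternating (λ v l → v (punchIn j l)) (λ _ _ _ _ → refl)))
    where
    linear : LinearAtHead (det {suc n})
    linear a x y xs = trans
      (sum-cong (λ j → solve 5 (λ s a x y d → s :* ((a :* x :+ y) :* d) := a :* (s :* (x :* d)) :+ s :* (y :* d))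
        refl (sign (toℕ j)) a (x j) (y j) (d j)))
      (sum-linear a (λ j → sign (toℕ j) * (x j * d j)) (λ j → sign (toℕ j) * (y j * d j)))
      where
      d : Fin (suc n) → Carrier
      d j = det (λ k l → xs k (punchIn j l))

    vanish : ∀ n → VanishesOnRepeat (det {suc n})
    vanish zero    = tt
    vanish (suc n) = det-vanish

  insert-zero : Fin (suc n) → Vector Carrier n → Vector Carrier (suc n)
  insert-zero zero v zero = 0#
  insert-zero zero v (suc l) = v l
  insert-zero {suc n} (suc j) v zero    = v zero
  insert-zero {suc n} (suc j) v (suc l) = insert-zero j (tail v) l

  insert-zero-linear : ∀ (j : Fin (suc n)) a x y l →
    insert-zero j (a · x ⊕ y) l ≈ (a · insert-zero j x ⊕ insert-zero j y) l
  insert-zero-linear zero a x y zero =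
    solve 1 (λ a → :0 := a :* :0 :+ :0) refl a
  insert-zero-linear zero a x y (suc l) = refl
  insert-zero-linear {suc n} (suc j) a x y zero    = refl
  insert-zero-linear {suc n} (suc j) a x y (suc l) = insert-zero-linear j a (tail x) (tail y) l

  insert-zero-cong : ∀ (j : Fin (suc n)) {x y} → (∀ l → x l ≈ y l) →
                     ∀ l → insert-zero j x l ≈ insert-zero j y l
  insert-zero-cong zero x≈y zero    = refl
  insert-zero-cong zero x≈y (suc l) = x≈y l
  insert-zero-cong {suc n} (suc j) x≈y zero    = x≈y zero
  insert-zero-cong {suc n} (suc j) x≈y (suc l) = insert-zero-cong j (λ l → x≈y (suc l)) l

  insert-zero-𝟙 : ∀ (j : Fin (suc n)) k l → insert-zero j (𝟙 k) l ≈ 𝟙 (punchIn j k) l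
  insert-zero-𝟙 zero    k       zero    = refl
  insert-zero-𝟙 zero    k       (suc l) = refl
  insert-zero-𝟙 (suc j) zero    zero    = refl
  insert-zero-𝟙 (suc j) (suc k) zero    = refl
  insert-zero-𝟙 (suc j) zero    (suc l) = zero′ j l
    where
    zero′ : ∀ {n} (j : Fin (suc n)) l → insert-zero j (λ _ → 0#) l ≈ 0#
    zero′ zero zero = refl
    zero′ zero (suc l) = refl
    zero′ {suc n} (suc j) zero = refl
    zero′ {suc n} (suc j) (suc l) = zero′ j l
  insert-zero-𝟙 (suc j) (suc k) (suc l) = insert-zero-𝟙 j k l

  clear-entry : ∀ (j : Fin (suc n)) (t : Vector Carrier (suc n)) l →
                ((- t j) · 𝟙 j ⊕ t) l ≈ insert-zero j (t ∘ punchIn j) l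
  clear-entry zero t zero    = solve 1 (λ t → (:- t) :* :1 :+ t := :0) refl _
  clear-entry zero t (suc l) = solve 2 (λ t u → (:- t) :* :0 :+ u := u) refl _ _
  clear-entry {suc n} (suc j) t zero    = solve 2 (λ t u → (:- t) :* :0 :+ u := u) refl _ _
  clear-entry {suc n} (suc j) t (suc l) = clear-entry j (tail t) l

  -- Expand along the first row; once the head is the basis vector j, the alternating
  -- property makes the remaining rows matter only modulo it, i.e. with column j deleted.
  alternating-unique : ∀ {n} {D : Functional n n} → Congruent D → Alternating D →
                       ∀ M → D M ≈ det M * D 𝟙
  alternating-unique {zero}  D-cong alt M = trans (D-cong (λ ())) (sym (*-identityˡ _))
  alternating-unique {suc n} {D} D-cong alt M = begin
    D M
      ≈⟨ D-cong (∷-η M) ⟩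
    D (head M ∷ tail M)
      ≈⟨ D-expand D-cong alt (head M) (tail M) ⟩
    sum (λ j → M zero j * D (𝟙 j ∷ tail M))
      ≈⟨ sum-cong (λ j → *-congˡ {M zero j} (trans (column-deleted j) (*-congˡ (at-𝟙 j)))) ⟩
    sum (λ j → M zero j * (det (submatrix M zero j) * (sign (toℕ j) * D 𝟙)))
      ≈⟨ sum-cong (λ j → solve 4 (λ m d s e → m :* (d :* (s :* e)) := (s :* (m :* d)) :* e)
           refl (M zero j) (det (submatrix M zero j)) (sign (toℕ j)) (D 𝟙)) ⟩
    sum (λ j → sign (toℕ j) * (M zero j * det (submatrix M zero j)) * D 𝟙)
      ≈⟨ *-distribʳ-sum (D 𝟙) (λ j → sign (toℕ j) * (M zero j * det (submatrix M zero j))) ⟨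
    det M * D 𝟙 ∎
    where
    Dⱼ : Fin (suc n) → Functional n n
    Dⱼ j N = D (𝟙 j ∷ (insert-zero j ∘ N))

    Dⱼ-cong : ∀ j → Congruent (Dⱼ j)
    Dⱼ-cong j M≈N = D-cong (∷-cong (𝟙 j) (λ i → insert-zero-cong j (M≈N i)))

    column-deleted : ∀ j → D (𝟙 j ∷ tail M) ≈ det (submatrix M zero j) * Dⱼ j 𝟙
    column-deleted j = begin
      D (𝟙 j ∷ tail M)
        ≈⟨ add-multiples D-cong alt (𝟙 j) (λ i → - tail M i j) (tail M) ⟨
      D (𝟙 j ∷ (λ i → (- tail M i j) · 𝟙 j ⊕ tail M i))
        ≈⟨ D-cong (∷-cong (𝟙 j) (λ i → clear-entry j (tail M i))) ⟩
      Dⱼ j (submatrix M zero j)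
        ≈⟨ alternating-unique (Dⱼ-cong j)
             (alternating-∘ (restrict-cong D-cong (𝟙 j)) (proj₂ (proj₂ alt) (𝟙 j))
               (insert-zero j) (insert-zero-linear j)) (submatrix M zero j) ⟩
      det (submatrix M zero j) * Dⱼ j 𝟙 ∎

    at-𝟙 : ∀ j → Dⱼ j 𝟙 ≈ sign (toℕ j) * D 𝟙
    at-𝟙 j = begin
      Dⱼ j 𝟙
        ≈⟨ D-cong (∷-cong (𝟙 j) (insert-zero-𝟙 j)) ⟩
      D (𝟙 j ∷ (𝟙 ∘ punchIn j))
        ≈⟨ *-identityˡ _ ⟨
      1# * D (𝟙 j ∷ (𝟙 ∘ punchIn j))
        -- The sign is its own inverse; one copy is absorbed by moving row j of the identity to the
        -- head, the other remains.
        ≈⟨ *-congʳ (sign² (toℕ j)) ⟨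
      sign (toℕ j) * sign (toℕ j) * D (𝟙 j ∷ (𝟙 ∘ punchIn j))
        ≈⟨ *-assoc _ _ _ ⟩
      sign (toℕ j) * (sign (toℕ j) * D (𝟙 j ∷ (𝟙 ∘ punchIn j)))
        ≈⟨ *-congˡ (move-to-head D-cong alt 𝟙 j) ⟨
      sign (toℕ j) * D 𝟙 ∎

  det-𝟙 : ∀ n → det (𝟙 {n}) ≈ 1#
  det-𝟙 zero    = refl
  det-𝟙 (suc n) = trans
    (+-cong (trans (*-identityˡ _) (trans (*-identityˡ _) (det-𝟙 n)))
      (sum-zero {n} {λ j → sign (toℕ (suc j)) * (0# * det (submatrix 𝟙 zero (suc j)))} (λ j → trans (*-congˡ {sign (toℕ (suc j))} (zeroˡ (det (submatrix 𝟙 zero (suc j))))) (zeroʳ _))))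
    (+-identityʳ 1#)

  det-* : ∀ (M N : Matrix n) → det (M *ᴹ N) ≈ det M * det N
  det-* {n} M N = trans
    (alternating-unique {D = λ M → det (M *ᴹ N)}
      (λ M≈M′ → det-cong (λ i j → sum-cong (λ k → *-congʳ {N k j} (M≈M′ i k))))
      (alternating-∘ det-cong det-alternating (λ v j → sum (λ k → v k * N k j))
        (λ a x y j → trans
          (sum-cong (λ k → solve 4 (λ a x y n → (a :* x :+ y) :* n := a :* (x :* n) :+ y :* n) refl a (x k) (y k) (N k j)))
          (sum-linear a (λ k → x k * N k j) (λ k → y k * N k j))))
      M)
    (*-congˡ (det-cong (λ i j → sum-𝟙ˡ (λ k → N k j) i)))

  cofactor-expansion : ∀ (M : Matrix (suc n)) k →
    det M ≈ sum (λ j → sign (toℕ k ℕ.+ toℕ j) * (M k j * minor M k j))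
  cofactor-expansion M k = begin
    det M
      ≈⟨ move-to-head det-cong det-alternating M k ⟩
    sign (toℕ k) * det (M k ∷ (M ∘ punchIn k))
      ≈⟨ *-distribˡ-sum (sign (toℕ k)) (λ j → sign (toℕ j) * (M k j * minor M k j)) ⟩
    sum (λ j → sign (toℕ k) * (sign (toℕ j) * (M k j * minor M k j)))
      ≈⟨ sum-cong (λ j → trans (sym (*-assoc _ _ _)) (*-congʳ {M k j * minor M k j} (sym (sign-+ (toℕ k) (toℕ j))))) ⟩
    sum (λ j → sign (toℕ k ℕ.+ toℕ j) * (M k j * minor M k j)) ∎

  adj : Matrix n → Matrix n
  adj M j k = sign (toℕ k ℕ.+ toℕ j) * minor M k j

  -- Up to sign, this entry is the expansion of M with row k replaced by row i, a determinant with a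
  -- repeated row.
  *-adj-off : ∀ (M : Matrix (suc n)) {i k} → i ≢ k → (M *ᴹ adj M) i k ≈ 0#
  *-adj-off M {i} {k} i≢k = begin
    sum (λ j → M i j * (sign (toℕ k ℕ.+ toℕ j) * minor M k j))
      ≈⟨ sum-cong (λ j → trans (*-congˡ {M i j} (*-congʳ {minor M k j} (sign-+ (toℕ k) (toℕ j))))
           (solve 4 (λ m s t d → m :* ((s :* t) :* d) := s :* (t :* (m :* d))) refl
              (M i j) (sign (toℕ k)) (sign (toℕ j)) (minor M k j))) ⟩
    sum (λ j → sign (toℕ k) * (sign (toℕ j) * (M i j * minor M k j)))
      ≈⟨ *-distribˡ-sum (sign (toℕ k)) (λ j → sign (toℕ j) * (M i j * minor M k j)) ⟨
    sign (toℕ k) * det (M i ∷ (M ∘ punchIn k))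
      ≈⟨ *-congˡ (repeat-head det-cong det-alternating (M i) (M ∘ punchIn k) (punchOut k≢i)
           (λ j → reflexive (≡.cong (λ r → M r j) (Fin.punchIn-punchOut k≢i)))) ⟩
    sign (toℕ k) * 0#
      ≈⟨ zeroʳ _ ⟩
    0# ∎
    where
    k≢i : k ≢ i
    k≢i k≡i = i≢k (≡.sym k≡i)

  *-adj : ∀ (M : Matrix (suc n)) i k → (M *ᴹ adj M) i k ≈ det M * 𝟙 i k
  *-adj M i k with i Fin.≟ k
  ... | no  i≢k = trans (*-adj-off M i≢k) (sym (zeroʳ (det M)))
  ... | yes ≡.refl = trans
    (sum-cong (λ j → solve 3 (λ m s d → m :* (s :* d) := s :* (m :* d)) refl (M i j) (sign (toℕ i ℕ.+ toℕ j)) (minor M i j)))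
    (trans (sym (cofactor-expansion M i)) (sym (*-identityʳ _)))

  sum-*-assoc : ∀ {m n} (x : Vector Carrier m) (N : Fin m → Fin n → Carrier) (y : Vector Carrier n) →
    sum (λ i → x i * sum (λ j → N i j * y j)) ≈ sum (λ j → sum (λ i → x i * N i j) * y j)
  sum-*-assoc x N y = begin
    sum (λ i → x i * sum (λ j → N i j * y j))
      ≈⟨ sum-cong (λ i → *-distribˡ-sum (x i) (λ j → N i j * y j)) ⟩
    sum (λ i → sum (λ j → x i * (N i j * y j)))
      ≈⟨ ∑-comm (λ i j → x i * (N i j * y j)) ⟩
    sum (λ j → sum (λ i → x i * (N i j * y j)))
      ≈⟨ sum-cong (λ j → trans (sum-cong (λ i → sym (*-assoc (x i) (N i j) (y j))))
           (sym (*-distribʳ-sum (y j) (λ i → x i * N i j)))) ⟩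
    sum (λ j → sum (λ i → x i * N i j) * y j) ∎

  -- Multiplication of x M = 0 by the adjugate on the right. The factor `det M` stays in the
  -- conclusion, as it cannot be cancelled in a general ring; for an entry `x k` equal to `1#` this
  -- makes the determinant vanish.
  left-kernel : ∀ (M : Matrix (suc n)) (x : Vector Carrier (suc n)) →
    (∀ j → sum (λ i → x i * M i j) ≈ 0#) → ∀ k → det M * x k ≈ 0#
  left-kernel M x xM≈0 k = begin
    det M * x k
      ≈⟨ *-congˡ (sum-𝟙ʳ x k) ⟨
    det M * sum (λ i → x i * 𝟙 i k)
      ≈⟨ *-distribˡ-sum (det M) (λ i → x i * 𝟙 i k) ⟩
    sum (λ i → det M * (x i * 𝟙 i k))
      ≈⟨ sum-cong (λ i → trans (solve 3 (λ d x e → d :* (x :* e) := x :* (d :* e)) refl (det M) (x i) (𝟙 i k))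
           (*-congˡ {x i} (sym (*-adj M i k)))) ⟩
    sum (λ i → x i * (M *ᴹ adj M) i k)
      ≈⟨ sum-*-assoc x M (λ j → adj M j k) ⟩
    sum (λ j → sum (λ i → x i * M i j) * adj M j k)
      ≈⟨ sum-zero (λ j → trans (*-congʳ {adj M j k} (xM≈0 j)) (zeroˡ _)) ⟩
    0# ∎

  *ᴹ-assoc : ∀ (M N P : Matrix n) → (M *ᴹ N) *ᴹ P ≈ᴹ M *ᴹ (N *ᴹ P)
  *ᴹ-assoc M N P i j = sym (sum-*-assoc (M i) N (λ k → P k j))

  *ᴹ-congˡ : ∀ (M : Matrix n) {N P} → N ≈ᴹ P → M *ᴹ N ≈ᴹ M *ᴹ P
  *ᴹ-congˡ M N≈P i j = sum-cong (λ k → *-congˡ {M i k} (N≈P k j))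

  *ᴹ-congʳ : ∀ {M N : Matrix n} (P : Matrix n) → M ≈ᴹ N → M *ᴹ P ≈ᴹ N *ᴹ P
  *ᴹ-congʳ P M≈N i j = sum-cong (λ k → *-congʳ {P k j} (M≈N i k))

  *ᴹ-identityˡ : ∀ (M : Matrix n) → 𝟙 *ᴹ M ≈ᴹ M
  *ᴹ-identityˡ M i j = sum-𝟙ˡ (λ k → M k j) i

  *ᴹ-identityʳ : ∀ (M : Matrix n) → M *ᴹ 𝟙 ≈ᴹ M
  *ᴹ-identityʳ M i j = sum-𝟙ʳ (M i) j

  inverse-unique : ∀ (M N P : Matrix n) → N *ᴹ M ≈ᴹ 𝟙 → M *ᴹ P ≈ᴹ 𝟙 → N ≈ᴹ P
  inverse-unique M N P NM≈𝟙 MP≈𝟙 i j = begin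
    N i j                 ≈⟨ *ᴹ-identityʳ N i j ⟨
    (N *ᴹ 𝟙) i j          ≈⟨ *ᴹ-congˡ N MP≈𝟙 i j ⟨
    (N *ᴹ (M *ᴹ P)) i j   ≈⟨ *ᴹ-assoc N M P i j ⟨
    ((N *ᴹ M) *ᴹ P) i j   ≈⟨ *ᴹ-congʳ P NM≈𝟙 i j ⟩
    (𝟙 *ᴹ P) i j          ≈⟨ *ᴹ-identityˡ P i j ⟩
    P i j                 ∎

  -- N M adj(M) is evaluated in both bracketings, which replaces the division of adj(M) by the
  -- determinant.
  adj≈det*inverse : ∀ (M N : Matrix (suc n)) → N *ᴹ M ≈ᴹ 𝟙 → ∀ i j → adj M i j ≈ det M * N i j
  adj≈det*inverse M N NM≈𝟙 i j = begin
    adj M i j                               ≈⟨ *ᴹ-identityˡ (adj M) i j ⟨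
    (𝟙 *ᴹ adj M) i j                        ≈⟨ *ᴹ-congʳ (adj M) NM≈𝟙 i j ⟨
    ((N *ᴹ M) *ᴹ adj M) i j                 ≈⟨ *ᴹ-assoc N M (adj M) i j ⟩
    (N *ᴹ (M *ᴹ adj M)) i j                 ≈⟨ *ᴹ-congˡ N (*-adj M) i j ⟩
    sum (λ k → N i k * (det M * 𝟙 k j))     ≈⟨ sum-cong (λ k → solve 3 (λ x d e → x :* (d :* e) := d :* (x :* e))
                                                 refl (N i k) (det M) (𝟙 k j)) ⟩
    sum (λ k → det M * (N i k * 𝟙 k j))     ≈⟨ *-distribˡ-sum (det M) (λ k → N i k * 𝟙 k j) ⟨
    det M * sum (λ k → N i k * 𝟙 k j)       ≈⟨ *-congˡ (sum-𝟙ʳ (N i) j) ⟩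
    det M * N i j                           ∎

-- Evaluation of polynomials, monic polynomials, coefficients in a subring

module PolynomialEvaluation {c ℓ} (R : CommutativeRing c ℓ) where
  open List using ([]; _∷_)
  open Unary using ([]; _∷_)
  open CommutativeRing R hiding (zero)
  open Matrices rawRing
  open Polynomials rawRing
  open Sums R
  open IntegerSolver R
  open ≈-Reasoning setoid
  private module Mₚ = Matrices poly-rawRing

  eval : Carrier → Poly → Carrier
  eval z []      = 0#
  eval z (a ∷ p) = a + z * eval z p

  eval-zero : ∀ z p → (∀ k → coeff p k ≈ 0#) → eval z p ≈ 0#
  eval-zero z []      p≈0 = refl
  eval-zero z (a ∷ p) p≈0 = trans
    (+-cong (p≈0 0) (trans (*-congˡ (eval-zero z p (λ k → p≈0 (suc k)))) (zeroʳ z)))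
    (+-identityˡ 0#)

  -- Equal polynomials may have lists of different lengths; the surplus consists of zero
  -- coefficients, which `eval-zero` handles.
  eval-cong : ∀ z p q → p ≈ₚ q → eval z p ≈ eval z q
  eval-cong z []      q       p≈q = sym (eval-zero z q (λ k → sym (p≈q k)))
  eval-cong z (a ∷ p) []      p≈q = eval-zero z (a ∷ p) p≈q
  eval-cong z (a ∷ p) (b ∷ q) p≈q =
    +-cong (p≈q 0) (*-congˡ (eval-cong z p q (λ k → p≈q (suc k))))

  eval-+ : ∀ z p q → eval z (p +ₚ q) ≈ eval z p + eval z q
  eval-+ z []      q       = sym (+-identityˡ _)
  eval-+ z (a ∷ p) []      = sym (+-identityʳ _)
  eval-+ z (a ∷ p) (b ∷ q) = trans (+-congˡ (*-congˡ (eval-+ z p q)))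
    (solve 5 (λ a b z p q → (a :+ b) :+ z :* (p :+ q) := (a :+ z :* p) :+ (b :+ z :* q)) refl a b z _ _)

  eval-scale : ∀ z a p → eval z (List.map (a *_) p) ≈ a * eval z p
  eval-scale z a []      = sym (zeroʳ a)
  eval-scale z a (b ∷ p) = trans (+-congˡ (*-congˡ (eval-scale z a p)))
    (solve 4 (λ z a b p → a :* b :+ z :* (a :* p) := a :* (b :+ z :* p)) refl z a b _)

  eval-* : ∀ z p q → eval z (p *ₚ q) ≈ eval z p * eval z q
  eval-* z []      q = sym (zeroˡ _)
  eval-* z (a ∷ p) q = begin
    eval z (List.map (a *_) q +ₚ (0# ∷ p *ₚ q))
      ≈⟨ eval-+ z (List.map (a *_) q) (0# ∷ p *ₚ q) ⟩
    eval z (List.map (a *_) q) + (0# + z * eval z (p *ₚ q))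
      ≈⟨ +-cong (eval-scale z a q) (+-congˡ (*-congˡ (eval-* z p q))) ⟩
    a * eval z q + (0# + z * (eval z p * eval z q))
      ≈⟨ solve 4 (λ a q z p → a :* q :+ (:0 :+ z :* (p :* q)) := (a :+ z :* p) :* q) refl a _ z _ ⟩
    (a + z * eval z p) * eval z q ∎

  eval-const : ∀ z a → eval z (const a) ≈ a
  eval-const z a = solve 2 (λ z a → a :+ z :* :0 := a) refl z a

  eval-sum : ∀ {n} z (f : Vector Poly n) → eval z (Mₚ.sum f) ≈ sum (λ i → eval z (f i))
  eval-sum {zero}  z f = refl
  eval-sum {suc n} z f = trans (eval-+ z (head f) (Mₚ.sum (tail f))) (+-congˡ (eval-sum z (tail f)))

  eval-product : ∀ {n} z (f : Vector Poly n) → eval z (Mₚ.product f) ≈ product (λ i → eval z (f i))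
  eval-product {zero}  z f = eval-const z 1#
  eval-product {suc n} z f =
    trans (eval-* z (head f) (Mₚ.product (tail f))) (*-congˡ (eval-product z (tail f)))

  eval-sign : ∀ z k → eval z (Mₚ.sign k) ≈ sign k
  eval-sign z zero    = eval-const z 1#
  eval-sign z (suc k) = trans (eval-* z (-ₚ const 1#) (Mₚ.sign k))
    (*-cong (eval-const z (- 1#)) (eval-sign z k))

  -- Follows the recursion of `det` one operation at a time, so the polynomials enter only as a raw
  -- ring.
  eval-det : ∀ {n} z (P : Mₚ.Matrix n) → eval z (Mₚ.det P) ≈ det (λ i j → eval z (P i j))
  eval-det {zero}  z P = eval-const z 1#
  eval-det {suc n} z P = trans
    (eval-sum z (λ j → Mₚ.sign (toℕ j) *ₚ (P zero j *ₚ Mₚ.det (Mₚ.submatrix P zero j))))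
    (sum-cong (λ j → trans (eval-* z (Mₚ.sign (toℕ j)) (P zero j *ₚ Mₚ.det (Mₚ.submatrix P zero j)))
      (*-cong (eval-sign z (toℕ j)) (trans (eval-* z (P zero j) (Mₚ.det (Mₚ.submatrix P zero j)))
        (*-congˡ (eval-det z (Mₚ.submatrix P zero j)))))))

  eval-charPoly : ∀ {n} z (M : Matrix n) → eval z (charPoly M) ≈ det (λ i j → z * 𝟙 i j - M i j)
  eval-charPoly z M = trans (eval-det z (λ i j → (X *ₚ Mₚ.𝟙 i j) +ₚ (-ₚ const (M i j)))) (det-cong (λ i j → begin
    eval z ((X *ₚ Mₚ.𝟙 i j) +ₚ (-ₚ const (M i j)))
      ≈⟨ eval-+ z (X *ₚ Mₚ.𝟙 i j) (-ₚ const (M i j)) ⟩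
    eval z (X *ₚ Mₚ.𝟙 i j) + eval z (-ₚ const (M i j))
      ≈⟨ +-cong (eval-* z X (Mₚ.𝟙 i j)) (eval-const z (- M i j)) ⟩
    (0# + z * (1# + z * 0#)) * eval z (Mₚ.𝟙 i j) - M i j
      ≈⟨ +-congʳ (*-cong (solve 1 (λ z → :0 :+ z :* (:1 :+ z :* :0) := z) refl z) (eval-𝟙 i j)) ⟩
    z * 𝟙 i j - M i j ∎))
    where
    open Determinants R using (det-cong)
    eval-𝟙 : ∀ {n} (i j : Fin n) → eval z (Mₚ.𝟙 i j) ≈ 𝟙 i j
    eval-𝟙 i j with does (i Fin.≟ j)
    ... | true  = eval-const z 1#
    ... | false = refl

  linearFactors : ∀ {n} → Vector Carrier n → Poly
  linearFactors μs = Mₚ.product (λ i → X +ₚ (-ₚ const (μs i)))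

  eval-linearFactors : ∀ {n} z (μs : Vector Carrier n) →
    eval z (linearFactors μs) ≈ product (λ i → z - μs i)
  eval-linearFactors {n} z μs = trans (eval-product z (λ i → X +ₚ (-ₚ const (μs i)))) (product-cong n μs)
    where
    product-cong : ∀ n (μs : Vector Carrier n) →
      product (λ i → eval z (X +ₚ (-ₚ const (μs i)))) ≈ product (λ i → z - μs i)
    product-cong zero    μs = refl
    product-cong (suc n) μs = *-cong
      (solve 2 (λ z μ → (:0 :+ (:- μ)) :+ z :* (:1 :+ z :* :0) := z :- μ) refl z (μs zero))
      (product-cong n (tail μs))

  -- Stated through coefficients: the length of a list does not give the degree, and trailing zeros
  -- cannot be recognised and trimmed.
  Monic : ℕ → Poly → Set ℓ
  Monic n p = coeff p n ≈ 1# × (∀ k → n < k → coeff p k ≈ 0#)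

  monic-resp : ∀ {n} p q → p ≈ₚ q → Monic n q → Monic n p
  monic-resp p q p≈q (q≈1 , q≈0) = trans (p≈q _) q≈1 , λ k n<k → trans (p≈q k) (q≈0 k n<k)

  coeff-+ : ∀ p q k → coeff (p +ₚ q) k ≈ coeff p k + coeff q k
  coeff-+ []      q       k       = sym (+-identityˡ _)
  coeff-+ (a ∷ p) []      k       = sym (+-identityʳ _)
  coeff-+ (a ∷ p) (b ∷ q) zero    = refl
  coeff-+ (a ∷ p) (b ∷ q) (suc k) = coeff-+ p q k

  coeff-scale : ∀ a p k → coeff (List.map (a *_) p) k ≈ a * coeff p k
  coeff-scale a []      k       = sym (zeroʳ a)
  coeff-scale a (b ∷ p) zero    = refl
  coeff-scale a (b ∷ p) (suc k) = coeff-scale a p k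

  coeff-linear* : ∀ a p k → coeff ((a ∷ 1# ∷ []) *ₚ p) (suc k) ≈ a * coeff p (suc k) + coeff p k
  coeff-linear* a p k = begin
    coeff ((a ∷ 1# ∷ []) *ₚ p) (suc k)
      ≈⟨ coeff-+ (List.map (a *_) p) _ (suc k) ⟩
    coeff (List.map (a *_) p) (suc k) + coeff (List.map (1# *_) p +ₚ const 0#) k
      ≈⟨ +-cong (coeff-scale a p (suc k)) (coeff-+ (List.map (1# *_) p) (const 0#) k) ⟩
    a * coeff p (suc k) + (coeff (List.map (1# *_) p) k + coeff (const 0#) k)
      ≈⟨ +-congˡ (+-cong (coeff-scale 1# p k) (coeff-0 k)) ⟩
    a * coeff p (suc k) + (1# * coeff p k + 0#)
      ≈⟨ +-congˡ (solve 1 (λ x → :1 :* x :+ :0 := x) refl _) ⟩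
    a * coeff p (suc k) + coeff p k ∎
    where
    coeff-0 : ∀ k → coeff (const 0#) k ≈ 0#
    coeff-0 zero    = refl
    coeff-0 (suc k) = refl

  -- The characteristic polynomial inherits monicity from here, through its assumed factorisation,
  -- and not from an analysis of the determinant.
  linearFactors-monic : ∀ {n} (μs : Vector Carrier n) → Monic n (linearFactors μs)
  linearFactors-monic {zero}  μs = refl , λ where (suc k) _ → refl
  linearFactors-monic {suc n} μs with linearFactors-monic {n} (tail μs)
  ... | q≈1 , q≈0 =
    trans (coeff-linear* a q n) (trans (+-cong (trans (*-congˡ (q≈0 (suc n) (ℕ.s≤s ℕ.≤-refl))) (zeroʳ a)) q≈1) (+-identityˡ 1#)) ,
    λ where
      (suc k) (s<s n<k) → trans (coeff-linear* a q k)
        (trans (+-cong (trans (*-congˡ (q≈0 (suc k) (ℕ.m<n⇒m<1+n n<k))) (zeroʳ a)) (q≈0 k n<k)) (+-identityˡ 0#))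
    where
    a = 0# - μs zero
    q = linearFactors (tail μs)

  record IsSubring {k} (K : Pred Carrier k) : Set (c ⊔ k) where
    field
      0-closed   : 0# ∈ K
      1-closed   : 1# ∈ K
      +-closed   : ∀ {x y} → x ∈ K → y ∈ K → x + y ∈ K
      *-closed   : ∀ {x y} → x ∈ K → y ∈ K → x * y ∈ K
      neg-closed : ∀ {x} → x ∈ K → - x ∈ K

  module _ {k} {K : Pred Carrier k} (K-subring : IsSubring K) where
    open IsSubring K-subring

    sum-closed : ∀ {n} {f : Vector Carrier n} → (∀ i → f i ∈ K) → sum f ∈ K
    sum-closed {zero}  f∈K = 0-closed
    sum-closed {suc n} f∈K = +-closed (f∈K zero) (sum-closed (f∈K ∘ suc))

    sign-closed : ∀ n → sign n ∈ K
    sign-closed zero    = 1-closed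
    sign-closed (suc n) = *-closed (neg-closed 1-closed) (sign-closed n)

    𝟙-closed : ∀ {n} (i j : Fin n) → 𝟙 i j ∈ K
    𝟙-closed i j with does (i Fin.≟ j)
    ... | true  = 1-closed
    ... | false = 0-closed

    det-closed : ∀ {n} {M : Matrix n} → (∀ i j → M i j ∈ K) → det M ∈ K
    det-closed {zero}  M∈K = 1-closed
    det-closed {suc n} M∈K = sum-closed (λ j → *-closed (sign-closed (toℕ j))
      (*-closed (M∈K zero j) (det-closed (λ i l → M∈K (suc i) (punchIn j l)))))

    private
      scale-closed : ∀ {a p} → a ∈ K → All K p → All K (List.map (a *_) p)
      scale-closed a∈K []          = []
      scale-closed a∈K (b∈K ∷ p∈K) = *-closed a∈K b∈K ∷ scale-closed a∈K p∈K

      +ₚ-closed : ∀ {p q} → All K p → All K q → All K (p +ₚ q)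
      +ₚ-closed []          q∈K         = q∈K
      +ₚ-closed (a∈K ∷ p∈K) []          = a∈K ∷ p∈K
      +ₚ-closed (a∈K ∷ p∈K) (b∈K ∷ q∈K) = +-closed a∈K b∈K ∷ +ₚ-closed p∈K q∈K

      *ₚ-closed : ∀ {p q} → All K p → All K q → All K (p *ₚ q)
      *ₚ-closed []          q∈K = []
      *ₚ-closed (a∈K ∷ p∈K) q∈K = +ₚ-closed (scale-closed a∈K q∈K) (0-closed ∷ *ₚ-closed p∈K q∈K)

      sumₚ-closed : ∀ {n} {f : Vector Poly n} → (∀ i → All K (f i)) → All K (Mₚ.sum f)
      sumₚ-closed {zero}  f∈K = []
      sumₚ-closed {suc n} f∈K = +ₚ-closed (f∈K zero) (sumₚ-closed (f∈K ∘ suc))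

      signₚ-closed : ∀ n → All K (Mₚ.sign n)
      signₚ-closed zero    = 1-closed ∷ []
      signₚ-closed (suc n) = *ₚ-closed (neg-closed 1-closed ∷ []) (signₚ-closed n)

      detₚ-closed : ∀ {n} {P : Mₚ.Matrix n} → (∀ i j → All K (P i j)) → All K (Mₚ.det P)
      detₚ-closed {zero}  P∈K = 1-closed ∷ []
      detₚ-closed {suc n} P∈K = sumₚ-closed (λ j → *ₚ-closed (signₚ-closed (toℕ j))
        (*ₚ-closed (P∈K zero j) (detₚ-closed (λ i l → P∈K (suc i) (punchIn j l)))))

      𝟙ₚ-closed : ∀ {n} (i j : Fin n) → All K (Mₚ.𝟙 i j)
      𝟙ₚ-closed i j with does (i Fin.≟ j)
      ... | true  = 1-closed ∷ []
      ... | false = []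

    charPoly-closed : ∀ {n} {M : Matrix n} → (∀ i j → M i j ∈ K) → All K (charPoly M)
    charPoly-closed M∈K = detₚ-closed (λ i j →
      +ₚ-closed (*ₚ-closed (0-closed ∷ 1-closed ∷ []) (𝟙ₚ-closed i j)) (neg-closed (M∈K i j) ∷ []))

    -- Separates the leading power from a combination of exactly n lower powers, which is the form
    -- in which a root reduces its n-th power.
    monic-eval : ∀ {n p} → Monic n p → All K p →
      Σ[ a ∈ Vector Carrier n ] (∀ i → a i ∈ K) ×
        (∀ z → eval z p ≈ z ^ n + sum (λ i → a i * z ^ toℕ i))
    -- The empty list is monic only when `0#` and `1#` agree; then all elements agree, and this case
    -- and the later one for `[]` hold trivially.
    monic-eval {zero} {[]} (0≈1 , _) _ = (λ ()) , (λ ()) , λ z → trans 0≈1 (sym (+-identityʳ 1#))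
    monic-eval {zero} {a ∷ p} (a≈1 , p≈0) _ = (λ ()) , (λ ()) , λ z →
      +-cong a≈1 (trans (*-congˡ (eval-zero z p (λ k → p≈0 (suc k) z<s))) (zeroʳ z))
    monic-eval {suc n} {[]} (0≈1 , _) _ = (λ _ → 0#) , (λ _ → 0-closed) , λ z →
      trans (sym (zeroˡ _)) (trans (*-congʳ 0≈1) (*-identityˡ _))
    monic-eval {suc n} {a ∷ p} (p≈1 , p≈0) (a∈K ∷ p∈K)
      with b , b∈K , p≈ ← monic-eval {n} {p} (p≈1 , λ k n<k → p≈0 (suc k) (s<s n<k)) p∈K =
      a Vector.∷ b , (λ { zero → a∈K ; (suc i) → b∈K i }) , λ z → begin
        a + z * eval z p
          ≈⟨ +-congˡ (*-congˡ (p≈ z)) ⟩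
        a + z * (z ^ n + sum (λ i → b i * z ^ toℕ i))
          ≈⟨ solve 4 (λ a z y s → a :+ z :* (y :+ s) := z :* y :+ (a :* :1 :+ z :* s)) refl a z (z ^ n) _ ⟩
        z * z ^ n + (a * 1# + z * sum (λ i → b i * z ^ toℕ i))
          ≈⟨ +-congˡ (+-congˡ (trans (*-distribˡ-sum z (λ i → b i * z ^ toℕ i))
               (sum-cong (λ i → solve 3 (λ z b y → z :* (b :* y) := b :* (z :* y)) refl z (b i) (z ^ toℕ i))))) ⟩
        z * z ^ n + (a * 1# + sum (λ i → b i * (z * z ^ toℕ i))) ∎

-- Invertible elements and local rings

module Units {c ℓ} (R : CommutativeRing c ℓ) where
  open CommutativeRing R hiding (zero)
  open Matrices rawRing using (product; _^_)
  open IntegerSolver R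

  record Invertible (x : Carrier) : Set (c ⊔ ℓ) where
    constructor _,_
    field
      inverse   : Carrier
      *-inverse : x * inverse ≈ 1#

  NonTrivial : Set ℓ
  NonTrivial = 1# ≉ 0#

  -- Constructive locality: the disjunction is data that names an invertible summand. It is the
  -- source of case distinctions in a ring without decidable equality.
  Local : Set (c ⊔ ℓ)
  Local = ∀ x y → Invertible (x + y) → Invertible x ⊎ Invertible y

  Tight : Set (c ⊔ ℓ)
  Tight = ∀ x → ¬ Invertible x → x ≈ 0#

  Discrete : ∀ {k} → Pred Carrier k → Set (c ⊔ ℓ ⊔ k)
  Discrete K = ∀ {x} → x ∈ K → x ≈ 0# ⊎ (Σ[ y ∈ Carrier ] (y ∈ K) × (x * y ≈ 1#))

  invertible-resp : ∀ {x y} → x ≈ y → Invertible x → Invertible y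
  invertible-resp x≈y (u , xu≈1) = u , trans (*-congʳ (sym x≈y)) xu≈1

  invertible-factorˡ : ∀ x y → Invertible (x * y) → Invertible x
  invertible-factorˡ x y (u , xyu≈1) = y * u , trans (sym (*-assoc x y u)) xyu≈1

  invertible-cancelˡ : ∀ {x y} → Invertible x → x * y ≈ 0# → y ≈ 0#
  invertible-cancelˡ {x} {y} (u , xu≈1) xy≈0 = trans
    (trans (sym (*-identityʳ y)) (trans (*-congˡ (sym xu≈1))
      (solve 3 (λ x y u → y :* (x :* u) := (x :* y) :* u) refl x y u)))
    (trans (*-congʳ xy≈0) (zeroˡ u))

  invertible-≉0 : NonTrivial → ∀ {x} → Invertible x → x ≉ 0#
  invertible-≉0 1≉0 (u , xu≈1) x≈0 = 1≉0 (trans (sym xu≈1) (trans (*-congʳ x≈0) (zeroˡ u)))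

  invertible-^ : ∀ {x} → Invertible x → ∀ k → Invertible (x ^ k)
  invertible-^ x-inv zero = 1# , *-identityˡ 1#
  invertible-^ {x} (u , xu≈1) (suc k) with v , yv≈1 ← invertible-^ (u , xu≈1) k =
    u * v , trans (solve 4 (λ x y u v → (x :* y) :* (u :* v) := (x :* u) :* (y :* v)) refl x (x ^ k) u v)
      (trans (*-cong xu≈1 yv≈1) (*-identityˡ 1#))

  -- Invertible factors are cancelled one after another until a zero factor appears; if none did,
  -- the empty product `1#` would vanish.
  product-zero : NonTrivial → ∀ {n} (f : Vector Carrier n) → (∀ i → f i ≈ 0# ⊎ Invertible (f i)) →
                 product f ≈ 0# → Σ[ i ∈ Fin n ] f i ≈ 0#
  product-zero 1≉0 {zero}  f f? 1≈0 = ⊥-elim (1≉0 1≈0)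
  product-zero 1≉0 {suc n} f f? Πf≈0 with f? zero
  ... | inj₁ f₀≈0  = zero , f₀≈0
  ... | inj₂ f₀-inv with i , fᵢ≈0 ← product-zero 1≉0 (tail f) (f? ∘ suc) (invertible-cancelˡ f₀-inv Πf≈0) =
    suc i , fᵢ≈0

-- Algebraic elements over a discrete subfield

-- K is a discrete subfield of a local ring whose apartness (invertibility of the difference)
-- is tight; ℂ is such a ring, although equality in it is not decidable.
module AlgebraicElements {c ℓ k} (R : CommutativeRing c ℓ)
  (1≉0 : Units.NonTrivial R) (local : Units.Local R) (tight : Units.Tight R)
  (K : Pred (CommutativeRing.Carrier R) k)
  (K-subring : PolynomialEvaluation.IsSubring R K) (K-discrete : Units.Discrete R K)
  where
  open CommutativeRing R hiding (zero)
  open Units R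
  open PolynomialEvaluation R
  open Matrices rawRing
  open Polynomials rawRing
  open Sums R
  open Determinants R using (sum-*-assoc; left-kernel)
  open IntegerSolver R
  open IsSubring K-subring
  open SumProps semiring using (sum-remove)
  open RingProps ring using (x∙y⁻¹≈ε⇒x≈y)
  open ≈-Reasoning setoid

  private
    pivot : ∀ {n} {x : Vector Carrier n} → (∀ i → x i ∈ K) →
      (∀ i → x i ≈ 0#) ⊎ (Σ[ i ∈ Fin n ] Σ[ y ∈ Carrier ] (y ∈ K) × (x i * y ≈ 1#))
    pivot {zero}  x∈K = inj₁ (λ ())
    pivot {suc n} x∈K with K-discrete (x∈K zero) | pivot (x∈K ∘ suc)
    ... | inj₂ y       | _                = inj₂ (zero , y)
    ... | inj₁ _       | inj₂ (i , y)     = inj₂ (suc i , y)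
    ... | inj₁ x₀≈0    | inj₁ x≈0         = inj₁ λ { zero → x₀≈0 ; (suc i) → x≈0 i }

    insertAt-closed : ∀ {n} {a : Vector Carrier n} i {b} → (∀ j → a j ∈ K) → b ∈ K → ∀ j → insertAt a i b j ∈ K
    insertAt-closed zero a∈K b∈K zero    = b∈K
    insertAt-closed zero a∈K b∈K (suc j) = a∈K j
    insertAt-closed {suc n} (suc i) a∈K b∈K zero    = a∈K zero
    insertAt-closed {suc n} (suc i) a∈K b∈K (suc j) = insertAt-closed i (a∈K ∘ suc) b∈K j

  -- Nontriviality is witnessed by an invertible coefficient, the form in which locality can exploit
  -- it.
  Dependent : ∀ {m n} → (Fin m → Vector Carrier n) → Set _
  Dependent {m} v = Σ[ a ∈ Vector Carrier m ] (∀ i → a i ∈ K) ×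
    (Σ[ i ∈ Fin m ] Invertible (a i)) × (∀ j → sum (λ i → a i * v i j) ≈ 0#)

  -- Gaussian elimination on the first coordinate. If it vanishes throughout, one vector and this
  -- coordinate are dropped. Otherwise a vector with invertible first coordinate clears it from the
  -- others, and a relation among the reduced vectors is lifted back.
  dependent : ∀ {n} (v : Fin (suc n) → Vector Carrier n) → (∀ i j → v i j ∈ K) → Dependent v
  dependent {zero} v v∈K = (λ _ → 1#) , (λ _ → 1-closed) , (zero , 1# , *-identityˡ 1#) , λ ()
  dependent {suc n} v v∈K with pivot (λ i → v∈K i zero)
  ... | inj₁ v₀≈0
    with a , a∈K , (i , aᵢ-inv) , av≈0 ← dependent (λ i j → v (suc i) (suc j)) (λ i j → v∈K (suc i) (suc j)) =
    0# Vector.∷ a , (λ { zero → 0-closed ; (suc i) → a∈K i }) , (suc i , aᵢ-inv) , λ where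
      zero    → sum-zero {suc (suc n)} {λ i → (0# Vector.∷ a) i * v i zero}
                  (λ i → trans (*-congˡ {(0# Vector.∷ a) i} (v₀≈0 i)) (zeroʳ _))
      (suc j) → trans (+-cong (zeroˡ _) (av≈0 j)) (+-identityˡ 0#)
  ... | inj₂ (p , u , u∈K , vₚu≈1)
    with a , a∈K , (i , aᵢ-inv) , aw≈0 ← dependent
           (λ i j → v (punchIn p i) (suc j) - (v (punchIn p i) zero * u) * v p (suc j))
           (λ i j → +-closed (v∈K _ _) (neg-closed (*-closed (*-closed (v∈K _ _) u∈K) (v∈K _ _)))) =
    b , insertAt-closed p a∈K (neg-closed s∈K) ,
    (punchIn p i , invertible-resp (reflexive (≡.sym (VectorProps.insertAt-punchIn a p (- s) i))) aᵢ-inv) ,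
    relation
    where
    r : Vector Carrier (suc n)
    r i = v (punchIn p i) zero * u

    -- The total multiple of the pivot vector subtracted in the reduced relation; `- s` is therefore
    -- its coefficient in the lifted one.
    s : Carrier
    s = sum (λ i → a i * r i)

    s∈K : s ∈ K
    s∈K = sum-closed K-subring (λ i → *-closed (a∈K i) (*-closed (v∈K (punchIn p i) zero) u∈K))

    b : Vector Carrier (suc (suc n))
    b = insertAt a p (- s)

    w : Fin (suc n) → Vector Carrier (suc n)
    w i j = v (punchIn p i) j - r i * v p j

    aw≈0′ : ∀ j → sum (λ i → a i * w i j) ≈ 0#
    aw≈0′ zero    = sum-zero {suc n} {λ i → a i * w i zero} (λ i → begin
      a i * (v (punchIn p i) zero - v (punchIn p i) zero * u * v p zero)
        ≈⟨ solve 4 (λ a v u q → a :* (v :- v :* u :* q) := a :* v :- a :* v :* (q :* u)) refl (a i) _ u _ ⟩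
      a i * v (punchIn p i) zero - a i * v (punchIn p i) zero * (v p zero * u)
        ≈⟨ +-congˡ (-‿cong (*-congˡ vₚu≈1)) ⟩
      a i * v (punchIn p i) zero - a i * v (punchIn p i) zero * 1#
        ≈⟨ solve 1 (λ x → x :- x :* :1 := :0) refl _ ⟩
      0# ∎)
    aw≈0′ (suc j) = aw≈0 j

    relation : ∀ j → sum (λ i → b i * v i j) ≈ 0#
    relation j = begin
      sum (λ i → b i * v i j)
        ≈⟨ sum-remove {i = p} (λ i → b i * v i j) ⟩
      b p * v p j + sum (λ i → b (punchIn p i) * v (punchIn p i) j)
        ≈⟨ +-cong (*-congʳ (reflexive (VectorProps.insertAt-lookup a p (- s))))
             (sum-cong (λ i → trans (*-congʳ {v (punchIn p i) j} (reflexive (VectorProps.insertAt-punchIn a p (- s) i)))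
               (solve 4 (λ a v r q → a :* v := (a :* r) :* q :+ a :* (v :- r :* q)) refl
                 (a i) (v (punchIn p i) j) (r i) (v p j)))) ⟩
      - s * v p j + sum (λ i → a i * r i * v p j + a i * w i j)
        ≈⟨ +-congˡ (∑-distrib-+ (λ i → a i * r i * v p j) (λ i → a i * w i j)) ⟩
      - s * v p j + (sum (λ i → a i * r i * v p j) + sum (λ i → a i * w i j))
        ≈⟨ +-congˡ (+-cong (sym (*-distribʳ-sum (v p j) (λ i → a i * r i))) (aw≈0′ j)) ⟩
      - s * v p j + (s * v p j + 0#)
        ≈⟨ solve 2 (λ s q → (:- s) :* q :+ (s :* q :+ :0) := :0) refl s (v p j) ⟩
      0# ∎

  -- Tightness excludes nilpotents: powers of an invertible element are invertible and cannot
  -- vanish.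
  nilpotent : ∀ z k → z ^ k ≈ 0# → z ≈ 0#
  nilpotent z k zᵏ≈0 = tight z (λ z-inv → invertible-≉0 1≉0 (invertible-^ z-inv k) zᵏ≈0)

  -- The exponent k is an accumulator: each constant coefficient found to be zero is traded for one
  -- more factor z in front. The invertible coefficient guarantees that this stops.
  zero-or-invertible : ∀ {n} (a : Vector Carrier n) → (∀ i → a i ∈ K) → (Σ[ i ∈ Fin n ] Invertible (a i)) →
    ∀ z k → z ^ k * sum (λ i → a i * z ^ toℕ i) ≈ 0# → z ≈ 0# ⊎ Invertible z
  zero-or-invertible {suc n} a a∈K (i , aᵢ-inv) z k zᵏf≈0 = case (K-discrete (a∈K zero)) i aᵢ-inv
    where
    t : Carrier
    t = sum (λ i → a (suc i) * z ^ toℕ i)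

    f : Carrier
    f = sum (λ i → a i * z ^ toℕ i)

    f≈ : f ≈ a zero + z * t
    f≈ = +-cong (*-identityʳ _) (trans
      (sum-cong (λ i → solve 3 (λ a z y → a :* (z :* y) := z :* (a :* y)) refl (a (suc i)) z (z ^ toℕ i)))
      (sym (*-distribˡ-sum z (λ i → a (suc i) * z ^ toℕ i))))

    case : (a zero ≈ 0#) ⊎ (Σ[ y ∈ Carrier ] (y ∈ K) × (a zero * y ≈ 1#)) →
           ∀ i → Invertible (a i) → z ≈ 0# ⊎ Invertible z
    case (inj₁ a₀≈0) zero    a₀-inv = ⊥-elim (invertible-≉0 1≉0 a₀-inv a₀≈0)
    case (inj₁ a₀≈0) (suc i) aᵢ-inv = zero-or-invertible (tail a) (a∈K ∘ suc) (i , aᵢ-inv) z (suc k) (begin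
      z * z ^ k * t           ≈⟨ solve 3 (λ z y t → z :* y :* t := y :* (:0 :+ z :* t)) refl z (z ^ k) t ⟩
      z ^ k * (0# + z * t)    ≈⟨ *-congˡ (trans (+-congʳ (sym a₀≈0)) (sym f≈)) ⟩
      z ^ k * f               ≈⟨ zᵏf≈0 ⟩
      0#                      ∎)
    case (inj₂ (u , _ , a₀u≈1)) _ _
      -- The invertible constant term equals f + z (- t). An invertible f cancels from the relation
      -- and leaves a power of z equal to zero; otherwise z divides a unit.
      with local f (z * - t) (invertible-resp
             (trans (solve 3 (λ a z t → a := (a :+ z :* t) :+ z :* (:- t)) refl (a zero) z t) (+-congʳ (sym f≈)))
             (u , a₀u≈1))
    ... | inj₁ f-inv  = inj₁ (nilpotent z k (invertible-cancelˡ f-inv (trans (*-comm f _) zᵏf≈0)))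
    ... | inj₂ zt-inv = inj₂ (invertible-factorˡ z (- t) zt-inv)

  Span : ∀ {n} → Vector Carrier n → Carrier → Set _
  Span {n} m w = Σ[ a ∈ Vector Carrier n ] (∀ i → a i ∈ K) × (w ≈ sum (λ i → a i * m i))

  module _ {n} {m : Vector Carrier n} where

    span-resp : ∀ {v w} → v ≈ w → Span m v → Span m w
    span-resp v≈w (a , a∈K , v≈) = a , a∈K , trans (sym v≈w) v≈

    span-generator : ∀ i → Span m (m i)
    span-generator i = 𝟙 i , 𝟙-closed K-subring i , sym (sum-𝟙ˡ m i)

    span-combine : ∀ b {v w} → b ∈ K → Span m v → Span m w → Span m (b * v + w)
    span-combine b b∈K (a , a∈K , v≈) (a′ , a′∈K , w≈) =
      (λ i → b * a i + a′ i) , (λ i → +-closed (*-closed b∈K (a∈K i)) (a′∈K i)) ,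
      trans (+-cong (*-congˡ v≈) w≈) (trans
        (sym (sum-linear b (λ i → a i * m i) (λ i → a′ i * m i)))
        (sum-cong (λ i → solve 4 (λ b a m a′ → b :* (a :* m) :+ a′ :* m := (b :* a :+ a′) :* m) refl b (a i) (m i) (a′ i))))

    span-sum : ∀ {l} (b v : Vector Carrier l) → (∀ i → b i ∈ K) → (∀ i → Span m (v i)) → Span m (sum (λ i → b i * v i))
    span-sum {zero} b v b∈K v∈ =
      (λ _ → 0#) , (λ _ → 0-closed) , sym (sum-zero {n} {λ i → 0# * m i} (λ i → zeroˡ (m i)))
    span-sum {suc l} b v b∈K v∈ =
      span-combine (b zero) (b∈K zero) (v∈ zero) (span-sum (tail b) (tail v) (b∈K ∘ suc) (v∈ ∘ suc))

  span-* : ∀ {n n′} {m : Vector Carrier n} {m′ : Vector Carrier n′} y →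
           (∀ i → Span m′ (y * m i)) → ∀ {w} → Span m w → Span m′ (y * w)
  span-* {m = m} y ym∈ (a , a∈K , w≈) = span-resp
    (sym (trans (*-congˡ w≈) (trans (*-distribˡ-sum y (λ i → a i * m i))
      (sum-cong (λ i → solve 3 (λ y a m → y :* (a :* m) := a :* (y :* m)) refl y (a i) (m i))))))
    (span-sum a (λ i → y * m i) a∈K ym∈)

  -- Unlike a definition by annihilating polynomials, this one passes to differences at once,
  -- by multiplying the two families of generators.
  record Integral (z : Carrier) : Set (c ⊔ ℓ ⊔ k) where
    field
      {size}     : ℕ
      generators : Vector Carrier size
      one        : Span generators 1#
      stable     : ∀ i → Span generators (z * generators i)

    powers : ∀ j → Span generators (z ^ j)
    powers zero    = one
    powers (suc j) = span-* z stable (powers j)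

  -- There is one more power of z than there are generators. The relation is sought among coordinate
  -- vectors over K, which is possible although the generators themselves may be dependent.
  integral-zero-or-invertible : ∀ {z} → Integral z → z ≈ 0# ⊎ Invertible z
  integral-zero-or-invertible {z} z-int
    with a , a∈K , a-inv , av≈0 ← dependent (λ (i : Fin (suc (Integral.size z-int))) → proj₁ (Integral.powers z-int (toℕ i)))
                                            (λ i → proj₁ (proj₂ (Integral.powers z-int (toℕ i)))) =
    zero-or-invertible a a∈K a-inv z 0 (trans (*-identityˡ _) (begin
      sum (λ i → a i * z ^ toℕ i)
        ≈⟨ sum-cong (λ i → *-congˡ {a i} (proj₂ (proj₂ (powers (toℕ i))))) ⟩
      sum (λ i → a i * sum (λ j → v i j * generators j))
        ≈⟨ sum-*-assoc a v generators ⟩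
      sum (λ j → sum (λ i → a i * v i j) * generators j)
        ≈⟨ sum-zero {size} {λ j → sum (λ i → a i * v i j) * generators j}
             (λ j → trans (*-congʳ {generators j} (av≈0 j)) (zeroˡ _)) ⟩
      0# ∎))
    where
    open Integral z-int
    v : Fin (suc size) → Vector Carrier size
    v i = proj₁ (powers (toℕ i))

  -- The generators are the powers of z below the degree; a positive degree puts `1#` among them.
  -- Only the product of z with the last one needs the equation.
  root-integral : ∀ {n p z} → Monic (suc n) p → All K p → eval z p ≈ 0# → Integral z
  root-integral {n} {p} {z} p-monic p∈K pz≈0
    with a , a∈K , p≈ ← monic-eval K-subring p-monic p∈K = record
      { generators = m
      ; one        = span-generator {m = m} zero
      ; stable     = stable
      }
    where
    m : Vector Carrier (suc n)
    m i = z ^ toℕ i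

    stable : ∀ i → Span m (z ^ suc (toℕ i))
    stable i with suc (toℕ i) ℕ.<? suc n
    ... | yes i<n = span-resp {m = m} (reflexive (≡.cong (z ^_) (Fin.toℕ-fromℕ< i<n))) (span-generator {m = m} (fromℕ< i<n))
    ... | no  i≮n =
      (λ j → - 1# * a j) , (λ j → *-closed (neg-closed 1-closed) (a∈K j)) , (begin
        z ^ suc (toℕ i)
          ≡⟨ ≡.cong (z ^_) (ℕ.≤-antisym (Fin.toℕ<n i) (ℕ.≮⇒≥ i≮n)) ⟩
        z ^ suc n
          ≈⟨ solve 2 (λ y s → y := (:- :1) :* s :+ (y :+ s)) refl _ s ⟩
        - 1# * s + (z ^ suc n + s)
          ≈⟨ +-cong (*-distribˡ-sum (- 1#) (λ j → a j * z ^ toℕ j)) (trans (sym (p≈ z)) pz≈0) ⟩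
        sum (λ j → - 1# * (a j * z ^ toℕ j)) + 0#
          ≈⟨ +-identityʳ _ ⟩
        sum (λ j → - 1# * (a j * z ^ toℕ j))
          ≈⟨ sum-cong (λ j → *-assoc (- 1#) (a j) (z ^ toℕ j)) ⟨
        sum (λ j → - 1# * a j * z ^ toℕ j) ∎)
      where s = sum (λ j → a j * z ^ toℕ j)

  integral-difference : ∀ {x y} → Integral x → Integral y → Integral (x - y)
  integral-difference {x} {y} x-int y-int = record
    { generators = m
    -- `1#` is expanded in the generators of y, and each of these, written as its product with `1#`,
    -- by expanding that `1#` in the generators of x.
    ; one        = span-resp (*-identityˡ 1#) (span-* 1# (λ j →
        span-resp (*-comm (Y.generators j) 1#) (span-* (Y.generators j) (λ i → span-m′ i j) X.one)) Y.one)
    ; stable     = λ l → let i , j = remQuot Y.size l in span-resp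
        -- For p from the first family and q from the second, (x - y) p q splits into q (x p) and p
        -- (y q), each covered by one stability hypothesis.
        (solve 4 (λ x y p q → (:- :1) :* (p :* (y :* q)) :+ q :* (x :* p) := (x :- y) :* (p :* q)) refl
          x y (X.generators i) (Y.generators j))
        (span-combine (- 1#) (neg-closed 1-closed)
          (span-* (X.generators i) (span-m i) (Y.stable j))
          (span-* (Y.generators j) (λ i → span-m′ i j) (X.stable i)))
    }
    where
    module X = Integral x-int
    module Y = Integral y-int

    m : Vector Carrier (X.size ℕ.* Y.size)
    m l = X.generators (proj₁ (remQuot Y.size l)) * Y.generators (proj₂ (remQuot {X.size} Y.size l))

    span-m : ∀ i j → Span m (X.generators i * Y.generators j)
    span-m i j = span-resp
      (reflexive (≡.cong (λ (i , j) → X.generators i * Y.generators j) (Fin.remQuot-combine i j)))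
      (span-generator (combine i j))

    span-m′ : ∀ i j → Span m (Y.generators j * X.generators i)
    span-m′ i j = span-resp (*-comm _ _) (span-m i j)

  -- The column sums put the all-ones row vector into the left kernel of 1 - M. Its entries are
  -- units, so `left-kernel` annihilates the determinant itself.
  charPoly-root-1 : ∀ {n} (M : Matrix (suc n)) → (∀ j → sum (λ i → M i j) ≈ 1#) →
                    eval 1# (charPoly M) ≈ 0#
  charPoly-root-1 {n} M sums≈1 = begin
    eval 1# (charPoly M)    ≈⟨ eval-charPoly 1# M ⟩
    det N                   ≈⟨ *-identityʳ _ ⟨
    det N * 1#              ≈⟨ left-kernel N (λ _ → 1#) kernel zero ⟩
    0#                      ∎
    where
    N : Matrix (suc n)
    N i j = 1# * 𝟙 i j - M i j

    kernel : ∀ j → sum (λ i → 1# * N i j) ≈ 0#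
    kernel j = begin
      sum (λ i → 1# * N i j)
        ≈⟨ sum-cong (λ i → solve 2 (λ e m → :1 :* (:1 :* e :- m) := (:- :1) :* m :+ :1 :* e) refl (𝟙 i j) (M i j)) ⟩
      sum (λ i → - 1# * M i j + 1# * 𝟙 i j)
        ≈⟨ sum-linear (- 1#) (λ i → M i j) (λ i → 1# * 𝟙 i j) ⟩
      - 1# * sum (λ i → M i j) + sum (λ i → 1# * 𝟙 i j)
        ≈⟨ +-cong (*-congˡ (sums≈1 j)) (sum-𝟙ʳ (λ _ → 1#) j) ⟩
      - 1# * 1# + 1#
        ≈⟨ trans (+-congʳ (*-identityʳ (- 1#))) (-‿inverseˡ 1#) ⟩
      0# ∎

  module Roots {n} (p : Poly) (p∈K : All K p)
    (μs : Vector Carrier (suc n)) (factored : p ≈ₚ linearFactors μs) where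

    Root : Pred Carrier ℓ
    Root z = eval z p ≈ 0#

    root-difference : ∀ {x y} → Root x → Root y → x - y ≈ 0# ⊎ Invertible (x - y)
    root-difference x-root y-root = integral-zero-or-invertible
      (integral-difference (root⇒integral x-root) (root⇒integral y-root))
      where
      root⇒integral : ∀ {z} → Root z → Integral z
      root⇒integral = root-integral
        (monic-resp p (linearFactors μs) factored (linearFactors-monic μs)) p∈K

    root-≟ : ∀ {x y} → Root x → Root y → Dec (x ≈ y)
    root-≟ {x} {y} x-root y-root = [ (λ x-y≈0 → yes (x∙y⁻¹≈ε⇒x≈y x y x-y≈0)) ,
      (λ x-y-inv → no λ x≈y → invertible-≉0 1≉0 x-y-inv (trans (+-congʳ x≈y) (-‿inverseʳ y))) ]′
      (root-difference x-root y-root)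

    eval-factors : ∀ z → eval z p ≈ product (λ i → z - μs i)
    eval-factors z = trans (eval-cong z p (linearFactors μs) factored) (eval-linearFactors z μs)

    factor-root : ∀ i → Root (μs i)
    factor-root i =
      trans (eval-factors (μs i)) (product-has-zero (λ j → μs i - μs j) i (-‿inverseʳ (μs i)))
      where
      product-has-zero : ∀ {n} (f : Vector Carrier n) i → f i ≈ 0# → product f ≈ 0#
      product-has-zero f zero    fᵢ≈0 = trans (*-congʳ fᵢ≈0) (zeroˡ _)
      product-has-zero f (suc i) fᵢ≈0 = trans (*-congˡ (product-has-zero (tail f) i fᵢ≈0)) (zeroʳ _)

    root-factor : ∀ {z} → Root z → Σ[ i ∈ Fin (suc n) ] z ≈ μs i
    root-factor {z} z-root =
      let i , z-μ≈0 = product-zero 1≉0 (λ i → z - μs i) (λ i → root-difference z-root (factor-root i))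
                        (trans (sym (eval-factors z)) z-root)
      in i , x∙y⁻¹≈ε⇒x≈y z (μs i) z-μ≈0

-- Combined matrices over an abstract commutative ring

-- Composite terms are replaced by variables subject to equations: over ℂ, where these lemmas
-- are used, checking a conversion between two compound numbers is infeasible.
module CombinedMatrices {c ℓ} (R : RawRing c ℓ)
  (isCommutativeRing : IsCommutativeRing (RawRing._≈_ R) (RawRing._+_ R) (RawRing._*_ R) (RawRing.-_ R)
                                         (RawRing.0# R) (RawRing.1# R))
  where
  open RawRing R using (Carrier; _≈_; _≉_; _+_; _*_; -_; 0#; 1#)
  private
    CR : CommutativeRing c ℓ
    CR = commutativeRing R isCommutativeRing
  open CommutativeRing CR hiding (zero; Carrier; _≈_; _≉_; _+_; _*_; -_; 0#; 1#)
  open Matrices R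
  open Sums CR
  open Determinants CR hiding (_·_⊕_)
  open IntegerSolver CR
  open SumProps semiring using (sum-permute)
  open ≈-Reasoning setoid

  sum-of-zeros : ∀ {n} (f : Vector Carrier n) → (∀ i → f i ≈ 0#) → sum f ≈ 0#
  sum-of-zeros f f≈0 = sum-zero f≈0

  ∘ᴹ-entry : ∀ {n} (A T N : Matrix n) → (∀ i j → T i j ≈ N j i) → ∀ i j → (A ∘ᴹ T) i j ≈ A i j * N j i
  ∘ᴹ-entry A T N T≈ i j = *-congˡ (T≈ i j)

  det-inverse : ∀ {n} (A N : Matrix n) {a d} → A *ᴹ N ≈ᴹ 𝟙 → a ≈ det A → d ≈ det N → a * d ≈ 1#
  det-inverse {n} A N AN≈𝟙 a≈ d≈ = trans (*-cong a≈ d≈) (trans (sym (det-* A N)) (trans (det-cong AN≈𝟙) (det-𝟙 n)))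

  module _ {n} (A N : Matrix n) (NA≈𝟙 : N *ᴹ A ≈ᴹ 𝟙) (AN≈𝟙 : A *ᴹ N ≈ᴹ 𝟙) where

    -- Inserting det N det A = 1 lets `det N` stand in for 1/det A in the adjugate formula.
    inverse-cofactor : ∀ i j → N j i ≈ (sign (toℕ i ℕ.+ toℕ j) * det N) * minor A i j
    inverse-cofactor = go A N NA≈𝟙 (trans (*-comm _ _) (det-inverse A N AN≈𝟙 refl refl))
      where
      -- The size is generalised here so that it can be matched as a successor, the only case in
      -- which an index exists.
      go : ∀ {n} (A N : Matrix n) → N *ᴹ A ≈ᴹ 𝟙 → det N * det A ≈ 1# →
           ∀ i j → N j i ≈ (sign (toℕ i ℕ.+ toℕ j) * det N) * minor A i j
      go {suc n} A N NA≈𝟙 dd≈1 i j = begin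
        N j i                                           ≈⟨ *-identityˡ _ ⟨
        1# * N j i                                      ≈⟨ *-congʳ dd≈1 ⟨
        (det N * det A) * N j i                         ≈⟨ *-assoc _ _ _ ⟩
        det N * (det A * N j i)                         ≈⟨ *-congˡ (adj≈det*inverse A N NA≈𝟙 j i) ⟨
        det N * (sign (toℕ i ℕ.+ toℕ j) * minor A i j)  ≈⟨ solve 3 (λ d s m → d :* (s :* m) := (s :* d) :* m) refl _ _ _ ⟩
        (sign (toℕ i ℕ.+ toℕ j) * det N) * minor A i j  ∎

    entry-formula : ∀ i j {s d sd m am x} →
      s ≈ sign (toℕ i ℕ.+ toℕ j) → d ≈ det N → sd ≈ s * d → m ≈ minor A i j → am ≈ A i j * m →
      x ≈ A i j * N j i → x ≈ sd * am
    entry-formula i j {s} {d} {sd} {m} {am} {x} s≈ d≈ sd≈ m≈ am≈ x≈ = begin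
      x                                                        ≈⟨ x≈ ⟩
      A i j * N j i                                            ≈⟨ *-congˡ (inverse-cofactor i j) ⟩
      A i j * ((sign (toℕ i ℕ.+ toℕ j) * det N) * minor A i j) ≈⟨ *-congˡ (*-cong (*-cong s≈ d≈) m≈) ⟨
      A i j * ((s * d) * m)                                    ≈⟨ solve 4 (λ a s d m → a :* ((s :* d) :* m) := (s :* d) :* (a :* m)) refl (A i j) s d m ⟩
      (s * d) * (A i j * m)                                    ≈⟨ *-cong sd≈ am≈ ⟨
      sd * am                                                  ∎

    trace-formula : ∀ (M : Matrix n) (m f : Vector Carrier n) {d S} →
      (∀ i → M i i ≈ A i i * N i i) → d ≈ det N → (∀ i → m i ≈ minor A i i) → (∀ i → f i ≈ A i i * m i) →
      S ≈ sum f → tr M ≈ d * S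
    trace-formula M m f {d} {S} M≈ d≈ m≈ f≈ S≈ = begin
      sum (λ i → M i i)   ≈⟨ sum-cong diagonal ⟩
      sum (λ i → d * f i) ≈⟨ *-distribˡ-sum d f ⟨
      d * sum f           ≈⟨ *-congˡ S≈ ⟨
      d * S               ∎
      where
      diagonal : ∀ i → M i i ≈ d * f i
      diagonal i = trans
        (entry-formula i i {s} {d} {s * d} {m i} {f i} {M i i} refl d≈ refl (m≈ i) (f≈ i) (M≈ i))
        (*-congʳ (trans (*-congʳ (trans (sign-+ (toℕ i) (toℕ i)) (sign² (toℕ i)))) (*-identityˡ d)))
        where s = sign (toℕ i ℕ.+ toℕ i)

  row-sum : ∀ {n} (A N M : Matrix n) → A *ᴹ N ≈ᴹ 𝟙 → (∀ i j → M i j ≈ A i j * N j i) →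
            ∀ i → sum (λ j → M i j) ≈ 1#
  row-sum A N M AN≈𝟙 M≈ i = trans (sum-cong (M≈ i)) (trans (AN≈𝟙 i i) (reflexive (𝟙-diag i)))

  column-sum : ∀ {n} (A N M : Matrix n) → N *ᴹ A ≈ᴹ 𝟙 → (∀ i j → M i j ≈ A i j * N j i) →
               ∀ j → sum (λ i → M i j) ≈ 1#
  column-sum A N M NA≈𝟙 M≈ j = trans (sum-cong (λ i → trans (M≈ i j) (*-comm (A i j) (N j i))))
    (trans (NA≈𝟙 j j) (reflexive (𝟙-diag j)))

  all-ones : ∀ {n} (e : Fin n → Vector Carrier n) → (∀ k i → e k i ≈ 𝟙 k i) → ∀ i → vectorSum e i ≈ 1#
  all-ones e e≈ i = trans (sum-cong (λ k → trans (e≈ k i) (sym (*-identityˡ (𝟙 k i))))) (sum-𝟙ʳ (λ _ → 1#) i)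

  ones-eigen : ∀ {n} (A N M : Matrix n) → A *ᴹ N ≈ᴹ 𝟙 → (∀ i j → M i j ≈ A i j * N j i) →
               ∀ (v : Vector Carrier n) {o} → o ≈ 1# → (∀ i → v i ≈ 1#) → ∀ i → (M *ⱽ v) i ≈ o * v i
  ones-eigen A N M AN≈𝟙 M≈ v {o} o≈1 v≈1 i = begin
    sum (λ j → M i j * v j) ≈⟨ sum-cong (λ j → trans (*-congˡ {M i j} (v≈1 j)) (*-identityʳ (M i j))) ⟩
    sum (λ j → M i j)       ≈⟨ row-sum A N M AN≈𝟙 M≈ i ⟩
    1#                      ≈⟨ *-identityˡ 1# ⟨
    1# * 1#                 ≈⟨ *-cong o≈1 (v≈1 i) ⟨
    o * v i                 ∎

  ones-isEigenvector : ∀ {n} (A N : Matrix n) {M : Matrix n} {o} {v : Vector Carrier n} → 1# ≉ 0# → Fin n →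
    A *ᴹ N ≈ᴹ 𝟙 → (∀ i j → M i j ≈ A i j * N j i) → o ≈ 1# → (∀ i → v i ≈ 1#) → IsEigenvector M o v
  ones-isEigenvector A N {M} {o} {v} 1≉0 i AN≈𝟙 M≈ o≈1 v≈1 = record
    { nonzero = λ v≈0 → 1≉0 (trans (sym (v≈1 i)) (v≈0 i))
    ; eigen   = ones-eigen A N M AN≈𝟙 M≈ v o≈1 v≈1
    }

  private
    𝟙-opposite : ∀ {n} (i k : Fin n) → 𝟙 i (opposite k) ≡ 𝟙 (opposite i) k
    𝟙-opposite i k = go (opposite i Fin.≟ k)
      where
      go : Dec (opposite i ≡ k) → 𝟙 i (opposite k) ≡ 𝟙 (opposite i) k
      go (yes ≡.refl) = ≡.trans (≡.cong (𝟙 i) (Fin.opposite-involutive i))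
        (≡.trans (𝟙-diag i) (≡.sym (𝟙-diag (opposite i))))
      go (no i≢k) = ≡.trans
        (𝟙-off λ i≡k → i≢k (≡.trans (≡.cong opposite i≡k) (Fin.opposite-involutive k)))
        (≡.sym (𝟙-off i≢k))

  ℛ-entry : ∀ {n} (M : Matrix n) i j → ℛ M i j ≈ M (opposite i) (opposite j)
  ℛ-entry M i j = begin
    sum (λ k → (J *ᴹ M) i k * 𝟙 k (opposite j))
      ≈⟨ sum-𝟙ʳ ((J *ᴹ M) i) (opposite j) ⟩
    sum (λ k → 𝟙 i (opposite k) * M k (opposite j))
      ≈⟨ sum-cong (λ k → *-congʳ {M k (opposite j)} (reflexive (𝟙-opposite i k))) ⟩
    sum (λ k → 𝟙 (opposite i) k * M k (opposite j))
      ≈⟨ sum-𝟙ˡ (λ k → M k (opposite j)) (opposite i) ⟩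
    M (opposite i) (opposite j) ∎

  reversed-inverse : ∀ {n} (M N P Q : Matrix n) → M *ᴹ N ≈ᴹ 𝟙 →
    (∀ i j → P i j ≈ M (opposite i) (opposite j)) → (∀ i j → Q i j ≈ N (opposite i) (opposite j)) →
    P *ᴹ Q ≈ᴹ 𝟙
  reversed-inverse M N P Q MN≈𝟙 P≈ Q≈ i j = begin
    sum (λ k → P i k * Q k j)
      ≈⟨ sum-cong (λ k → *-cong (P≈ i k) (Q≈ k j)) ⟩
    sum (λ k → M (opposite i) (opposite k) * N (opposite k) (opposite j))
      ≈⟨ sum-permute (λ k → M (opposite i) k * N k (opposite j)) Perm.reverse ⟨
    (M *ᴹ N) (opposite i) (opposite j)
      ≈⟨ MN≈𝟙 (opposite i) (opposite j) ⟩
    𝟙 (opposite i) (opposite j)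
      ≡⟨ 𝟙-opposite i (opposite j) ⟨
    𝟙 i (opposite (opposite j))
      ≡⟨ ≡.cong (𝟙 i) (Fin.opposite-involutive j) ⟩
    𝟙 i j ∎

  -- The inverse P that comes with B is arbitrary; uniqueness of inverses identifies it with the
  -- reversal of N.
  reversed-combined : ∀ {n} (A N B P : Matrix n) → N *ᴹ A ≈ᴹ 𝟙 → (∀ i j → B i j ≈ A (opposite i) (opposite j)) →
    B *ᴹ P ≈ᴹ 𝟙 → ∀ i j {x y} → x ≈ B i j * P j i → y ≈ A (opposite i) (opposite j) * N (opposite j) (opposite i) →
    x ≈ y
  reversed-combined A N B P NA≈𝟙 B≈ BP≈𝟙 i j x≈ y≈ = trans x≈ (trans (*-cong (B≈ i j)
    (sym (inverse-unique B N′ P (reversed-inverse N A N′ B NA≈𝟙 (λ _ _ → refl) B≈) BP≈𝟙 j i))) (sym y≈))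
    where
    N′ : Matrix _
    N′ i j = N (opposite i) (opposite j)

  -- What the Galois argument uses of the characteristic polynomial, with the polynomial hidden. In
  -- `preserved` the map h takes membership proofs, because an automorphism of `K [ μs ]` acts on
  -- elements paired with such proofs.
  record RootTheory {n k} (K : Pred Carrier k) (μs : Vector Carrier n) : Set (c ⊔ lsuc (ℓ ⊔ k)) where
    field
      Root        : Pred Carrier ℓ
      μ-root      : ∀ i → Root (μs i)
      1-root      : Root 1#
      root-≟      : ∀ {x y} → Root x → Root y → Dec (x ≈ y)
      root-find   : ∀ {z} → Root z → Σ[ i ∈ Fin n ] z ≈ μs i
      preserved   : ∀ {L : Pred Carrier k} (h : ∀ {x} → x ∈ L → Carrier)
        (base : ∀ {a} → a ∈ K → a ∈ L)
        (add : ∀ {x y} → x ∈ L → y ∈ L → x + y ∈ L) (mul : ∀ {x y} → x ∈ L → y ∈ L → x * y ∈ L) →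
        (∀ {x y} (x∈L : x ∈ L) (y∈L : y ∈ L) → x ≈ y → h x∈L ≈ h y∈L) →
        (∀ {a} (a∈K : a ∈ K) → h (base a∈K) ≈ a) →
        (∀ {x y} (x∈L : x ∈ L) (y∈L : y ∈ L) → h (add x∈L y∈L) ≈ h x∈L + h y∈L) →
        (∀ {x y} (x∈L : x ∈ L) (y∈L : y ∈ L) → h (mul x∈L y∈L) ≈ h x∈L * h y∈L) →
        ∀ {x} (x∈L : x ∈ L) → Root x → Root (h x∈L)

  module _ {k} (K : Pred Carrier k)
    (1≉0 : Units.NonTrivial CR) (local : Units.Local CR) (tight : Units.Tight CR)
    (K-subring : PolynomialEvaluation.IsSubring CR K) (K-discrete : Units.Discrete CR K)
    where
    open List using ([]; _∷_)
    open Unary using ([]; _∷_)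
    open Polynomials R using (Poly; charPoly; IsSpectrum)
    open PolynomialEvaluation CR
    open AlgebraicElements CR 1≉0 local tight K K-subring K-discrete
    open IsSubring K-subring

    private
      polynomial-roots : ∀ {n} (p : Poly) (p∈K : All K p) (μs : Vector Carrier (suc n)) →
        Polynomials._≈ₚ_ R p (linearFactors μs) → eval 1# p ≈ 0# → RootTheory K μs
      polynomial-roots p p∈K μs factored 1-root = record
        { Root      = Root
        ; μ-root    = factor-root
        ; 1-root    = 1-root
        ; root-≟    = root-≟
        ; root-find = root-factor
        ; preserved = preserved
        }
        where
        open Roots p p∈K μs factored

        preserved : ∀ {L : Pred Carrier k} (h : ∀ {x} → x ∈ L → Carrier)
          (base : ∀ {a} → a ∈ K → a ∈ L)
          (add : ∀ {x y} → x ∈ L → y ∈ L → x + y ∈ L) (mul : ∀ {x y} → x ∈ L → y ∈ L → x * y ∈ L) →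
          (∀ {x y} (x∈L : x ∈ L) (y∈L : y ∈ L) → x ≈ y → h x∈L ≈ h y∈L) →
          (∀ {a} (a∈K : a ∈ K) → h (base a∈K) ≈ a) →
          (∀ {x y} (x∈L : x ∈ L) (y∈L : y ∈ L) → h (add x∈L y∈L) ≈ h x∈L + h y∈L) →
          (∀ {x y} (x∈L : x ∈ L) (y∈L : y ∈ L) → h (mul x∈L y∈L) ≈ h x∈L * h y∈L) →
          ∀ {x} (x∈L : x ∈ L) → Root x → Root (h x∈L)
        preserved {L} h base add mul h-cong h-K h-+ h-* {x} x∈L px≈0 =
          trans (sym (h-eval p∈K)) (trans (h-cong (eval∈L p∈K) (base 0-closed) px≈0) (h-K 0-closed))
          where
          -- Horner's scheme is replayed as a membership proof built from `base`, `add` and `mul`,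
          -- the constructors on which the values of h are known.
          eval∈L : ∀ {q} → All K q → eval x q ∈ L
          eval∈L []          = base 0-closed
          eval∈L (a∈K ∷ q∈K) = add (base a∈K) (mul x∈L (eval∈L q∈K))

          h-eval : ∀ {q} (q∈K : All K q) → h (eval∈L q∈K) ≈ eval (h x∈L) q
          h-eval []          = h-K 0-closed
          h-eval (a∈K ∷ q∈K) = trans (h-+ (base a∈K) (mul x∈L (eval∈L q∈K)))
            (+-cong (h-K a∈K) (trans (h-* x∈L (eval∈L q∈K)) (*-congˡ (h-eval q∈K))))

    combined-roots : ∀ {n} (A N M : Matrix (suc n)) → N *ᴹ A ≈ᴹ 𝟙 → (∀ i j → M i j ≈ A i j * N j i) →
      (∀ i j → M i j ∈ K) → (μs : Vector Carrier (suc n)) → IsSpectrum M μs → RootTheory K μs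
    combined-roots A N M NA≈𝟙 M≈ M∈K μs spectrum =
      polynomial-roots (charPoly M) (charPoly-closed K-subring M∈K) μs spectrum
        (charPoly-root-1 M (column-sum A N M NA≈𝟙 M≈))

    det∈K : ∀ {n} {M : Matrix n} → (∀ i j → M i j ∈ K) → det M ∈ K
    det∈K = det-closed K-subring

open import Defs

-- Null sequences, apartness from zero and reciprocals of reals

module Reals where
  open +-*-Solver using (_:=_; _:+_; _:*_; :-_; _:-_) renaming (solve to solveℚ)

  Null : (ℕ → ℚ) → Set
  Null f = ∀ ε → 0ℚ ℚ.< ε → Σ[ N ∈ ℕ ] (∀ n → n ≥ N → ℚ.∣ f n ∣ ℚ.< ε)

  halve : ∀ {ε} → 0ℚ ℚ.< ε → 0ℚ ℚ.< ½ ℚ.* ε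
  halve {ε} 0<ε = subst (ℚ._< ½ ℚ.* ε) (ℚ.*-zeroʳ ½) (ℚ.*-monoʳ-<-pos ½ 0<ε)

  private
    half+half : ∀ ε → ½ ℚ.* ε ℚ.+ ½ ℚ.* ε ≡ ε
    half+half ε = ≡.trans (≡.sym (ℚ.*-distribʳ-+ ε ½ ½)) (ℚ.*-identityˡ ε)

    ∣+∣<half+half : ∀ p q {ε} → ℚ.∣ p ∣ ℚ.< ½ ℚ.* ε → ℚ.∣ q ∣ ℚ.< ½ ℚ.* ε → ℚ.∣ p ℚ.+ q ∣ ℚ.< ε
    ∣+∣<half+half p q {ε} p< q< = ℚ.≤-<-trans (ℚ.∣p+q∣≤∣p∣+∣q∣ p q)
      (subst (ℚ.∣ p ∣ ℚ.+ ℚ.∣ q ∣ ℚ.<_) (half+half ε) (ℚ.+-mono-< p< q<))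

    half< : ∀ {ε} → 0ℚ ℚ.< ε → ½ ℚ.* ε ℚ.< ε
    half< {ε} 0<ε = subst₂ ℚ._<_ (ℚ.+-identityʳ _) (half+half ε) (ℚ.+-monoʳ-< (½ ℚ.* ε) (halve 0<ε))

    *-pos : ∀ {p q} → 0ℚ ℚ.< p → 0ℚ ℚ.< q → 0ℚ ℚ.< p ℚ.* q
    *-pos {p} {q} 0<p 0<q = subst (ℚ._< p ℚ.* q) (ℚ.*-zeroʳ p) (ℚ.*-monoʳ-<-pos p {{ℚ.positive 0<p}} 0<q)

    *-mono-≤-abs : ∀ p q {δ η} → 0ℚ ℚ.< δ → δ ℚ.≤ ℚ.∣ p ∣ → η ℚ.≤ ℚ.∣ q ∣ → δ ℚ.* η ℚ.≤ ℚ.∣ p ∣ ℚ.* ℚ.∣ q ∣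
    *-mono-≤-abs p q {δ} {η} 0<δ δ≤p η≤q = ℚ.≤-trans
      (ℚ.*-monoˡ-≤-nonNeg δ {{ℚ.nonNegative (ℚ.<⇒≤ 0<δ)}} η≤q)
      (ℚ.*-monoʳ-≤-nonNeg ℚ.∣ q ∣ {{ℚ.∣-∣-nonNeg q}} δ≤p)

    ∣p∣≤∣p-q∣+∣q∣ : ∀ p q → ℚ.∣ p ∣ ℚ.≤ ℚ.∣ p ℚ.- q ∣ ℚ.+ ℚ.∣ q ∣
    ∣p∣≤∣p-q∣+∣q∣ p q = subst (λ r → ℚ.∣ r ∣ ℚ.≤ ℚ.∣ p ℚ.- q ∣ ℚ.+ ℚ.∣ q ∣)
      (solveℚ 2 (λ p q → (p :- q) :+ q := p) ≡.refl p q) (ℚ.∣p+q∣≤∣p∣+∣q∣ (p ℚ.- q) q)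

  null-resp : ∀ {f g} → (∀ n → f n ≡ g n) → Null f → Null g
  null-resp f≡g f-null ε 0<ε =
    let N , f< = f-null ε 0<ε in N , λ n n≥N → subst (λ p → ℚ.∣ p ∣ ℚ.< ε) (f≡g n) (f< n n≥N)

  null-+ : ∀ {f g} → Null f → Null g → Null (λ n → f n ℚ.+ g n)
  null-+ {f} {g} f-null g-null ε 0<ε =
    let M , f< = f-null (½ ℚ.* ε) (halve 0<ε)
        N , g< = g-null (½ ℚ.* ε) (halve 0<ε)
    in M ℕ.⊔ N , λ n n≥ → ∣+∣<half+half (f n) (g n) (f< n (ℕ.m⊔n≤o⇒m≤o M N n≥)) (g< n (ℕ.m⊔n≤o⇒n≤o M N n≥))

  null-neg : ∀ {f} → Null f → Null (λ n → ℚ.- f n)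
  null-neg {f} f-null ε 0<ε =
    let N , f< = f-null ε 0<ε in N , λ n n≥N → subst (ℚ._< ε) (≡.sym (ℚ.∣-p∣≡∣p∣ (f n))) (f< n n≥N)

  private
    rescale : ∀ {B ε} → 0ℚ ℚ.< B → 0ℚ ℚ.< ε → Σ[ δ ∈ ℚ ] (0ℚ ℚ.< δ) × (B ℚ.* δ ≡ ε)
    rescale {B} {ε} 0<B 0<ε = B⁻¹ ℚ.* ε , *-pos {B⁻¹} {ε} (ℚ.positive⁻¹ B⁻¹ {{ℚ.1/pos⇒pos B}}) 0<ε ,
      ≡.trans (≡.sym (ℚ.*-assoc B B⁻¹ ε)) (≡.trans (cong (ℚ._* ε) (ℚ.*-inverseʳ B)) (ℚ.*-identityˡ ε))
      where
      instance
        B-pos : ℚ.Positive B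
        B-pos = ℚ.positive 0<B
        B≢0 : ℚ.NonZero B
        B≢0 = ℚ.pos⇒nonZero B
      B⁻¹ = ℚ.1/ B

    ∣p*q∣<B*δ : ∀ p q {B δ} → 0ℚ ℚ.< B → ℚ.∣ p ∣ ℚ.≤ B → ℚ.∣ q ∣ ℚ.< δ → ℚ.∣ p ℚ.* q ∣ ℚ.< B ℚ.* δ
    ∣p*q∣<B*δ p q {B} {δ} 0<B p≤B q<δ = subst (ℚ._< B ℚ.* δ) (≡.sym (ℚ.∣p*q∣≡∣p∣*∣q∣ p q))
      (ℚ.≤-<-trans (ℚ.*-monoʳ-≤-nonNeg ℚ.∣ q ∣ {{ℚ.∣-∣-nonNeg q}} p≤B)
        (ℚ.*-monoʳ-<-pos B {{ℚ.positive 0<B}} q<δ))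

  null-* : ∀ x {f} → Null f → Null (λ n → seq x n ℚ.* f n)
  null-* x {f} f-null ε 0<ε = go (eventuallyBounded x)
    where
    go : Σ[ B ∈ ℚ ] (0ℚ ℚ.< B) × (Σ[ M ∈ ℕ ] (∀ n → n ≥ M → ℚ.∣ seq x n ∣ ℚ.≤ B)) →
         Σ[ N ∈ ℕ ] (∀ n → n ≥ N → ℚ.∣ seq x n ℚ.* f n ∣ ℚ.< ε)
    go (B , 0<B , M , x≤B) =
      let δ , 0<δ , Bδ≡ε = rescale {B} {ε} 0<B 0<ε
          N , f<         = f-null δ 0<δ
      in M ℕ.⊔ N , λ n n≥ → subst (ℚ.∣ seq x n ℚ.* f n ∣ ℚ.<_) Bδ≡ε
           (∣p*q∣<B*δ (seq x n) (f n) 0<B (x≤B n (ℕ.m⊔n≤o⇒m≤o M N n≥)) (f< n (ℕ.m⊔n≤o⇒n≤o M N n≥)))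

  pointwise : ∀ {x y} → (∀ n → seq x n ≡ seq y n) → x ≈ʳ y
  pointwise {x} {y} x≡y .close ε 0<ε = 0 , λ n _ →
    subst (ℚ._< ε) (cong ℚ.∣_∣ (≡.sym (≡.trans (cong (ℚ._- seq y n) (x≡y n)) (ℚ.+-inverseʳ (seq y n))))) 0<ε

  +ʳ-cong : ∀ {x x′ y y′} → x ≈ʳ x′ → y ≈ʳ y′ → x +ʳ y ≈ʳ x′ +ʳ y′
  +ʳ-cong {x} {x′} {y} {y′} x≈ y≈ .close = null-resp
    (λ n → solveℚ 4 (λ x x′ y y′ → (x :- x′) :+ (y :- y′) := (x :+ y) :- (x′ :+ y′)) ≡.refl
      (seq x n) (seq x′ n) (seq y n) (seq y′ n))
    (null-+ (x≈ .close) (y≈ .close))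

  -ʳ-cong : ∀ {x y} → x ≈ʳ y → -ʳ x ≈ʳ -ʳ y
  -ʳ-cong {x} {y} x≈ .close = null-resp
    (λ n → solveℚ 2 (λ x y → :- (x :- y) := (:- x) :- (:- y)) ≡.refl (seq x n) (seq y n))
    (null-neg (x≈ .close))

  *ʳ-cong : ∀ {x x′ y y′} → x ≈ʳ x′ → y ≈ʳ y′ → x *ʳ y ≈ʳ x′ *ʳ y′
  *ʳ-cong {x} {x′} {y} {y′} x≈ y≈ .close = null-resp
    (λ n → solveℚ 4 (λ x x′ y y′ → x :* (y :- y′) :+ y′ :* (x :- x′) := (x :* y) :- (x′ :* y′)) ≡.refl
      (seq x n) (seq x′ n) (seq y n) (seq y′ n))
    (null-+ (null-* x (y≈ .close)) (null-* y′ (x≈ .close)))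

  EventuallyBelow : ℚ → ℝ → Set
  EventuallyBelow ε x = Σ[ N ∈ ℕ ] (∀ n → n ≥ N → ℚ.∣ seq x n ∣ ℚ.< ε)

  AwayFrom0 : ℝ → Set
  AwayFrom0 x = Σ[ δ ∈ ℚ ] (0ℚ ℚ.< δ) × (Σ[ N ∈ ℕ ] (∀ n → n ≥ N → δ ℚ.≤ ℚ.∣ seq x n ∣))

  -- One term `seq x N`, beyond which the sequence varies by less than ε/4, decides: its absolute
  -- value is a rational that can be compared with ε/2. Below it the tail stays under ε, otherwise
  -- the tail keeps at least ε/4 from zero.
  below-or-away : ∀ ε → 0ℚ ℚ.< ε → ∀ x → EventuallyBelow ε x ⊎ AwayFrom0 x
  below-or-away ε 0<ε x = go (cauchy x δ (halve 0<η))
    where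
    η = ½ ℚ.* ε
    δ = ½ ℚ.* η
    0<η = halve 0<ε

    go : Σ[ N ∈ ℕ ] (∀ m n → m ≥ N → n ≥ N → ℚ.∣ seq x m ℚ.- seq x n ∣ ℚ.< δ) →
         EventuallyBelow ε x ⊎ AwayFrom0 x
    go (N , x~) with ℚ.∣ seq x N ∣ ℚ.<? η
    ... | yes x<η = inj₁ (N , λ n n≥N → ℚ.≤-<-trans (∣p∣≤∣p-q∣+∣q∣ (seq x n) (seq x N))
      (subst (ℚ.∣ seq x n ℚ.- seq x N ∣ ℚ.+ ℚ.∣ seq x N ∣ ℚ.<_) (half+half ε)
        (ℚ.+-mono-< (ℚ.<-trans (x~ n N n≥N ℕ.≤-refl) (half< 0<η)) x<η)))
    ... | no  x≮η = inj₂ (δ , halve 0<η , N , λ n n≥N → ℚ.≮⇒≥ λ xₙ<δ → x≮η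
      (ℚ.≤-<-trans (∣p∣≤∣p-q∣+∣q∣ (seq x N) (seq x n))
        (subst (ℚ.∣ seq x N ℚ.- seq x n ∣ ℚ.+ ℚ.∣ seq x n ∣ ℚ.<_) (half+half η)
          (ℚ.+-mono-< (x~ N n ℕ.≤-refl n≥N) xₙ<δ))))

  private
    -- The reciprocal, with junk value 0 at 0.
    recip : ℚ → ℚ
    recip p with p ℚ.≟ 0ℚ
    ... | yes _   = 0ℚ
    ... | no  p≢0 = (ℚ.1/ p) {{ℚ.≢-nonZero p≢0}}

    *-recip : ∀ p → p ≢ 0ℚ → p ℚ.* recip p ≡ 1ℚ
    *-recip p p≢0 with p ℚ.≟ 0ℚ
    ... | yes p≡0 = ⊥-elim (p≢0 p≡0)
    ... | no  p≢0 = ℚ.*-inverseʳ p {{ℚ.≢-nonZero p≢0}}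

  away⇒invertible : ∀ x → AwayFrom0 x → Σ[ y ∈ ℝ ] x *ʳ y ≈ʳ constʳ 1ℚ
  away⇒invertible x (δ , 0<δ , N , δ≤x) = y , mk≈ʳ (λ ε 0<ε → N , λ n n≥N →
      subst (ℚ._< ε) (≡.sym (cong (λ p → ℚ.∣ p ℚ.- 1ℚ ∣) (xy≡1 n n≥N))) 0<ε)
    where
    xy≡1 : ∀ n → n ≥ N → seq x n ℚ.* recip (seq x n) ≡ 1ℚ
    xy≡1 n n≥N = *-recip (seq x n) λ xₙ≡0 →
      ℚ.<-irrefl ≡.refl (ℚ.<-≤-trans 0<δ (subst (λ p → δ ℚ.≤ ℚ.∣ p ∣) xₙ≡0 (δ≤x n n≥N)))

    0<δδ : 0ℚ ℚ.< δ ℚ.* δ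
    0<δδ = *-pos 0<δ 0<δ

    -- δ² ∣1/p − 1/q∣ ≤ ∣p∣ ∣q∣ ∣1/p − 1/q∣ = ∣q − p∣
    estimate : ∀ p q p′ q′ → δ ℚ.≤ ℚ.∣ p ∣ → δ ℚ.≤ ℚ.∣ q ∣ → p ℚ.* p′ ≡ 1ℚ → q ℚ.* q′ ≡ 1ℚ →
               (δ ℚ.* δ) ℚ.* ℚ.∣ p′ ℚ.- q′ ∣ ℚ.≤ ℚ.∣ q ℚ.- p ∣
    estimate p q p′ q′ δ≤p δ≤q pp′≡1 qq′≡1 = ℚ.≤-trans
      (ℚ.*-monoʳ-≤-nonNeg ℚ.∣ p′ ℚ.- q′ ∣ {{ℚ.∣-∣-nonNeg (p′ ℚ.- q′)}} (*-mono-≤-abs p q 0<δ δ≤p δ≤q))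
      (ℚ.≤-reflexive (≡.trans
        (≡.trans (cong (ℚ._* ℚ.∣ p′ ℚ.- q′ ∣) (≡.sym (ℚ.∣p*q∣≡∣p∣*∣q∣ p q))) (≡.sym (ℚ.∣p*q∣≡∣p∣*∣q∣ (p ℚ.* q) (p′ ℚ.- q′))))
        (cong ℚ.∣_∣ (≡.trans
          (solveℚ 4 (λ p q p′ q′ → (p :* q) :* (p′ :- q′) := q :* (p :* p′) :- p :* (q :* q′)) ≡.refl p q p′ q′)
          (cong₂ ℚ._-_ (≡.trans (cong (q ℚ.*_) pp′≡1) (ℚ.*-identityʳ q))
                       (≡.trans (cong (p ℚ.*_) qq′≡1) (ℚ.*-identityʳ p)))))))

    y : ℝ
    seq y n = recip (seq x n)
    cauchy y ε 0<ε =
      let M , x~ = cauchy x ((δ ℚ.* δ) ℚ.* ε) (*-pos 0<δδ 0<ε)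
      in N ℕ.⊔ M , λ m n m≥ n≥ →
        let m≥N = ℕ.m⊔n≤o⇒m≤o N M m≥
            n≥N = ℕ.m⊔n≤o⇒m≤o N M n≥
        in ℚ.*-cancelˡ-<-nonNeg (δ ℚ.* δ) {{ℚ.nonNegative (ℚ.<⇒≤ 0<δδ)}}
             (ℚ.≤-<-trans
               (estimate (seq x m) (seq x n) (recip (seq x m)) (recip (seq x n))
                 (δ≤x m m≥N) (δ≤x n n≥N) (xy≡1 m m≥N) (xy≡1 n n≥N))
               (x~ n m (ℕ.m⊔n≤o⇒n≤o N M n≥) (ℕ.m⊔n≤o⇒n≤o N M m≥)))

  private
    0≤p² : ∀ p → 0ℚ ℚ.≤ p ℚ.* p
    0≤p² p = subst (0ℚ ℚ.≤_) (p²≡ p) (ℚ.nonNegative⁻¹ _ {{ℚ.nonNeg*nonNeg⇒nonNeg ℚ.∣ p ∣ {{ℚ.∣-∣-nonNeg p}} ℚ.∣ p ∣ {{ℚ.∣-∣-nonNeg p}}}})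
      where
      p²≡ : ∀ p → ℚ.∣ p ∣ ℚ.* ℚ.∣ p ∣ ≡ p ℚ.* p
      p²≡ p = [ (λ e → cong₂ ℚ._*_ e e) ,
                (λ e → ≡.trans (cong₂ ℚ._*_ e e) (solveℚ 1 (λ p → (:- p) :* (:- p) := p :* p) ≡.refl p)) ]′
                (ℚ.∣p∣≡p∨∣p∣≡-p p)

  away-sum-of-squares : ∀ x y → AwayFrom0 x → AwayFrom0 (x *ʳ x +ʳ y *ʳ y)
  away-sum-of-squares x y (δ , 0<δ , N , δ≤x) = δ ℚ.* δ , *-pos 0<δ 0<δ , N , λ n n≥N →
    let p = seq x n
        q = seq y n
    in subst (δ ℚ.* δ ℚ.≤_) (≡.sym (ℚ.0≤p⇒∣p∣≡p (ℚ.+-mono-≤ (0≤p² p) (0≤p² q))))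
      (subst (ℚ._≤ p ℚ.* p ℚ.+ q ℚ.* q) (ℚ.+-identityʳ _) (ℚ.+-mono-≤
        (ℚ.≤-trans (*-mono-≤-abs p p 0<δ (δ≤x n n≥N) (δ≤x n n≥N))
          (ℚ.≤-reflexive (≡.trans (≡.sym (ℚ.∣p*q∣≡∣p∣*∣q∣ p p)) (ℚ.0≤p⇒∣p∣≡p (0≤p² p)))))
        (0≤p² q)))

  private
    -- Two summands below o/4 have a sum below o/2, which is too small to lie within o/2 of o.
    no-small-summands : ∀ {o} p q → 0ℚ ℚ.< o → ℚ.∣ (p ℚ.+ q) ℚ.- o ∣ ℚ.< ½ ℚ.* o →
      ℚ.∣ p ∣ ℚ.< ½ ℚ.* (½ ℚ.* o) → ¬ (ℚ.∣ q ∣ ℚ.< ½ ℚ.* (½ ℚ.* o))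
    no-small-summands {o} p q 0<o s~o p< q< = ℚ.<-irrefl ≡.refl
      (subst (ℚ._< o) (≡.trans (cong ℚ.∣_∣ (solveℚ 2 (λ s o → (:- (s :- o)) :+ s := o) ≡.refl (p ℚ.+ q) o))
          (ℚ.0≤p⇒∣p∣≡p (ℚ.<⇒≤ 0<o)))
        (∣+∣<half+half (ℚ.- ((p ℚ.+ q) ℚ.- o)) (p ℚ.+ q)
          (subst (ℚ._< ½ ℚ.* o) (≡.sym (ℚ.∣-p∣≡∣p∣ ((p ℚ.+ q) ℚ.- o))) s~o)
          (∣+∣<half+half p q p< q<)))

  -- The sum is given as a bare rational sequence f; the contradiction arises at a single index
  -- beyond all three thresholds.
  no-small-sum : ∀ {o} (f : ℕ → ℚ) x y → 0ℚ ℚ.< o → (∀ n → f n ≡ seq x n ℚ.+ seq y n) →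
                 Null (λ n → f n ℚ.- o) →
                 EventuallyBelow (½ ℚ.* (½ ℚ.* o)) x → ¬ EventuallyBelow (½ ℚ.* (½ ℚ.* o)) y
  no-small-sum {o} f x y 0<o f≡x+y f~o (M , x<) (N , y<) =
    let L , f-o< = f~o (½ ℚ.* o) (halve 0<o)
        n    = L ℕ.⊔ (M ℕ.⊔ N)
        n≥MN = ℕ.m≤n⊔m L (M ℕ.⊔ N)
    in no-small-summands (seq x n) (seq y n) 0<o
         (subst (λ p → ℚ.∣ p ℚ.- o ∣ ℚ.< ½ ℚ.* o) (f≡x+y n) (f-o< n (ℕ.m≤m⊔n L (M ℕ.⊔ N))))
         (x< n (ℕ.m⊔n≤o⇒m≤o M N n≥MN)) (y< n (ℕ.m⊔n≤o⇒n≤o M N n≥MN))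

-- The complex numbers as a local ring with tight apartness

module Complexes where
  open Reals
  open import Algebra.Definitions {A = ℂ} _≈_ using (Congruent₁; Congruent₂)
  open import Algebra.Structures {A = ℂ} _≈_
    using (IsMagma; IsSemigroup; IsMonoid; IsGroup; IsAbelianGroup; IsRing)

  open +-*-Solver using (_:=_; _:+_; _:*_; :-_; _:-_; Polynomial; con) renaming (solve to solveℚ)

  private
    :0 :1 : ∀ {n} → Polynomial n
    :0 = con 0ℚ
    :1 = con 1ℚ

  -- Only the underlying rational sequences are compared: checking a conversion between
  -- compound real numbers would unfold their Cauchy moduli.
  ℂ-pointwise : ∀ {z w} → (∀ n → seq (re z) n ≡ seq (re w) n) → (∀ n → seq (im z) n ≡ seq (im w) n) → z ≈ w
  ℂ-pointwise re≡ im≡ = mk≈ (pointwise re≡) (pointwise im≡)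

  +-cong : Congruent₂ _+_
  +-cong (mk≈ p q) (mk≈ r s) = mk≈ (mk≈ʳ (+ʳ-cong p r .close)) (mk≈ʳ (+ʳ-cong q s .close))

  -‿cong : Congruent₁ (-_)
  -‿cong (mk≈ p q) = mk≈ (mk≈ʳ (-ʳ-cong p .close)) (mk≈ʳ (-ʳ-cong q .close))

  neg-cong : ∀ x y → x ≈ y → - x ≈ - y
  neg-cong x y (mk≈ p q) = mk≈ (mk≈ʳ (-ʳ-cong p .close)) (mk≈ʳ (-ʳ-cong q .close))

  *-cong : Congruent₂ _*_
  *-cong (mk≈ p q) (mk≈ r s) = mk≈
    (mk≈ʳ (+ʳ-cong (*ʳ-cong p r) (-ʳ-cong (*ʳ-cong q s)) .close))
    (mk≈ʳ (+ʳ-cong (*ʳ-cong p s) (*ʳ-cong q r) .close))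

  +-assoc : ∀ x y z → (x + y) + z ≈ x + (y + z)
  +-assoc x y z = ℂ-pointwise
    (λ n → ℚ.+-assoc (seq (re x) n) (seq (re y) n) (seq (re z) n))
    (λ n → ℚ.+-assoc (seq (im x) n) (seq (im y) n) (seq (im z) n))

  +-comm : ∀ x y → x + y ≈ y + x
  +-comm x y = ℂ-pointwise
    (λ n → ℚ.+-comm (seq (re x) n) (seq (re y) n)) (λ n → ℚ.+-comm (seq (im x) n) (seq (im y) n))

  +-identityˡ : ∀ x → 0# + x ≈ x
  +-identityˡ x = ℂ-pointwise (λ n → ℚ.+-identityˡ (seq (re x) n)) (λ n → ℚ.+-identityˡ (seq (im x) n))

  +-identityʳ : ∀ x → x + 0# ≈ x
  +-identityʳ x = ℂ-pointwise (λ n → ℚ.+-identityʳ (seq (re x) n)) (λ n → ℚ.+-identityʳ (seq (im x) n))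

  -‿inverseˡ : ∀ x → - x + x ≈ 0#
  -‿inverseˡ x = ℂ-pointwise (λ n → ℚ.+-inverseˡ (seq (re x) n)) (λ n → ℚ.+-inverseˡ (seq (im x) n))

  -‿inverseʳ : ∀ x → x + - x ≈ 0#
  -‿inverseʳ x = ℂ-pointwise (λ n → ℚ.+-inverseʳ (seq (re x) n)) (λ n → ℚ.+-inverseʳ (seq (im x) n))

  *-comm : ∀ x y → x * y ≈ y * x
  *-comm x y = ℂ-pointwise
    (λ n → solveℚ 4 (λ a b c d → a :* c :+ :- (b :* d) := c :* a :+ :- (d :* b)) ≡.refl
      (seq (re x) n) (seq (im x) n) (seq (re y) n) (seq (im y) n))
    (λ n → solveℚ 4 (λ a b c d → a :* d :+ b :* c := c :* b :+ d :* a) ≡.refl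
      (seq (re x) n) (seq (im x) n) (seq (re y) n) (seq (im y) n))

  *-assoc : ∀ x y z → (x * y) * z ≈ x * (y * z)
  *-assoc x y z = ℂ-pointwise
    (λ n → solveℚ 6 (λ a b c d e f → (a :* c :+ :- (b :* d)) :* e :+ :- ((a :* d :+ b :* c) :* f) :=
                                     a :* (c :* e :+ :- (d :* f)) :+ :- (b :* (c :* f :+ d :* e))) ≡.refl
      (seq (re x) n) (seq (im x) n) (seq (re y) n) (seq (im y) n) (seq (re z) n) (seq (im z) n))
    (λ n → solveℚ 6 (λ a b c d e f → (a :* c :+ :- (b :* d)) :* f :+ (a :* d :+ b :* c) :* e :=
                                     a :* (c :* f :+ d :* e) :+ b :* (c :* e :+ :- (d :* f))) ≡.refl
      (seq (re x) n) (seq (im x) n) (seq (re y) n) (seq (im y) n) (seq (re z) n) (seq (im z) n))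

  *-identityˡ : ∀ x → 1# * x ≈ x
  *-identityˡ x = ℂ-pointwise
    (λ n → solveℚ 2 (λ a b → :1 :* a :+ :- (:0 :* b) := a) ≡.refl (seq (re x) n) (seq (im x) n))
    (λ n → solveℚ 2 (λ a b → :1 :* b :+ :0 :* a := b) ≡.refl (seq (re x) n) (seq (im x) n))

  *-identityʳ : ∀ x → x * 1# ≈ x
  *-identityʳ x = ℂ-pointwise
    (λ n → solveℚ 2 (λ a b → a :* :1 :+ :- (b :* :0) := a) ≡.refl (seq (re x) n) (seq (im x) n))
    (λ n → solveℚ 2 (λ a b → a :* :0 :+ b :* :1 := b) ≡.refl (seq (re x) n) (seq (im x) n))

  *-distribˡ-+ : ∀ x y z → x * (y + z) ≈ x * y + x * z
  *-distribˡ-+ x y z = ℂ-pointwise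
    (λ n → solveℚ 6 (λ a b c d e f → a :* (c :+ e) :+ :- (b :* (d :+ f)) :=
                                     (a :* c :+ :- (b :* d)) :+ (a :* e :+ :- (b :* f))) ≡.refl
      (seq (re x) n) (seq (im x) n) (seq (re y) n) (seq (im y) n) (seq (re z) n) (seq (im z) n))
    (λ n → solveℚ 6 (λ a b c d e f → a :* (d :+ f) :+ b :* (c :+ e) := (a :* d :+ b :* c) :+ (a :* f :+ b :* e)) ≡.refl
      (seq (re x) n) (seq (im x) n) (seq (re y) n) (seq (im y) n) (seq (re z) n) (seq (im z) n))

  *-distribʳ-+ : ∀ x y z → (y + z) * x ≈ y * x + z * x
  *-distribʳ-+ x y z = ℂ-pointwise
    (λ n → solveℚ 6 (λ a b c d e f → (c :+ e) :* a :+ :- ((d :+ f) :* b) :=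
                                     (c :* a :+ :- (d :* b)) :+ (e :* a :+ :- (f :* b))) ≡.refl
      (seq (re x) n) (seq (im x) n) (seq (re y) n) (seq (im y) n) (seq (re z) n) (seq (im z) n))
    (λ n → solveℚ 6 (λ a b c d e f → (c :+ e) :* b :+ (d :+ f) :* a := (c :* b :+ d :* a) :+ (e :* b :+ f :* a)) ≡.refl
      (seq (re x) n) (seq (im x) n) (seq (re y) n) (seq (im y) n) (seq (re z) n) (seq (im z) n))

  -- The structures are built in stages to keep the implicit arguments of the congruence
  -- laws from being compared as compound complex numbers.
  +-isMagma : IsMagma _+_
  +-isMagma = record { isEquivalence = ℂ-isEquivalence ; ∙-cong = +-cong }

  +-isSemigroup : IsSemigroup _+_
  +-isSemigroup = record { isMagma = +-isMagma ; assoc = +-assoc }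

  +-isMonoid : IsMonoid _+_ 0#
  +-isMonoid = record { isSemigroup = +-isSemigroup ; identity = +-identityˡ , +-identityʳ }

  +-isGroup : IsGroup _+_ 0# (-_)
  +-isGroup = record { isMonoid = +-isMonoid ; inverse = -‿inverseˡ , -‿inverseʳ ; ⁻¹-cong = -‿cong }

  +-isAbelianGroup : IsAbelianGroup _+_ 0# (-_)
  +-isAbelianGroup = record { isGroup = +-isGroup ; comm = +-comm }

  +-*-isRing : IsRing _+_ _*_ (-_) 0# 1#
  +-*-isRing = record
    { +-isAbelianGroup = +-isAbelianGroup
    ; *-cong           = *-cong
    ; *-assoc          = *-assoc
    ; *-identity       = *-identityˡ , *-identityʳ
    ; distrib          = *-distribˡ-+ , *-distribʳ-+
    }

  +-*-isCommutativeRing : IsCommutativeRing _≈_ _+_ _*_ (-_) 0# 1#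
  +-*-isCommutativeRing = record { isRing = +-*-isRing ; *-comm = *-comm }

  ℂ-commutativeRing : CommutativeRing 0ℓ 0ℓ
  ℂ-commutativeRing = commutativeRing ℂ-rawRing +-*-isCommutativeRing

  open Units ℂ-commutativeRing

  private
    -- With u the reciprocal of the squared modulus, the inverse is the conjugate of z times u.
    conjugate-inverse : ∀ z u → (re z *ʳ re z +ʳ im z *ʳ im z) *ʳ u ≈ʳ constʳ 1ℚ → Invertible z
    conjugate-inverse z u nu≈1 = ((re z *ʳ u) +i (-ʳ (im z *ʳ u))) , mk≈
      (mk≈ʳ (null-resp
        (λ n → cong (ℚ._- 1ℚ) (solveℚ 3 (λ a b u → (a :* a :+ b :* b) :* u := a :* (a :* u) :+ :- (b :* (:- (b :* u)))) ≡.refl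
          (seq (re z) n) (seq (im z) n) (seq u n)))
        (nu≈1 .close)))
      (pointwise (λ n → solveℚ 3 (λ a b u → a :* (:- (b :* u)) :+ b :* (a :* u) := :0) ≡.refl
        (seq (re z) n) (seq (im z) n) (seq u n)))

    -- `away-sum-of-squares` needs the component known to be away from zero in first place; this
    -- version serves the imaginary part.
    swapped-conjugate-inverse : ∀ z u → (im z *ʳ im z +ʳ re z *ʳ re z) *ʳ u ≈ʳ constʳ 1ℚ → Invertible z
    swapped-conjugate-inverse z u nu≈1 = conjugate-inverse z u (mk≈ʳ (null-resp
      (λ n → cong (ℚ._- 1ℚ) (solveℚ 3 (λ a b u → (b :* b :+ a :* a) :* u := (a :* a :+ b :* b) :* u) ≡.refl
        (seq (re z) n) (seq (im z) n) (seq u n)))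
      (nu≈1 .close)))

  below-or-invertible : ∀ ε → 0ℚ ℚ.< ε → ∀ z →
    (EventuallyBelow ε (re z) × EventuallyBelow ε (im z)) ⊎ Invertible z
  below-or-invertible ε 0<ε z = [ (λ re< → [ (λ im< → inj₁ (re< , im<)) ,
      (λ im-away → inj₂ (let u , nu≈1 = away⇒invertible (im z *ʳ im z +ʳ re z *ʳ re z) (away-sum-of-squares (im z) (re z) im-away)
                         in swapped-conjugate-inverse z u nu≈1)) ]′
      (below-or-away ε 0<ε (im z))) ,
    (λ re-away → inj₂ (let u , nu≈1 = away⇒invertible (re z *ʳ re z +ʳ im z *ʳ im z) (away-sum-of-squares (re z) (im z) re-away)
                       in conjugate-inverse z u nu≈1)) ]′
    (below-or-away ε 0<ε (re z))

  private
    0<1 : 0ℚ ℚ.< 1ℚ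
    0<1 = ℚ.positive⁻¹ 1ℚ

  1≉0 : 1# ≉ 0#
  1≉0 (mk≈ re≈ _) = let N , 1< = re≈ .close 1ℚ 0<1 in ℚ.<-irrefl ≡.refl (1< N ℕ.≤-refl)

  -- For each ε the alternative of `below-or-invertible` collapses to smallness.
  tight : ∀ z → ¬ Invertible z → z ≈ 0#
  tight z z-ninv = mk≈
    (mk≈ʳ λ ε 0<ε → to-0 (re z) (proj₁ (below ε 0<ε)))
    (mk≈ʳ λ ε 0<ε → to-0 (im z) (proj₂ (below ε 0<ε)))
    where
    below : ∀ ε → 0ℚ ℚ.< ε → EventuallyBelow ε (re z) × EventuallyBelow ε (im z)
    below ε 0<ε = [ (λ small → small) , (λ z-inv → ⊥-elim (z-ninv z-inv)) ]′ (below-or-invertible ε 0<ε z)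

    to-0 : ∀ x {ε} → EventuallyBelow ε x → Σ[ N ∈ ℕ ] (∀ n → n ≥ N → ℚ.∣ seq x n ℚ.- 0ℚ ∣ ℚ.< ε)
    to-0 x {ε} (N , x<) = N , λ n n≥N →
      subst (λ p → ℚ.∣ p ∣ ℚ.< ε) (≡.sym (ℚ.+-identityʳ (seq x n))) (x< n n≥N)

  -- If u inverts x + y then x u + y u = 1, so the real parts of the two products cannot both be
  -- below 1/4. The one that is not small is invertible, and so is its factor.
  local : ∀ x y → Invertible (x + y) → Invertible x ⊎ Invertible y
  local x y (u , xyu≈1) = [ (λ (xu< , _) → [ (λ (yu< , _) → ⊥-elim (not-both xu< yu<)) ,
      (λ yu-inv → inj₂ (invertible-factorˡ y u yu-inv)) ]′ (dichotomy (y * u))) ,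
    (λ xu-inv → inj₁ (invertible-factorˡ x u xu-inv)) ]′ (dichotomy (x * u))
    where
    ¼ = ½ ℚ.* (½ ℚ.* 1ℚ)

    dichotomy : ∀ z → (EventuallyBelow ¼ (re z) × EventuallyBelow ¼ (im z)) ⊎ Invertible z
    dichotomy = below-or-invertible ¼ (halve (halve 0<1))

    not-both : EventuallyBelow ¼ (re (x * u)) → ¬ EventuallyBelow ¼ (re (y * u))
    not-both = no-small-sum {1ℚ} (λ n → seq (re ((x + y) * u)) n) (re (x * u)) (re (y * u)) 0<1
      (λ n → solveℚ 6 (λ a b c d e f → (a :+ c) :* e :+ :- ((b :+ d) :* f) :=
                                       (a :* e :+ :- (b :* f)) :+ (c :* e :+ :- (d :* f))) ≡.refl
        (seq (re x) n) (seq (im x) n) (seq (re y) n) (seq (im y) n) (seq (re u) n) (seq (im u) n))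
      (re≈ xyu≈1 .close)

-- The action of Galois automorphisms on the indices of the roots

least : ∀ {n p} {P : Fin n → Set p} → (∀ i → Dec (P i)) → Σ[ i ∈ Fin n ] P i →
        Σ[ i ∈ Fin n ] P i × (∀ j → P j → i Fin.≤ j)
least {suc n} {P = P} P? (i , Pi) with P? zero
... | yes P0 = zero , P0 , λ _ _ → z≤n
... | no ¬P0 = shift (least (P? ∘ suc) (pred i Pi))
  where
  pred : ∀ i → P i → Σ[ j ∈ Fin n ] P (suc j)
  pred zero    P0 = ⊥-elim (¬P0 P0)
  pred (suc j) Pj = j , Pj

  shift : Σ[ i ∈ Fin n ] P (suc i) × (∀ j → P (suc j) → i Fin.≤ j) →
          Σ[ i ∈ Fin (suc n) ] P i × (∀ j → P j → i Fin.≤ j)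
  shift (i , Pi , i≤) = suc i , Pi , λ where
    zero    P0 → ⊥-elim (¬P0 P0)
    (suc j) Pj → s≤s (i≤ j Pj)

module _ {ℓ} {K : Pred ℂ ℓ} {n} {μs : Vector ℂ n} (σ : GaloisAutomorphism K μs) where
  open GaloisAutomorphism
  private
    module σ = IsRingHomomorphism (to-homomorphism σ)

  to-add : ∀ {x y} (x∈L : x ∈ K [ μs ]) (y∈L : y ∈ K [ μs ]) →
    proj₁ (to σ (x + y , add x∈L y∈L)) ≈ proj₁ (to σ (x , x∈L)) + proj₁ (to σ (y , y∈L))
  to-add {x} {y} x∈L y∈L = σ.+-homo (x , x∈L) (y , y∈L)

  to-mul : ∀ {x y} (x∈L : x ∈ K [ μs ]) (y∈L : y ∈ K [ μs ]) →
    proj₁ (to σ (x * y , mul x∈L y∈L)) ≈ proj₁ (to σ (x , x∈L)) * proj₁ (to σ (y , y∈L))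
  to-mul {x} {y} x∈L y∈L = σ.*-homo (x , x∈L) (y , y∈L)

  to-neg : ∀ {x} (x∈L : x ∈ K [ μs ]) → proj₁ (to σ (- x , neg x∈L)) ≈ - proj₁ (to σ (x , x∈L))
  to-neg {x} x∈L = σ.-‿homo (x , x∈L)

-- A root may occur several times among the μs, so a Galois automorphism is made to permute
-- the least index of each distinct root and to fix all other indices; it also fixes the
-- least index of the root 1.
module GaloisPermutations {ℓ} {K : Pred ℂ ℓ} {m} (μs : Vector ℂ (suc m))
  (Root : Pred ℂ 0ℓ)
  (μ-root : ∀ i → Root (μs i))
  (1-root : Root 1#)
  (root-≟ : ∀ {x y} → Root x → Root y → Dec (x ≈ y))
  (root-find : ∀ {z} → Root z → Σ[ i ∈ Fin (suc m) ] z ≈ μs i)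
  (Galois-root : ∀ (σ : GaloisAutomorphism K μs) x → Root (proj₁ x) →
                 Root (proj₁ (GaloisAutomorphism.to σ x)))
  where
  private
    module G = Group (Gal K μs)
    module H = Group (S m)
    module ≈ = IsEquivalence ℂ-isEquivalence
  open GaloisAutomorphism

  abstract
    -- Outside the `abstract` block the index is known only through `≈μ-index` and `index-≤` and
    -- does not unfold to comparisons of roots.
    index : ∀ z → Root z → Fin (suc m)
    index z z-root = proj₁ (least (λ i → root-≟ z-root (μ-root i)) (root-find z-root))

    ≈μ-index : ∀ z z-root → z ≈ μs (index z z-root)
    ≈μ-index z z-root = proj₁ (proj₂ (least (λ i → root-≟ z-root (μ-root i)) (root-find z-root)))

    index-≤ : ∀ z z-root {i} → z ≈ μs i → index z z-root Fin.≤ i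
    index-≤ z z-root {i} = proj₂ (proj₂ (least (λ i → root-≟ z-root (μ-root i)) (root-find z-root))) i

  -- Minimality makes the index independent of the representative of a number and of the proof that
  -- it is a root.
  index-cong : ∀ {z w} (z-root : Root z) (w-root : Root w) → z ≈ w → index z z-root ≡ index w w-root
  index-cong {z} {w} z-root w-root z≈w = Fin.≤-antisym
    (index-≤ z z-root (≈.trans z≈w (≈μ-index w w-root)))
    (index-≤ w w-root (≈.trans (≈.sym z≈w) (≈μ-index z z-root)))

  Canonical : Pred (Fin (suc m)) _
  Canonical i = index (μs i) (μ-root i) ≡ i

  index-canonical : ∀ z z-root → Canonical (index z z-root)
  index-canonical z z-root = index-cong _ z-root (≈.sym (≈μ-index z z-root))

  μ-image : GaloisAutomorphism K μs → Fin (suc m) → ℂ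
  μ-image σ i = proj₁ (to σ (μs i , gen i))

  image-index : GaloisAutomorphism K μs → Fin (suc m) → Fin (suc m)
  image-index σ i = index (μ-image σ i) (Galois-root σ _ (μ-root i))

  private
    act′ : GaloisAutomorphism K μs → ∀ i → Dec (Canonical i) → Fin (suc m)
    act′ σ i (yes _) = image-index σ i
    act′ σ i (no  _) = i

  act : GaloisAutomorphism K μs → Fin (suc m) → Fin (suc m)
  act σ i = act′ σ i (index (μs i) (μ-root i) Fin.≟ i)

  act-canonical : ∀ σ {i} → Canonical i → act σ i ≡ image-index σ i
  act-canonical σ {i} i-can = go (index (μs i) (μ-root i) Fin.≟ i)
    where
    go : (d : Dec (Canonical i)) → act′ σ i d ≡ image-index σ i
    go (yes _)     = ≡.refl
    go (no ¬i-can) = ⊥-elim (¬i-can i-can)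

  act-noncanonical : ∀ σ {i} → ¬ Canonical i → act σ i ≡ i
  act-noncanonical σ {i} ¬i-can = go (index (μs i) (μ-root i) Fin.≟ i)
    where
    go : (d : Dec (Canonical i)) → act′ σ i d ≡ i
    go (yes i-can) = ⊥-elim (¬i-can i-can)
    go (no _)      = ≡.refl

  by-canonicity : ∀ {f g : Fin (suc m) → Fin (suc m)} →
    (∀ i → Canonical i → f i ≡ g i) → (∀ i → ¬ Canonical i → f i ≡ g i) → ∀ i → f i ≡ g i
  by-canonicity can noncan i with index (μs i) (μ-root i) Fin.≟ i
  ... | yes i-can = can i i-can
  ... | no ¬i-can = noncan i ¬i-can

  act-cong : ∀ {σ τ} → σ G.≈ τ → ∀ i → act σ i ≡ act τ i
  act-cong {σ} {τ} σ≈τ = by-canonicity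
    (λ i i-can → ≡.trans (act-canonical σ i-can)
      (≡.trans (index-cong {μ-image σ i} {μ-image τ i} _ _ (σ≈τ (μs i , gen i))) (≡.sym (act-canonical τ i-can))))
    (λ i ¬i-can → ≡.trans (act-noncanonical σ ¬i-can) (≡.sym (act-noncanonical τ ¬i-can)))

  act-∙ : ∀ σ τ i → act (σ G.∙ τ) i ≡ act σ (act τ i)
  act-∙ σ τ = by-canonicity
    (λ i i-can → begin
      act (σ G.∙ τ) i           ≡⟨ act-canonical (σ G.∙ τ) i-can ⟩
      -- The image of `μs i` under τ equals the root stored at its index, so σ sends both to equal
      -- numbers.
      image-index (σ G.∙ τ) i   ≡⟨ index-cong _ _ (to-cong σ (≈μ-index (μ-image τ i) _)) ⟩
      image-index σ (image-index τ i) ≡⟨ act-canonical σ (index-canonical (μ-image τ i) _) ⟨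
      act σ (image-index τ i)   ≡⟨ cong (act σ) (act-canonical τ i-can) ⟨
      act σ (act τ i)           ∎)
    (λ i ¬i-can → begin
      act (σ G.∙ τ) i           ≡⟨ act-noncanonical (σ G.∙ τ) ¬i-can ⟩
      i                         ≡⟨ act-noncanonical σ ¬i-can ⟨
      act σ i                   ≡⟨ cong (act σ) (act-noncanonical τ ¬i-can) ⟨
      act σ (act τ i)           ∎)
    where open ≡-Reasoning

  act-ε : ∀ i → act G.ε i ≡ i
  act-ε = by-canonicity
    (λ i i-can → ≡.trans (act-canonical G.ε i-can) (≡.trans (index-cong _ (μ-root i) ≈.refl) i-can))
    (λ i → act-noncanonical G.ε)

  i₁ : Fin (suc m)
  i₁ = index 1# 1-root

  act-i₁ : ∀ σ → act σ i₁ ≡ i₁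
  act-i₁ σ = ≡.trans (act-canonical σ (index-canonical 1# 1-root)) (index-cong _ 1-root
    (≈.trans (to-cong σ {μs i₁ , gen i₁} {1# , one} (≈.sym (≈μ-index 1# 1-root)))
      (IsRingHomomorphism.1#-homo (to-homomorphism σ))))

  permutation : GaloisAutomorphism K μs → Permutation′ (suc m)
  permutation σ = Perm.permutation (act σ) (act (σ G.⁻¹))
    (λ i → ≡.trans (≡.sym (act-∙ σ (σ G.⁻¹) i))
             (≡.trans (act-cong {σ G.∙ σ G.⁻¹} {G.ε} (G.inverseʳ σ) i) (act-ε i)))
    (λ i → ≡.trans (≡.sym (act-∙ (σ G.⁻¹) σ i))
             (≡.trans (act-cong {σ G.⁻¹ G.∙ σ} {G.ε} (G.inverseˡ σ) i) (act-ε i)))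

  φ : GaloisAutomorphism K μs → Permutation′ m
  φ σ = Perm.remove i₁ (permutation σ)

  -- `Perm.remove` omits `i₁` from the source and its image from the target; as `i₁` is fixed, the
  -- two renumberings agree. Identities for φ thereby reduce to identities for `act`, by injectivity
  -- of `punchIn`.
  punchIn-φ : ∀ σ j → punchIn i₁ (φ σ ⟨$⟩ʳ j) ≡ act σ (punchIn i₁ j)
  punchIn-φ σ j = ≡.trans (cong (λ i → punchIn i (φ σ ⟨$⟩ʳ j)) (≡.sym (act-i₁ σ)))
    (≡.sym (Perm.punchIn-permute (permutation σ) i₁ j))

  φ-cong : ∀ {σ τ} → σ G.≈ τ → φ σ H.≈ φ τ
  φ-cong {σ} {τ} σ≈τ j = Fin.punchIn-injective i₁ _ _
    (≡.trans (punchIn-φ σ j) (≡.trans (act-cong {σ} {τ} σ≈τ _) (≡.sym (punchIn-φ τ j))))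

  φ-∙ : ∀ σ τ → φ (σ G.∙ τ) H.≈ φ σ H.∙ φ τ
  φ-∙ σ τ j = Fin.punchIn-injective i₁ _ _ (begin
    punchIn i₁ (φ (σ G.∙ τ) ⟨$⟩ʳ j)         ≡⟨ punchIn-φ (σ G.∙ τ) j ⟩
    act (σ G.∙ τ) (punchIn i₁ j)            ≡⟨ act-∙ σ τ _ ⟩
    act σ (act τ (punchIn i₁ j))            ≡⟨ cong (act σ) (punchIn-φ τ j) ⟨
    act σ (punchIn i₁ (φ τ ⟨$⟩ʳ j))         ≡⟨ punchIn-φ σ (φ τ ⟨$⟩ʳ j) ⟨
    punchIn i₁ (φ σ ⟨$⟩ʳ (φ τ ⟨$⟩ʳ j))      ∎)
    where open ≡-Reasoning

  φ-ε : φ G.ε H.≈ H.ε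
  φ-ε j = Fin.punchIn-injective i₁ _ _ (≡.trans (punchIn-φ G.ε j) (act-ε _))

  φ-⁻¹ : ∀ σ → φ (σ G.⁻¹) H.≈ φ σ H.⁻¹
  φ-⁻¹ σ j = begin
    φ (σ G.⁻¹) ⟨$⟩ʳ j                           ≡⟨ Perm.inverseˡ (φ σ) ⟨
    φ σ ⟨$⟩ˡ (φ σ ⟨$⟩ʳ (φ (σ G.⁻¹) ⟨$⟩ʳ j))     ≡⟨ cong (φ σ ⟨$⟩ˡ_) (φ-∙ σ (σ G.⁻¹) j) ⟨
    φ σ ⟨$⟩ˡ (φ (σ G.∙ σ G.⁻¹) ⟨$⟩ʳ j)          ≡⟨ cong (φ σ ⟨$⟩ˡ_) (φ-cong {σ G.∙ σ G.⁻¹} {G.ε} (G.inverseʳ σ) j) ⟩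
    φ σ ⟨$⟩ˡ (φ G.ε ⟨$⟩ʳ j)                     ≡⟨ cong (φ σ ⟨$⟩ˡ_) (φ-ε j) ⟩
    φ σ ⟨$⟩ˡ j                                  ∎
    where open ≡-Reasoning

  -- Every root equals the one at its canonical index, so the images of the roots at canonical
  -- indices, which `act` records, determine all others.
  act-injective : ∀ {σ τ} → (∀ i → act σ i ≡ act τ i) → ∀ i → μ-image σ i ≈ μ-image τ i
  act-injective {σ} {τ} σ≡τ i =
    ≈.trans (to-cong σ (≈μ-index (μs i) _)) (≈.trans canonical (to-cong τ (≈.sym (≈μ-index (μs i) _))))
    where
    c : Fin (suc m)
    c = index (μs i) (μ-root i)

    c-can : Canonical c
    c-can = index-canonical (μs i) _

    same-index : image-index σ c ≡ image-index τ c
    same-index = ≡.trans (≡.sym (act-canonical σ c-can)) (≡.trans (σ≡τ c) (act-canonical τ c-can))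

    canonical : μ-image σ c ≈ μ-image τ c
    canonical = ≈.trans (≈μ-index (μ-image σ c) _)
      (≈.trans (≈.reflexive (cong μs same-index)) (≈.sym (≈μ-index (μ-image τ c) _)))

  -- Induction on the derivation of membership in `K [ μs ]`: each constructor is respected by both
  -- automorphisms.
  automorphism-ext : ∀ {σ τ} → (∀ i → μ-image σ i ≈ μ-image τ i) → σ G.≈ τ
  automorphism-ext {σ} {τ} σ≈τ (x , x∈L) = go x∈L
    where
    module σ = IsRingHomomorphism (to-homomorphism σ)
    module τ = IsRingHomomorphism (to-homomorphism τ)

    go : ∀ {x} (x∈L : x ∈ K [ μs ]) → proj₁ (to σ (x , x∈L)) ≈ proj₁ (to τ (x , x∈L))
    go (base x∈K)  = ≈.trans (fixes-K σ x∈K) (≈.sym (fixes-K τ x∈K))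
    go (gen i)     = σ≈τ i
    go (resp {x} {y} e x∈L) = ≈.trans (to-cong σ {y , resp e x∈L} {x , x∈L} (≈.sym e))
      (≈.trans (go x∈L) (to-cong τ {x , x∈L} {y , resp e x∈L} e))
    go zero        = ≈.trans σ.0#-homo (≈.sym τ.0#-homo)
    go one         = ≈.trans σ.1#-homo (≈.sym τ.1#-homo)
    go (add {x} {y} x∈L y∈L) = ≈.trans (to-add σ x∈L y∈L) (≈.trans
      (Complexes.+-cong {proj₁ (to σ (x , x∈L))} {proj₁ (to τ (x , x∈L))} {proj₁ (to σ (y , y∈L))} {proj₁ (to τ (y , y∈L))}
        (go x∈L) (go y∈L))
      (≈.sym (to-add τ x∈L y∈L)))
    go (mul {x} {y} x∈L y∈L) = ≈.trans (to-mul σ x∈L y∈L) (≈.trans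
      (Complexes.*-cong {proj₁ (to σ (x , x∈L))} {proj₁ (to τ (x , x∈L))} {proj₁ (to σ (y , y∈L))} {proj₁ (to τ (y , y∈L))}
        (go x∈L) (go y∈L))
      (≈.sym (to-mul τ x∈L y∈L)))
    go (neg {x} x∈L) = ≈.trans (to-neg σ x∈L) (≈.trans
      (Complexes.neg-cong (proj₁ (to σ (x , x∈L))) (proj₁ (to τ (x , x∈L))) (go x∈L)) (≈.sym (to-neg τ x∈L)))

  φ-determines-act : ∀ {σ τ} → φ σ H.≈ φ τ → ∀ i → act σ i ≡ act τ i
  φ-determines-act {σ} {τ} φσ≈φτ i = go (i₁ Fin.≟ i)
    where
    go : Dec (i₁ ≡ i) → act σ i ≡ act τ i
    go (yes i₁≡i) = ≡.subst (λ i → act σ i ≡ act τ i) i₁≡i (≡.trans (act-i₁ σ) (≡.sym (act-i₁ τ)))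
    go (no  i₁≢i) = ≡.subst (λ i → act σ i ≡ act τ i) (Fin.punchIn-punchOut i₁≢i)
      (≡.trans (≡.sym (punchIn-φ σ (punchOut i₁≢i)))
        (≡.trans (cong (punchIn i₁) (φσ≈φτ (punchOut i₁≢i))) (punchIn-φ τ (punchOut i₁≢i))))

  φ-injective : ∀ {σ τ} → φ σ H.≈ φ τ → σ G.≈ τ
  φ-injective {σ} {τ} φσ≈φτ =
    automorphism-ext {σ} {τ} (act-injective {σ} {τ} (φ-determines-act {σ} {τ} φσ≈φτ))

  Image : Pred (Permutation′ m) ℓ
  Image π = Σ[ σ ∈ GaloisAutomorphism K μs ] φ σ H.≈ π

  image-isSubgroup : IsSubgroup (S m) Image
  image-isSubgroup = record
    { respects  = λ { {π} {ρ} π≈ρ (σ , φσ≈π) → σ , H.trans {φ σ} {π} {ρ} φσ≈π π≈ρ }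
    ; ∙-closed  = λ { {π} {ρ} (σ , φσ≈π) (τ , φτ≈ρ) → σ G.∙ τ ,
        H.trans {φ (σ G.∙ τ)} {φ σ H.∙ φ τ} {π H.∙ ρ} (φ-∙ σ τ)
          (H.∙-cong {φ σ} {π} {φ τ} {ρ} φσ≈π φτ≈ρ) }
    ; ε-closed  = G.ε , φ-ε
    ; ⁻¹-closed = λ { {π} (σ , φσ≈π) → σ G.⁻¹ ,
        H.trans {φ (σ G.⁻¹)} {φ σ H.⁻¹} {π H.⁻¹} (φ-⁻¹ σ) (H.⁻¹-cong {φ σ} {π} φσ≈π) }
    }

  Gal-isomorphic : IsomorphicToSubgroupOf (Gal K μs) (S m)
  Gal-isomorphic = Image , image-isSubgroup , (λ σ → φ σ , σ , λ _ → ≡.refl) , record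
    { isGroupMonomorphism = record
      { isGroupHomomorphism = record
        { isMonoidHomomorphism = record
          { isMagmaHomomorphism = record
            { isRelHomomorphism = record { cong = λ {σ} {τ} → φ-cong {σ} {τ} }
            ; homo              = φ-∙
            }
          ; ε-homo = φ-ε
          }
        ; ⁻¹-homo = φ-⁻¹
        }
      ; injective = λ {σ} {τ} → φ-injective {σ} {τ}
      }
    ; surjective = λ (π , σ , φσ≈π) → σ , λ {τ} τ≈σ →
        H.trans {φ τ} {φ σ} {π} (φ-cong {τ} {σ} τ≈σ) φσ≈π
    }

-- Specialisation to a number field inside ℂ

module _ {ℓ} (K : Pred ℂ ℓ) (K-numberField : IsNumberField K) where
  open Complexes using (ℂ-commutativeRing; +-*-isCommutativeRing; ℂ-pointwise; 1≉0; local; tight)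
  open CombinedMatrices ℂ-rawRing +-*-isCommutativeRing
  open IsSubfield (IsNumberField.isSubfield K-numberField)
  private module ≈ = IsEquivalence ℂ-isEquivalence

  K-subring : PolynomialEvaluation.IsSubring ℂ-commutativeRing K
  K-subring = record
    { 0-closed   = 0-closed
    ; 1-closed   = 1-closed
    ; +-closed   = +-closed
    ; *-closed   = *-closed
    ; neg-closed = neg-closed
    }

  fromℚ-0* : ∀ {q} z → q ≡ 0ℚ → fromℚ q * z ≈ 0#
  fromℚ-0* z ≡.refl = ℂ-pointwise
    (λ n → solve 2 (λ a b → con 0ℚ :* a :+ :- (con 0ℚ :* b) := con 0ℚ) ≡.refl (seq (re z) n) (seq (im z) n))
    (λ n → solve 2 (λ a b → con 0ℚ :* b :+ con 0ℚ :* a := con 0ℚ) ≡.refl (seq (re z) n) (seq (im z) n))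
    where open +-*-Solver

  -- Equality with 0 is read off the rational coordinates with respect to the basis of K.
  K-discrete : ∀ {x} → x ∈ K → x ≈ 0# ⊎ (Σ[ y ∈ ℂ ] (y ∈ K) × (x * y ≈ 1#))
  K-discrete {x} x∈K = go (spanning x∈K)
    where
    open IsNumberField K-numberField using (spanning; independent)

    go : Σ[ q ∈ Vector ℚ (IsNumberField.degree K-numberField) ]
           (x ≈ sum (λ i → fromℚ (q i) * IsNumberField.basis K-numberField i)) →
         x ≈ 0# ⊎ (Σ[ y ∈ ℂ ] (y ∈ K) × (x * y ≈ 1#))
    go (q , x≈) = decide (Fin.all? (λ i → q i ℚ.≟ 0ℚ))
      where
      decide : Dec (∀ i → q i ≡ 0ℚ) → x ≈ 0# ⊎ (Σ[ y ∈ ℂ ] (y ∈ K) × (x * y ≈ 1#))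
      decide (yes q≡0) = inj₁ (≈.trans x≈ (sum-of-zeros (λ i → fromℚ (q i) * IsNumberField.basis K-numberField i)
        (λ i → fromℚ-0* (IsNumberField.basis K-numberField i) (q≡0 i))))
      decide (no  q≢0) = inj₂ (inverse x∈K λ x≈0 → q≢0 (independent q (≈.trans (≈.sym x≈) x≈0)))

  module _ {n} (A : Matrix n) (A∈GL : GL K A) where

    𝒞-entry : ∀ i j → 𝒞 A A∈GL i j ≈ A i j * GL.inv A∈GL j i
    𝒞-entry = ∘ᴹ-entry A (GL.inv A∈GL ᵀ) (GL.inv A∈GL) (λ _ _ → ≈.refl)

    𝒞∈K : ∀ i j → 𝒞 A A∈GL i j ∈ K
    𝒞∈K i j = resp-≈ (≈.sym (𝒞-entry i j)) (*-closed (GL.entries∈K A∈GL i j) (GL.inv∈K A∈GL j i))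

    abstract
      -- Taken from the given inverse, whose entries lie in K, so that membership in K follows by
      -- closure of determinants.
      1/det : ℂ
      1/det = det (GL.inv A∈GL)

      1/det≈ : 1/det ≈ det (GL.inv A∈GL)
      1/det≈ = ≈.refl

      1/det∈K : 1/det ∈ K
      1/det∈K = det∈K K 1≉0 local tight K-subring K-discrete (GL.inv∈K A∈GL)

    -- Here and below an equation is rebuilt from its rational estimates, so that its two
    -- presentations are only compared as rational sequences.
    det*1/det : det A * 1/det ≈ 1#
    det*1/det =
      let h = det-inverse A (GL.inv A∈GL) {det A} {1/det} (GL.inverseʳ A∈GL) ≈.refl 1/det≈
      in mk≈ (mk≈ʳ (h .re≈ .close)) (mk≈ʳ (h .im≈ .close))

    entries : ∀ i j → 𝒞 A A∈GL i j ≈ (sign (toℕ i ℕ.+ toℕ j) * 1/det) * (A i j * minor A i j)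
    entries i j =
      let s   = sign (toℕ i ℕ.+ toℕ j)
          sd≈ = ≈.refl {s * 1/det}
          am≈ = ≈.refl {A i j * minor A i j}
          h   = entry-formula A (GL.inv A∈GL) (GL.inverseˡ A∈GL) (GL.inverseʳ A∈GL) i j
                  {s} {1/det} {s * 1/det} {minor A i j} {A i j * minor A i j} {𝒞 A A∈GL i j}
                  ≈.refl 1/det≈ (mk≈ (mk≈ʳ (sd≈ .re≈ .close)) (mk≈ʳ (sd≈ .im≈ .close)))
                  ≈.refl (mk≈ (mk≈ʳ (am≈ .re≈ .close)) (mk≈ʳ (am≈ .im≈ .close)))
                  (𝒞-entry i j)
      in mk≈ (mk≈ʳ (h .re≈ .close)) (mk≈ʳ (h .im≈ .close))

    trace-of : ∀ {f : Vector ℂ n} {S} → f ≡ (λ i → A i i * minor A i i) → S ≡ sum (λ i → A i i * minor A i i) →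
               tr (𝒞 A A∈GL) ≈ 1/det * S
    trace-of {f} {S} f≡ S≡ =
      trace-formula A (GL.inv A∈GL) (GL.inverseˡ A∈GL) (GL.inverseʳ A∈GL) (𝒞 A A∈GL) (λ i → minor A i i) f {1/det} {S}
        (λ i → 𝒞-entry i i) 1/det≈ (λ _ → ≈.refl)
        (λ i → let f≈ = ≈.reflexive (≡.cong (λ f → f i) f≡) in mk≈ (mk≈ʳ (f≈ .re≈ .close)) (mk≈ʳ (f≈ .im≈ .close)))
        (≈.reflexive (≡.trans S≡ (≡.cong sum (≡.sym f≡))))

    -- S stands for a sum that conversion checking must not unfold.
    trace-at : ∀ {S} → S ≡ sum (λ i → A i i * minor A i i) → tr (𝒞 A A∈GL) ≈ 1/det * S
    trace-at {S} S≡ = trace-of {_} {S} ≡.refl S≡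

    trace : tr (𝒞 A A∈GL) ≈ 1/det * sum (λ i → A i i * minor A i i)
    trace = let p = trace-at ≡.refl in p

    ones : ∀ i → vectorSum basisVector i ≈ 1#
    ones = all-ones {n} (basisVector {n}) (λ _ _ → ≈.refl)

    eigenvector : Fin n → IsEigenvector (𝒞 A A∈GL) 1# (vectorSum basisVector)
    eigenvector i = ones-isEigenvector A (GL.inv A∈GL) 1≉0 i (GL.inverseʳ A∈GL) 𝒞-entry ≈.refl ones

    reversed-GL : ∀ (B P : Matrix n) → (∀ i j → B i j ≈ A (opposite i) (opposite j)) →
                  (∀ i j → P i j ≈ GL.inv A∈GL (opposite i) (opposite j)) → GL K B
    reversed-GL B P B≈ P≈ = record
      { entries∈K = λ i j → resp-≈ (≈.sym (B≈ i j)) (GL.entries∈K A∈GL (opposite i) (opposite j))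
      ; inv       = P
      ; inv∈K     = λ i j → resp-≈ (≈.sym (P≈ i j)) (GL.inv∈K A∈GL (opposite i) (opposite j))
      ; inverseˡ  = reversed-inverse (GL.inv A∈GL) A P B (GL.inverseˡ A∈GL) P≈ B≈
      ; inverseʳ  = reversed-inverse A (GL.inv A∈GL) B P (GL.inverseʳ A∈GL) B≈ P≈
      }

    ℛ-GL : GL K (ℛ A)
    ℛ-GL = reversed-GL _ (λ i j → GL.inv A∈GL (opposite i) (opposite j)) (ℛ-entry A) (λ _ _ → ≈.refl)

  𝒞-reversed : ∀ {n} (A : Matrix n) (A∈GL : GL K A) (B : Matrix n) (B∈GL : GL K B) →
    (∀ i j → B i j ≈ A (opposite i) (opposite j)) →
    ∀ (M : Matrix n) → M ≡ 𝒞 A A∈GL → 𝒞 B B∈GL ≈ᴹ ℛ M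
  𝒞-reversed {n} A A∈GL B B∈GL B≈ M M≡ i j = reversed-combined A (GL.inv A∈GL) B (GL.inv B∈GL)
    (GL.inverseˡ A∈GL) B≈ (GL.inverseʳ B∈GL) i j
    (𝒞-entry B B∈GL i j) (≈.trans (ℛ-entry M i j) (M≈ (opposite i) (opposite j)))
    where
    M≈ : ∀ i j → M i j ≈ A i j * GL.inv A∈GL j i
    M≈ i j = ≈.trans (≈.reflexive (≡.cong (λ M → M i j) M≡)) (𝒞-entry {n} A A∈GL i j)

  𝒞-ℛ : ∀ {n} (A : Matrix n) (A∈GL : GL K A) (ℛA∈GL : GL K (ℛ A)) → 𝒞 (ℛ A) ℛA∈GL ≈ᴹ ℛ (𝒞 A A∈GL)
  𝒞-ℛ {n} A A∈GL ℛA∈GL = let p = 𝒞-reversed {n} A A∈GL _ ℛA∈GL (ℛ-entry {n} A) _ ≡.refl in p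

  module _ {m} (A : Matrix (suc m)) (A∈GL : GL K A) (eig : Vector ℂ (suc m)) where

    abstract
      -- Abstract, so that `galois` works with the interface of `RootTheory` and never with the
      -- characteristic polynomial over ℂ.
      eigenvalues : IsSpectrum (𝒞 A A∈GL) eig → RootTheory K eig
      eigenvalues = combined-roots K 1≉0 local tight K-subring K-discrete A (GL.inv A∈GL) (𝒞 A A∈GL)
        (GL.inverseˡ A∈GL) (𝒞-entry A A∈GL) (𝒞∈K A A∈GL) eig

    galois : RootTheory K eig → IsomorphicToSubgroupOf (Gal K eig) (S m)
    galois roots = GaloisPermutations.Gal-isomorphic {K = K} eig Root μ-root 1-root root-≟ root-find
      (λ σ (x , x∈L) → preserved (λ {x} x∈L → proj₁ (GaloisAutomorphism.to σ (x , x∈L))) base add mul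
        (λ {x} {y} x∈L y∈L → GaloisAutomorphism.to-cong σ {x , x∈L} {y , y∈L})
        (GaloisAutomorphism.fixes-K σ) (to-add σ) (to-mul σ) x∈L)
      where open RootTheory roots

theorem1 : ∀ {ℓ} (K : Pred ℂ ℓ) → IsNumberField K →
    (n : ℕ) .{{_ : NonZero n}} (A : Matrix n) (A∈GL : GL K A) →
    (eig : Vector ℂ n) → IsSpectrum (𝒞 A A∈GL) eig →
    (Σ[ 1/det ∈ ℂ ] ((1/det ∈ K) × (det A * 1/det ≈ 1#) ×
    (∀ i j → 𝒞 A A∈GL i j ≈ (sign (toℕ i ℕ.+ toℕ j) * 1/det) * (A i j * minor A i j)) ×
    (tr (𝒞 A A∈GL) ≈ 1/det * sum (λ i → A i i * minor A i i)))) ×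
    IsEigenvector (𝒞 A A∈GL) 1# (vectorSum basisVector) ×
    IsomorphicToSubgroupOf (Gal K eig) (S (n ℕ.∸ 1)) ×
    (GL K (ℛ A) × (∀ (ℛA∈GL : GL K (ℛ A)) → 𝒞 (ℛ A) ℛA∈GL ≈ᴹ ℛ (𝒞 A A∈GL)))
-- The `NonZero` instance excludes size zero; at `suc m` the symmetric group of the statement
-- computes to `S m`.
theorem1 K K-nf (suc m) A A∈GL eig spectrum =
  (1/det K K-nf A A∈GL , 1/det∈K K K-nf A A∈GL , det*1/det K K-nf A A∈GL , entries K K-nf A A∈GL , trace K K-nf A A∈GL) ,
  eigenvector K K-nf A A∈GL zero ,
  galois K K-nf A A∈GL eig (eigenvalues K K-nf A A∈GL eig spectrum) ,
  ℛ-GL K K-nf A A∈GL ,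
  𝒞-ℛ K K-nf A A∈GL
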